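{- Let $b,k$ and $n$ be positive integers with $n\equiv k \pmod 2$ and $b\equiv 1 \pmod 2$, and let $G$ be a $(k+1)$-connected graph of order $$n\geq\max\Big\{\frac{b^{2}k^{2}-2b^{2}k\delta-4b^{2}k-bk+b^{2}\delta^{2}+4b^{2}\delta+7b\delta+b^{2}+8b+1}{6b},\ (b+5)\delta-(b+4)k-b+1+\frac{5}{b}\Big\}$$ with minimum degree $\delta$. If $$e(G)\geq e\big(K_{\delta}\vee(K_{n-(b+1)\delta+bk-1}\cup(b\delta-bk+1)K_1)\big),$$ then $G$ is $k$-critical with respect to $[1,b]$-odd factor, unless $G=K_{\delta}\vee(K_{n-(b+1)\delta+bk-1}\cup(b\delta-bk+1)K_1)$.
   Context: All graphs are finite, undirected and simple. $e(G)$ denotes the number of edges of $G$. $K_m$ is the complete graph on $m$ vertices, $tK_1$ is the edgeless graph on $t$ vertices, $G_1\cup G_2$ is the disjoint union of vertex-disjoint graphs, and $G_1\vee G_2$ (join) is obtained from $G_1\cup G_2$ by adding all edges between $V(G_1)$ and $V(G_2)$. A graph $G$ of order $n$ is $m$-connected if $n>m$ and $G-X$ is connected for every $X\subseteq V(G)$ with $|X|<m$. For an odd positive integer $b$, a $[1,b]$-odd factor of a graph $G$ is a spanning subgraph $F$ such that $d_F(v)\in\{1,3,\ldots,b\}$ for every $v\in V(G)$. For a positive integer $k$, a graph $G$ of order $n\geq k+2$ is $k$-critical with respect to $[1,b]$-odd factor if for every $X\subseteq V(G)$ with $|X|=k$, the graph $G-X$ has a $[1,b]$-odd factor. -}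

module Defs where

open import Data.Nat using (ℕ; zero; suc; _+_; _*_; _∸_; _≤_; _<_; _%_)
open import Data.Nat.Base using (_<ᵇ_)
open import Data.Bool using (Bool; true; false; _∧_; not; if_then_else_)
open import Data.Fin using (Fin; toℕ; splitAt; _≟_)
open import Data.Fin.Subset using (Subset; _∈_; _∉_; ∣_∣)
open import Data.List using (List; map; allFin)
open import Data.Nat.ListAction using (sum)
open import Data.Sum using (_⊎_; inj₁; inj₂)
open import Data.Product using (_×_; Σ; ∃)
open import Relation.Nullary.Decidable using (⌊_⌋)
open import Relation.Binary.PropositionalEquality using (_≡_)
open import Function.Bundles using (_⤖_; Bijection)

Adj : ℕ → Set
Adj n = Fin n → Fin n → Bool

record Graph (n : ℕ) : Set where
  field
    adj    : Adj n
    sym    : ∀ i j → adj i j ≡ adj j i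
    irrefl : ∀ i → adj i i ≡ false
open Graph public

deg : ∀ {n} → Adj n → Fin n → ℕ
deg {n} A v = sum (map (λ j → if A v j then 1 else 0) (allFin n))

edges : ∀ {n} → Adj n → ℕ
edges {n} A = sum (map (λ i → sum (map (λ j →
  if (toℕ i <ᵇ toℕ j) ∧ A i j then 1 else 0) (allFin n))) (allFin n))

IsMinDegree : ∀ {n} → Graph n → ℕ → Set
IsMinDegree G d = (∀ v → d ≤ deg (adj G) v) × ∃ (λ v → deg (adj G) v ≡ d)

data Reach {n : ℕ} (G : Graph n) (X : Subset n) : Fin n → Fin n → Set where
  here : ∀ {u} → Reach G X u u
  step : ∀ {u v w} → adj G u v ≡ true → v ∉ X → Reach G X v w → Reach G X u w

ConnectedMinus : ∀ {n} → Graph n → Subset n → Set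
ConnectedMinus {n} G X = ∀ (u v : Fin n) → u ∉ X → v ∉ X → Reach G X u v

IsConnectedK : ∀ {n} → ℕ → Graph n → Set
IsConnectedK {n} m G = (m < n) × (∀ (X : Subset n) → ∣ X ∣ < m → ConnectedMinus G X)

-- G - X has a [1,b]-odd factor: a spanning subgraph F of G - X
-- (represented on Fin n with no edges meeting X) with every degree in {1,3,...,b}
HasOddFactorMinus : ∀ {n} → ℕ → Graph n → Subset n → Set
HasOddFactorMinus {n} b G X = Σ (Adj n) λ F →
    (∀ i j → F i j ≡ F j i)
  × (∀ i j → F i j ≡ true → adj G i j ≡ true)
  × (∀ i j → i ∈ X → F i j ≡ false)
  × (∀ v → v ∉ X → (deg F v % 2 ≡ 1) × (deg F v ≤ b))

IsKCritical : ∀ {n} → ℕ → ℕ → Graph n → Set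
IsKCritical {n} k b G =
  (k + 2 ≤ n) × (∀ (X : Subset n) → ∣ X ∣ ≡ k → HasOddFactorMinus b G X)

complete : (m : ℕ) → Adj m
complete m i j = not ⌊ i ≟ j ⌋

empty : (t : ℕ) → Adj t
empty t i j = false

union : ∀ {a c} → Adj a → Adj c → Adj (a + c)
union {a} A C i j with splitAt a i | splitAt a j
... | inj₁ x | inj₁ y = A x y
... | inj₂ x | inj₂ y = C x y
... | _ | _ = false

join : ∀ {a c} → Adj a → Adj c → Adj (a + c)
join {a} A C i j with splitAt a i | splitAt a j
... | inj₁ x | inj₁ y = A x y
... | inj₂ x | inj₂ y = C x y
... | _ | _ = true

Iso : ∀ {n m} → Graph n → Adj m → Set
Iso {n} {m} G H = Σ (Fin n ⤖ Fin m) λ f →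
  ∀ i j → adj G i j ≡ H (Bijection.to f i) (Bijection.to f j)

-- sizes of the parts of K_δ ∨ (K_{n-(b+1)δ+bk-1} ∪ (bδ-bk+1)K_1)
cliqueSize : ℕ → ℕ → ℕ → ℕ → ℕ
cliqueSize n b k d = (n + b * k) ∸ ((b + 1) * d + 1)

indepSize : ℕ → ℕ → ℕ → ℕ
indepSize b k d = (b * d ∸ b * k) + 1

extremal : (n b k d : ℕ) → Adj (d + (cliqueSize n b k d + indepSize b k d))
extremal n b k d =
  join (complete d) (union (complete (cliqueSize n b k d)) (empty (indepSize b k d)))

{-# OPTIONS --safe #-}

-- Call a factor F of a graph A with deg F ≤ g and deg F ≡ g (mod 2) a parity factor. It exists as
-- soon as, for every set S of removed vertices, the rest has at most g(S) components of odd weight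
-- (Tutte for g = 1, Amahashi for g = b). Induct on the number of edges. If S attains equality and
-- touches an edge, take such an S with as few vertices as possible in odd components: by Hall's
-- theorem every odd component can be linked to S so that each s in S gets exactly g(s) links, and
-- the condition survives after deleting S and lowering g at the linked vertices. If no such S
-- exists, the condition has slack 2 and any single edge can be either deleted or used.
--
-- If G - X has no [1,b]-odd factor, some T containing X, with |T| = s, therefore leaves at least
-- b(s - k) + 2 odd components. Convexity bounds the number of edges by that of a join of K_s with
-- one large clique and equal small ones. For s = k this contradicts connectivity; for k < s < δ all
-- components have at least δ + 1 - s vertices and the count is too small; for s > δ it is too small
-- because of the lower bound on n; for s = δ equality forces the extremal graph.
module Submission where

-- The induction needs a varying `g`: its steps lower `g` at single vertices, and a prescribed set
-- `X` is discarded by isolating its vertices and setting `g` to 0 there. Equality or slack 2 are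
-- the only alternatives, since the total weight is even and both sides of the condition are
-- therefore congruent modulo 2. Minimality matters because it lets the link to an odd cell end at
-- any vertex of it: a tight refinement of the cell leaves no vertex outside its odd pieces. No
-- slack is available for removed sets that meet no edge; there every cell has to be even, and this
-- decides between the two treatments of an edge, according to whether it is a bridge with odd
-- sides. Labellings have unboundedly many labels, so the existence of a tight one is settled only
-- under double negation; a factor is a finite object with decidable properties, so the double
-- negation disappears at the end. Edges are counted as ordered pairs with the diagonal added: a
-- clique on `m` vertices then contributes `m * m`, without halves or subtractions.

module OddFactors where

  open import Defs hiding (sym)
  import Data.Bool as Bool
  import Data.Fin.Permutation as Permutation
  import Data.Integer as ℤ
  import Data.Integer.Properties as ℤ
  import Data.Nat as ℕ
  import Data.Vec as Vec
  open import Data.Bool using (Bool; true; false; _∧_; _∨_; not; if_then_else_)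
  open import Data.Bool.Properties using (∧-comm; ∧-identityʳ; ∨-comm)
  open import Data.Empty using (⊥; ⊥-elim)
  open import Data.Fin using (Fin; zero; suc; toℕ; splitAt; combine; remQuot; punchIn; _↑ˡ_; _↑ʳ_; _≟_)
  open import Data.Fin.Permutation using (Permutation; _⟨$⟩ʳ_; insert; insert-punchIn)
  open import Data.Fin.Properties using (any?; all?; suc-injective; splitAt-↑ˡ; splitAt-↑ʳ; ↑ˡ-injective; ↑ʳ-injective; join-splitAt; toℕ-injective; remQuot-combine)
  open import Data.Fin.Subset using (Subset; ∣_∣; _∈_; _∉_)
  open import Data.Fin.Subset.Properties using (anySubset?)
  open import Data.Integer.Tactic.RingSolver using () renaming (solve-∀ to ℤ-solve-∀)
  open import Data.List using (map; allFin; tabulate)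
  open import Data.List.Properties using (map-tabulate)
  open import Data.Nat using (ℕ; zero; suc; _+_; _*_; _∸_; _≤_; _<_; _%_; _<ᵇ_; z≤n; s≤s; _≤?_)
  open import Data.Nat.DivMod using (%-distribˡ-+; %-distribˡ-*; m%n<n; m%n%n≡m%n; m%n≤m)
  open import Data.Nat.ListAction using (sum)
  open import Data.Nat.Properties hiding (_≟_; suc-injective)
  open import Data.Nat.Tactic.RingSolver using (solve-∀)
  open import Data.Product using (_×_; Σ; ∃; _,_; proj₁; proj₂)
  open import Data.Sum using (_⊎_; inj₁; inj₂; [_,_]′)
  open import Data.Vec.Properties using (lookup∘tabulate; []=⇒lookup; lookup⇒[]=)
  open import Function using (_∘_)
  open import Function.Bundles using (Bijection)
  open import Function.Properties.Inverse using (↔⇒⤖)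
  open import Relation.Binary.Definitions using (tri<; tri≈; tri>)
  open import Relation.Binary.PropositionalEquality using (_≡_; _≢_; refl; sym; trans; cong; cong₂; subst; subst₂; module ≡-Reasoning)
  open import Relation.Nullary using (¬_; Dec; yes; no)
  open import Relation.Nullary.Decidable using (⌊_⌋; decidable-stable; _×-dec_; _→-dec_)

  -- Indicators and finite sums

  ⟦_⟧ : Bool → ℕ
  ⟦ true ⟧ = 1
  ⟦ false ⟧ = 0

  infix 4 _==_
  _==_ : ∀ {n} → Fin n → Fin n → Bool
  i == j = ⌊ i ≟ j ⌋

  ==-refl : ∀ {n} (i : Fin n) → (i == i) ≡ true
  ==-refl i with i ≟ i
  ... | yes _ = refl
  ... | no ¬p = ⊥-elim (¬p refl)

  ==⇒≡ : ∀ {n} {i j : Fin n} → (i == j) ≡ true → i ≡ j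
  ==⇒≡ {i = i} {j} e with i ≟ j
  ==⇒≡ e  | yes p = p
  ==⇒≡ () | no _

  ≢⇒== : ∀ {n} {i j : Fin n} → i ≢ j → (i == j) ≡ false
  ≢⇒== {i = i} {j} ne with i ≟ j
  ... | yes p = ⊥-elim (ne p)
  ... | no _ = refl

  ==-sym : ∀ {n} (i j : Fin n) → (i == j) ≡ (j == i)
  ==-sym i j with i ≟ j | j ≟ i
  ... | yes _ | yes _ = refl
  ... | yes p | no q  = ⊥-elim (q (sym p))
  ... | no p  | yes q = ⊥-elim (p (sym q))
  ... | no _  | no _  = refl

  true≢false : true ≢ false
  true≢false ()

  ∧-true : ∀ {a b} → (a ∧ b) ≡ true → a ≡ true × b ≡ true
  ∧-true {true} {true} _ = refl , refl

  ∨-true : ∀ {a b} → (a ∨ b) ≡ true → a ≡ true ⊎ b ≡ true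
  ∨-true {true} _ = inj₁ refl
  ∨-true {false} e = inj₂ e

  ∨-false : ∀ {a b} → (a ∨ b) ≡ false → a ≡ false × b ≡ false
  ∨-false {false} e = refl , e

  not-true : ∀ {a} → not a ≡ true → a ≡ false
  not-true {false} _ = refl

  bool? : (a : Bool) → a ≡ true ⊎ a ≡ false
  bool? true = inj₁ refl
  bool? false = inj₂ refl

  ¬true : ∀ {a} → ¬ (a ≡ true) → a ≡ false
  ¬true {true} h = ⊥-elim (h refl)
  ¬true {false} h = refl

  ⟦⟧≤1 : ∀ a → ⟦ a ⟧ ≤ 1
  ⟦⟧≤1 true = ≤-refl
  ⟦⟧≤1 false = z≤n

  ⟦⟧-not : ∀ a → ⟦ a ⟧ + ⟦ not a ⟧ ≡ 1
  ⟦⟧-not true = refl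
  ⟦⟧-not false = refl

  ⟦∧⟧ : ∀ a b → ⟦ a ∧ b ⟧ ≡ ⟦ a ⟧ * ⟦ b ⟧
  ⟦∧⟧ true b = sym (+-identityʳ _)
  ⟦∧⟧ false b = refl

  ⟦⟧-mono : ∀ {a b} → (a ≡ true → b ≡ true) → ⟦ a ⟧ ≤ ⟦ b ⟧
  ⟦⟧-mono {true} h rewrite h refl = ≤-refl
  ⟦⟧-mono {false} h = z≤n

  bool-ext : ∀ {a b} → (a ≡ true → b ≡ true) → (b ≡ true → a ≡ true) → a ≡ b
  bool-ext {true} h _ = sym (h refl)
  bool-ext {false} {true} _ h = h refl
  bool-ext {false} {false} _ _ = refl

  +-interchange : ∀ a b c d → (a + b) + (c + d) ≡ (a + c) + (b + d)
  +-interchange = solve-∀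

  ==-suc : ∀ {n} (i j : Fin n) → (suc i == suc j) ≡ (i == j)
  ==-suc i j = bool-ext (λ e → subst (λ z → (i == z) ≡ true) (suc-injective (==⇒≡ e)) (==-refl i))
                        (λ e → subst (λ z → (suc i == suc z) ≡ true) (==⇒≡ e) (==-refl (suc i)))

  -- Parity

  %2≤1 : ∀ a → a % 2 ≤ 1
  %2≤1 a = ≤-pred (m%n<n a 2)

  %2-cases : ∀ a → a % 2 ≡ 0 ⊎ a % 2 ≡ 1
  %2-cases a with a % 2 | %2≤1 a
  ... | zero | _ = inj₁ refl
  ... | suc zero | _ = inj₂ refl
  ... | suc (suc _) | s≤s ()

  %2-+ : ∀ a b → (a + b) % 2 ≡ (a % 2 + b % 2) % 2
  %2-+ a b = %-distribˡ-+ a b 2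

  %2-+-≤ : ∀ a b → (a + b) % 2 ≤ a % 2 + b % 2
  %2-+-≤ a b = ≤-trans (≤-reflexive (%2-+ a b)) (m%n≤m _ 2)

  %2-+-cancelˡ : ∀ a b → (a + b) % 2 ≡ 0 → a % 2 ≡ b % 2
  %2-+-cancelˡ a b e with %2-cases a | %2-cases b | trans (sym (%2-+ a b)) e
  ... | inj₁ p | inj₁ q | _ = trans p (sym q)
  ... | inj₂ p | inj₂ q | _ = trans p (sym q)
  ... | inj₁ p | inj₂ q | r rewrite p | q = ⊥-elim (1+n≢0 r)
  ... | inj₂ p | inj₁ q | r rewrite p | q = ⊥-elim (1+n≢0 r)

  %2-suc-odd : ∀ a → (1 + a) % 2 ≡ 1 → a % 2 ≡ 0
  %2-suc-odd a e with %2-cases a | trans (sym (%2-+ 1 a)) e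
  ... | inj₁ p | _ = p
  ... | inj₂ p | r rewrite p = ⊥-elim (1+n≢0 (sym r))

  -- Opaque, so that an equation between sums is solved by comparing the summands.
  abstract
    ∑ : ∀ {n} → (Fin n → ℕ) → ℕ
    ∑ {zero} f = 0
    ∑ {suc n} f = f zero + ∑ (f ∘ suc)

    ∑-empty : (f : Fin 0 → ℕ) → ∑ f ≡ 0
    ∑-empty f = refl

    ∑-suc : ∀ {n} (f : Fin (suc n) → ℕ) → ∑ f ≡ f zero + ∑ (f ∘ suc)
    ∑-suc f = refl

    ∑-cong : ∀ {n} {f h : Fin n → ℕ} → (∀ i → f i ≡ h i) → ∑ f ≡ ∑ h
    ∑-cong {zero} e = refl
    ∑-cong {suc n} e = cong₂ _+_ (e zero) (∑-cong (e ∘ suc))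

    ∑-zero : ∀ {n} {f : Fin n → ℕ} → (∀ i → f i ≡ 0) → ∑ f ≡ 0
    ∑-zero {zero} e = refl
    ∑-zero {suc n} e = cong₂ _+_ (e zero) (∑-zero (e ∘ suc))

    ∑-distrib-+ : ∀ {n} (f h : Fin n → ℕ) → ∑ (λ i → f i + h i) ≡ ∑ f + ∑ h
    ∑-distrib-+ {zero} f h = refl
    ∑-distrib-+ {suc n} f h =
      trans (cong (f zero + h zero +_) (∑-distrib-+ (f ∘ suc) (h ∘ suc))) (+-interchange (f zero) (h zero) _ _)

    ∑-comm : ∀ {m n} (f : Fin m → Fin n → ℕ) → ∑ (λ i → ∑ λ j → f i j) ≡ ∑ (λ j → ∑ λ i → f i j)
    ∑-comm {zero} {n} f = sym (∑-zero {n} λ _ → refl)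
    ∑-comm {suc m} f = trans (cong (∑ (f zero) +_) (∑-comm (f ∘ suc))) (sym (∑-distrib-+ (f zero) _))

    ∑-mono : ∀ {n} {f h : Fin n → ℕ} → (∀ i → f i ≤ h i) → ∑ f ≤ ∑ h
    ∑-mono {zero} _ = z≤n
    ∑-mono {suc n} p = +-mono-≤ (p zero) (∑-mono (p ∘ suc))

    ∑-mono-< : ∀ {n} {f h : Fin n → ℕ} → (∀ i → f i ≤ h i) → (∃ λ i → f i < h i) → ∑ f < ∑ h
    ∑-mono-< {suc n} p (zero , q) = +-mono-<-≤ q (∑-mono (p ∘ suc))
    ∑-mono-< {suc n} p (suc i , q) = +-mono-≤-< (p zero) (∑-mono-< (p ∘ suc) (i , q))

    ∑-≤⇒≗ : ∀ {n} {f h : Fin n → ℕ} → (∀ i → f i ≤ h i) → ∑ h ≤ ∑ f → ∀ i → f i ≡ h i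
    ∑-≤⇒≗ p q i = ≤-antisym (p i) (≮⇒≥ λ f<h → <⇒≱ (∑-mono-< p (i , f<h)) q)

    ∑-term : ∀ {n} (f : Fin n → ℕ) i → f i ≤ ∑ f
    ∑-term f zero = m≤m+n _ _
    ∑-term f (suc i) = ≤-trans (∑-term (f ∘ suc) i) (m≤n+m _ _)

    *-distribˡ-∑ : ∀ {n} c (f : Fin n → ℕ) → c * ∑ f ≡ ∑ λ i → c * f i
    *-distribˡ-∑ {zero} c f = *-zeroʳ c
    *-distribˡ-∑ {suc n} c f = trans (*-distribˡ-+ c (f zero) _) (cong (c * f zero +_) (*-distribˡ-∑ c (f ∘ suc)))

    *-distribʳ-∑ : ∀ {n} c (f : Fin n → ℕ) → ∑ f * c ≡ ∑ λ i → f i * c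
    *-distribʳ-∑ c f = trans (*-comm (∑ f) c) (trans (*-distribˡ-∑ c f) (∑-cong λ i → *-comm c (f i)))

    ∑-indicator : ∀ {n} (x : Fin n) (h : Fin n → ℕ) → ∑ (λ i → ⟦ x == i ⟧ * h i) ≡ h x
    ∑-indicator {suc n} zero h = trans (cong₂ _+_ (+-identityʳ (h zero)) (∑-zero {n} λ _ → refl)) (+-identityʳ _)
    ∑-indicator {suc n} (suc x) h =
      trans (∑-cong λ i → cong (λ z → ⟦ z ⟧ * h (suc i)) (==-suc x i)) (∑-indicator x (h ∘ suc))

    ∑-indicator₁ : ∀ {n} (x : Fin n) → ∑ (λ i → ⟦ x == i ⟧) ≡ 1
    ∑-indicator₁ x = trans (∑-cong λ i → sym (*-identityʳ ⟦ x == i ⟧)) (∑-indicator x (λ _ → 1))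

    ∑-const : ∀ n c → ∑ {n} (λ _ → c) ≡ n * c
    ∑-const zero c = refl
    ∑-const (suc n) c = cong (c +_) (∑-const n c)

    ∑-split : ∀ m {n} (h : Fin (m + n) → ℕ) → ∑ h ≡ ∑ (λ i → h (i ↑ˡ n)) + ∑ (λ j → h (m ↑ʳ j))
    ∑-split zero h = refl
    ∑-split (suc m) h = trans (cong (h zero +_) (∑-split m (h ∘ suc))) (sym (+-assoc (h zero) _ _))

    ∑∑-mono-< : ∀ {m n} {P Q : Fin m → Fin n → Bool} → (∀ i j → P i j ≡ true → Q i j ≡ true) →
      ∀ i j → P i j ≡ false → Q i j ≡ true →
      ∑ (λ i → ∑ λ j → ⟦ P i j ⟧) < ∑ λ i → ∑ λ j → ⟦ Q i j ⟧
    ∑∑-mono-< P⊆Q i j p q =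
      ∑-mono-< (λ i → ∑-mono λ j → ⟦⟧-mono (P⊆Q i j))
        (i , ∑-mono-< (λ j → ⟦⟧-mono (P⊆Q i j)) (j , subst₂ _<_ (cong ⟦_⟧ (sym p)) (cong ⟦_⟧ (sym q)) ≤-refl))

    ∑-%2-≤ : ∀ {n} (f : Fin n → ℕ) → ∑ f % 2 ≤ ∑ λ i → f i % 2
    ∑-%2-≤ {zero} f = z≤n
    ∑-%2-≤ {suc n} f = ≤-trans (%2-+-≤ (f zero) _) (+-monoʳ-≤ (f zero % 2) (∑-%2-≤ (f ∘ suc)))

    ∑-%2 : ∀ {n} (f : Fin n → ℕ) → ∑ (λ i → f i % 2) % 2 ≡ ∑ f % 2
    ∑-%2 {zero} f = refl
    ∑-%2 {suc n} f = begin
      (f zero % 2 + rest) % 2          ≡⟨ %2-+ (f zero % 2) rest ⟩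
      (f zero % 2 % 2 + rest % 2) % 2  ≡⟨ cong₂ (λ a b → (a + b) % 2) (m%n%n≡m%n (f zero) 2) (∑-%2 (f ∘ suc)) ⟩
      (f zero % 2 + ∑ (f ∘ suc) % 2) % 2 ≡⟨ %2-+ (f zero) _ ⟨
      (f zero + ∑ (f ∘ suc)) % 2     ∎
      where
      open ≡-Reasoning
      rest : ℕ
      rest = ∑ (λ i → f (suc i) % 2)

  parity-gap : ∀ {a b} → a ≤ b → a ≢ b → a % 2 ≡ b % 2 → 2 + a ≤ b
  parity-gap {a} {b} a≤b a≢b e with m≤n⇒∃[o]m+o≡n a≤b
  ... | zero , p = ⊥-elim (a≢b (trans (sym (+-identityʳ a)) p))
  ... | suc zero , p = ⊥-elim (0≢1 (%2-cases a))
    where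
    s : (1 + a) % 2 ≡ a % 2
    s = trans (cong (_% 2) (trans (+-comm 1 a) p)) (sym e)
    0≢1 : a % 2 ≡ 0 ⊎ a % 2 ≡ 1 → ⊥
    0≢1 (inj₁ q) = 1+n≢0 (trans (sym (trans (%2-+ 1 a) (cong (λ z → (1 + z) % 2) q))) (trans s q))
    0≢1 (inj₂ q) = 1+n≢0 (trans (sym q) (%2-suc-odd a (trans s q)))
  ... | suc (suc o) , p = subst (2 + a ≤_) (trans (regroup a o) p) (m≤m+n (2 + a) o)
    where
    regroup : ∀ a o → 2 + a + o ≡ a + suc (suc o)
    regroup = solve-∀

  -- Classical reasoning under double negation

  em : ∀ {P : Set} → ¬ ¬ (P ⊎ ¬ P)
  em k = k (inj₂ λ p → k (inj₁ p))

  -- Descent along `μ`, with `c` bounding the value still to be undercut. `P` is not assumed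
  -- decidable, so only non-existence is refuted.
  minimal : ∀ {X : Set} (P : X → Set) (μ : X → ℕ) → Σ X P →
    ¬ ¬ (Σ X λ x → P x × (∀ y → P y → μ x ≤ μ y))
  minimal {X} P μ (x₀ , p₀) k = go (suc (μ x₀)) x₀ p₀ ≤-refl
    where
    go : ∀ c x → P x → μ x < c → ⊥
    go (suc c) x p (s≤s le) = k (x , p , λ y q → ≮⇒≥ λ lt → go c y q (≤-trans lt le))

  -- Weights of vertex sets

  weight : ∀ {n} → (Fin n → ℕ) → (Fin n → Bool) → ℕ
  weight g P = ∑ λ x → ⟦ P x ⟧ * g x

  weight-cong : ∀ {n} (g : Fin n → ℕ) {P Q : Fin n → Bool} → (∀ x → P x ≡ Q x) → weight g P ≡ weight g Q
  weight-cong g e = ∑-cong λ x → cong (λ z → ⟦ z ⟧ * g x) (e x)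

  weight-empty : ∀ {n} (g : Fin n → ℕ) {P : Fin n → Bool} → (∀ x → P x ≡ false) → weight g P ≡ 0
  weight-empty g e = ∑-zero λ x → cong (λ z → ⟦ z ⟧ * g x) (e x)

  weight-singleton : ∀ {n} (g : Fin n → ℕ) v → weight g (v ==_) ≡ g v
  weight-singleton g v = ∑-indicator v g

  weight-+ : ∀ {n} (g : Fin n → ℕ) (P Q R : Fin n → Bool) →
    (∀ x → ⟦ P x ⟧ + ⟦ Q x ⟧ ≡ ⟦ R x ⟧) → weight g P + weight g Q ≡ weight g R
  weight-+ g P Q R e = trans (sym (∑-distrib-+ _ _))
    (∑-cong λ x → trans (sym (*-distribʳ-+ (g x) ⟦ P x ⟧ ⟦ Q x ⟧)) (cong (_* g x) (e x)))

  weight-complement : ∀ {n} (g : Fin n → ℕ) (P : Fin n → Bool) →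
    weight g P + weight g (not ∘ P) ≡ weight g (λ _ → true)
  weight-complement g P = weight-+ g P (not ∘ P) (λ _ → true) λ x → ⟦⟧-not (P x)

  weight-∨-∧ : ∀ {n} (g : Fin n → ℕ) (P Q : Fin n → Bool) →
    weight g (λ x → P x ∨ Q x) + weight g (λ x → P x ∧ Q x) ≡ weight g P + weight g Q
  weight-∨-∧ g P Q = trans (sym (∑-distrib-+ _ _)) (trans (∑-cong lem) (∑-distrib-+ _ _))
    where
    lem : ∀ x → ⟦ P x ∨ Q x ⟧ * g x + ⟦ P x ∧ Q x ⟧ * g x ≡ ⟦ P x ⟧ * g x + ⟦ Q x ⟧ * g x
    lem x with P x | Q x
    ... | true | true = refl
    ... | true | false = refl
    ... | false | q = +-identityʳ _

  size : ∀ {n} → (Fin n → Bool) → ℕ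
  size P = ∑ λ x → ⟦ P x ⟧

  -- Hall's theorem with capacities

  -- Quantifying over every `T` that contains the neighbourhood of `W` avoids forming the
  -- neighbourhood itself.
  Hall : ∀ {m n} → (Fin m → Fin n → Bool) → (Fin m → Bool) → (Fin n → ℕ) → Set
  Hall R D g = ∀ W T → (∀ i → W i ≡ true → D i ≡ true) →
    (∀ i s → W i ≡ true → R i s ≡ true → T s ≡ true) → size W ≤ weight g T

  unlink : ∀ {m n} → (Fin m → Fin n → Bool) → Fin m → Fin n → Fin m → Fin n → Bool
  unlink R i s j t = R j t ∧ not ((j == i) ∧ (t == s))

  unlink-keep : ∀ {m n} (R : Fin m → Fin n → Bool) {i s j t} →
    R j t ≡ true → j ≢ i ⊎ t ≢ s → unlink R i s j t ≡ true
  unlink-keep R {i} {s} {j} {t} r (inj₁ ne) rewrite r | ≢⇒== ne = refl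
  unlink-keep R {i} {s} {j} {t} r (inj₂ ne) rewrite r | ≢⇒== ne with j == i
  ... | true = refl
  ... | false = refl

  unlink-self : ∀ {m n} (R : Fin m → Fin n → Bool) i s → unlink R i s i s ≡ false
  unlink-self R i s rewrite ==-refl i | ==-refl s with R i s
  ... | true = refl
  ... | false = refl

  unlink-⊆ : ∀ {m n} (R : Fin m → Fin n → Bool) i s {j t} → unlink R i s j t ≡ true → R j t ≡ true
  unlink-⊆ R i s e = proj₁ (∧-true e)

  -- Rado: if i has two neighbours, one of the two links can be dropped, because two violators
  -- for the reduced relations would uncross to a violator for R.
  uncross : ∀ {m n} {R : Fin m → Fin n → Bool} {D g} → Hall R D g → ∀ i s s′ → s ≢ s′ →
    ¬ Hall (unlink R i s) D g → ¬ ¬ Hall (unlink R i s′) D g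
  uncross {R = R} {D} {g} H i s s′ s≢s′ ¬H₁ ¬H₂ =
    ¬H₁ λ W₁ T₁ w₁ t₁ → ≮⇒≥ λ lt₁ → ¬H₂ λ W₂ T₂ w₂ t₂ → ≮⇒≥ λ lt₂ → absurd W₁ T₁ w₁ t₁ lt₁ W₂ T₂ w₂ t₂ lt₂
    where
    -- Only a link at `i` was dropped, so a violator that misses `i` would already violate the
    -- condition for `R`.
    inside : ∀ s W T → (∀ j → W j ≡ true → D j ≡ true) →
      (∀ j t → W j ≡ true → unlink R i s j t ≡ true → T t ≡ true) → weight g T < size W → W i ≡ true
    inside s W T w t lt with bool? (W i)
    ... | inj₁ e = e
    ... | inj₂ e = ⊥-elim (<⇒≱ lt (H W T w λ j z wj r → t j z wj (unlink-keep R r (inj₁ λ { refl → true≢false (trans (sym wj) e) }))))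
    absurd : ∀ W₁ T₁ → (∀ j → W₁ j ≡ true → D j ≡ true) →
      (∀ j t → W₁ j ≡ true → unlink R i s j t ≡ true → T₁ t ≡ true) → weight g T₁ < size W₁ →
      ∀ W₂ T₂ → (∀ j → W₂ j ≡ true → D j ≡ true) →
      (∀ j t → W₂ j ≡ true → unlink R i s′ j t ≡ true → T₂ t ≡ true) → weight g T₂ < size W₂ → ⊥
    absurd W₁ T₁ w₁ t₁ lt₁ W₂ T₂ w₂ t₂ lt₂ = <-irrefl refl (begin-strict
      size W₁ + size W₂                    ≡⟨ count ⟩
      1 + (size W∪ + size W∩)              ≤⟨ s≤s (+-mono-≤ (H W∪ T∪ w∪ t∪) (H W∩ T∩ w∩ t∩)) ⟩
      1 + (weight g T∪ + weight g T∩)      ≡⟨ cong suc (weight-∨-∧ g T₁ T₂) ⟩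
      1 + (weight g T₁ + weight g T₂)      <⟨ s≤s (s≤s ≤-refl) ⟩
      2 + (weight g T₁ + weight g T₂)      ≡⟨ cong suc (sym (+-suc _ _)) ⟩
      suc (weight g T₁) + suc (weight g T₂) ≤⟨ +-mono-≤ lt₁ lt₂ ⟩
      size W₁ + size W₂                    ∎)
      where
      open ≤-Reasoning
      W∪ = λ j → W₁ j ∨ W₂ j
      -- Without `i` the intersection does not see the dropped links, at the cost of one in the
      -- count; two violators have a joint deficit of two, so one remains. In the union, the link
      -- from `i` to `s` is covered by `T₂` and every other link of `i` by `T₁`.
      W∩ = λ j → (W₁ j ∧ W₂ j) ∧ not (i == j)
      T∪ = λ t → T₁ t ∨ T₂ t
      T∩ = λ t → T₁ t ∧ T₂ t
      i∈₁ : W₁ i ≡ true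
      i∈₁ = inside s W₁ T₁ w₁ t₁ lt₁
      i∈₂ : W₂ i ≡ true
      i∈₂ = inside s′ W₂ T₂ w₂ t₂ lt₂
      count : size W₁ + size W₂ ≡ 1 + (size W∪ + size W∩)
      count = trans (sym (∑-distrib-+ _ _)) (trans (∑-cong pointwise)
        (trans (∑-distrib-+ _ _) (cong₂ _+_ (∑-indicator₁ i) (∑-distrib-+ _ _))))
        where
        pointwise : ∀ j → ⟦ W₁ j ⟧ + ⟦ W₂ j ⟧ ≡ ⟦ i == j ⟧ + (⟦ W∪ j ⟧ + ⟦ W∩ j ⟧)
        pointwise j with i ≟ j
        ... | yes refl rewrite i∈₁ | i∈₂ = refl
        ... | no _ with W₁ j | W₂ j
        ... | true | true = refl
        ... | true | false = refl
        ... | false | true = refl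
        ... | false | false = refl
      w∪ : ∀ j → W∪ j ≡ true → D j ≡ true
      w∪ j e = [ w₁ j , w₂ j ]′ (∨-true e)
      w∩ : ∀ j → W∩ j ≡ true → D j ≡ true
      w∩ j e = w₁ j (proj₁ (∧-true (proj₁ (∧-true e))))
      left : ∀ {a b} → a ≡ true → (a ∨ b) ≡ true
      left refl = refl
      right : ∀ {a b} → b ≡ true → (a ∨ b) ≡ true
      right {true} _ = refl
      right {false} e = e
      t∪ : ∀ j t → W∪ j ≡ true → R j t ≡ true → T∪ t ≡ true
      t∪ j t e r with j ≟ i
      ... | no j≢i = [ (λ p → left (t₁ j t p (unlink-keep R r (inj₁ j≢i)))) , (λ p → right {T₁ t} (t₂ j t p (unlink-keep R r (inj₁ j≢i)))) ]′ (∨-true e)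
      ... | yes refl with t ≟ s
      ... | no t≢s = left (t₁ i t i∈₁ (unlink-keep R r (inj₂ t≢s)))
      ... | yes refl = right {T₁ s} (t₂ i s i∈₂ (unlink-keep R r (inj₂ s≢s′)))
      t∩ : ∀ j t → W∩ j ≡ true → R j t ≡ true → T∩ t ≡ true
      t∩ j t e r = cong₂ _∧_ (t₁ j t p₁ (unlink-keep R r (inj₁ j≢i))) (t₂ j t p₂ (unlink-keep R r (inj₁ j≢i)))
        where
        p = ∧-true {W₁ j ∧ W₂ j} e
        p₁ = proj₁ (∧-true {W₁ j} (proj₁ p))
        p₂ = proj₂ (∧-true {W₁ j} (proj₁ p))
        j≢i : j ≢ i
        j≢i refl = true≢false (trans (sym (==-refl i)) (not-true (proj₂ p)))

  -- Links are dropped as long as some `i` in `D` has two of them, `c` bounding their number. When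
  -- the relation is a function on `D`, the capacity at `s` is Hall's condition for the set of all
  -- `i` sent to `s`. The vertex `s₀` is a filler value outside `D`.
  hall : ∀ {m n} c (R : Fin m → Fin n → Bool) (D : Fin m → Bool) (g : Fin n → ℕ) (s₀ : Fin n) →
    ∑ (λ i → ∑ λ s → ⟦ R i s ⟧) < c → Hall R D g →
    ¬ ¬ (Σ (Fin m → Fin n) λ φ → (∀ i → D i ≡ true → R i (φ i) ≡ true) ×
      (∀ s → size (λ i → D i ∧ (φ i == s)) ≤ g s))
  hall {m} {n} (suc c) R D g s₀ (s≤s le) H k
    with any? (λ i → any? λ s → any? λ s′ → (R i s ∧ (R i s′ ∧ (D i ∧ not (s == s′)))) Bool.≟ true)
  ... | yes (i , s , s′ , e) = em λ where
      (inj₁ H₁) → reduce s r H₁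
      (inj₂ ¬H₁) → uncross H i s s′ s≢s′ ¬H₁ (reduce s′ r′)
    where
    r = proj₁ (∧-true {R i s} e)
    e₂ = proj₂ (∧-true {R i s} e)
    r′ = proj₁ (∧-true {R i s′} e₂)
    s≢s′ : s ≢ s′
    s≢s′ refl = true≢false (trans (sym (==-refl s)) (not-true (proj₂ (∧-true {D i} (proj₂ (∧-true {R i s′} e₂))))))
    reduce : ∀ s → R i s ≡ true → Hall (unlink R i s) D g → ⊥
    reduce s r H₁ = hall c (unlink R i s) D g s₀
      (<-≤-trans (∑∑-mono-< (λ j t → unlink-⊆ R i s) i s (unlink-self R i s) r) le) H₁
      λ (φ , p , q) → k (φ , (λ j d → unlink-⊆ R i s (p j d)) , q)
  ... | no ¬two = k (φ , (λ i → proj₂ (pick i)) , capacity)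
    where
    pick : ∀ i → Σ (Fin n) λ s → D i ≡ true → R i s ≡ true
    pick i with any? (λ s → R i s Bool.≟ true)
    ... | yes (s , r) = s , λ _ → r
    ... | no ¬r = s₀ , λ d → ⊥-elim (1+n≰n (≤-trans (≤-reflexive (sym (∑-indicator₁ i)))
            (≤-trans (H (i ==_) (λ _ → false) (λ j e → subst (λ z → D z ≡ true) (==⇒≡ e) d)
                       (λ j s e r → ⊥-elim (¬r (s , subst (λ z → R z s ≡ true) (sym (==⇒≡ e)) r))))
                     (≤-reflexive (weight-empty g λ _ → refl)))))
    φ : Fin m → Fin n
    φ i = proj₁ (pick i)
    capacity : ∀ s → size (λ i → D i ∧ (φ i == s)) ≤ g s
    capacity s = ≤-trans (H _ (s ==_) (λ i e → proj₁ (∧-true e)) cover) (≤-reflexive (weight-singleton g s))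
      where
      cover : ∀ i t → (D i ∧ (φ i == s)) ≡ true → R i t ≡ true → (s == t) ≡ true
      cover i t e r with s ≟ t
      ... | yes _ = refl
      ... | no s≢t = ⊥-elim (¬two (i , s , t , cong₂ _∧_ (subst (λ z → R i z ≡ true) (==⇒≡ (proj₂ p)) (proj₂ (pick i) (proj₁ p)))
                         (cong₂ _∧_ r (cong₂ _∧_ (proj₁ p) (cong not (≢⇒== s≢t))))))
        where p = ∧-true {D i} e

  -- Labellings and parity factors

  -- A removed set together with a partition of the rest. Labels need not be attained: an empty cell
  -- has weight 0 and is never counted as odd.
  record Labelling (n : ℕ) : Set where
    field
      labels  : ℕ
      removed : Fin n → Bool
      label   : Fin n → Fin labels
  open Labelling

  cell : ∀ {n} (L : Labelling n) → Fin (labels L) → Fin n → Bool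
  cell L i x = not (removed L x) ∧ (label L x == i)

  oddCells : ∀ {n} → (Fin n → ℕ) → Labelling n → ℕ
  oddCells g L = ∑ λ i → weight g (cell L i) % 2

  -- Cells are unions of components of the graph without the removed vertices. Allowing unions keeps
  -- reachability out of the condition and does not weaken it: merging components only loses odd cells.
  Valid : ∀ {n} → Adj n → Labelling n → Set
  Valid A L = ∀ x y → A x y ≡ true → removed L x ≡ false → removed L y ≡ false → label L x ≡ label L y

  Tutte : ∀ {n} → Adj n → (Fin n → ℕ) → Set
  Tutte A g = ∀ L → Valid A L → oddCells g L ≤ weight g (removed L)

  Symmetric Irreflexive : ∀ {n} → Adj n → Set
  Symmetric A = ∀ x y → A x y ≡ A y x
  Irreflexive A = ∀ x → A x x ≡ false

  ParityFactor : ∀ {n} → Adj n → (Fin n → ℕ) → Set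
  ParityFactor {n} A g = Σ (Adj n) λ F → Symmetric F × (∀ x y → F x y ≡ true → A x y ≡ true) ×
    (∀ v → size (F v) % 2 ≡ g v % 2 × size (F v) ≤ g v)

  ∑-weight-cells : ∀ {n} (g : Fin n → ℕ) (L : Labelling n) (Q : Fin n → Bool) →
    ∑ (λ i → weight g (λ x → cell L i x ∧ Q x)) ≡ weight g (λ x → not (removed L x) ∧ Q x)
  ∑-weight-cells g L Q = trans (∑-comm _) (∑-cong λ x →
    trans (∑-cong λ i → pointwise (removed L x) (label L x == i) (Q x) (g x))
          (∑-indicator (label L x) (λ _ → ⟦ not (removed L x) ∧ Q x ⟧ * g x)))
    where
    pointwise : ∀ r e q w → ⟦ (not r ∧ e) ∧ q ⟧ * w ≡ ⟦ e ⟧ * (⟦ not r ∧ q ⟧ * w)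
    pointwise true true q w = refl
    pointwise true false q w = refl
    pointwise false true q w = sym (+-identityʳ _)
    pointwise false false q w = refl

  weight-shift : ∀ {n} {g g′ h : Fin n → ℕ} (Q : Fin n → Bool) → (∀ x → Q x ≡ true → g′ x + h x ≡ g x) →
    weight g′ Q + weight h Q ≡ weight g Q
  weight-shift {g = g} {g′} {h} Q e = trans (sym (∑-distrib-+ _ _)) (∑-cong pointwise)
    where
    pointwise : ∀ x → ⟦ Q x ⟧ * g′ x + ⟦ Q x ⟧ * h x ≡ ⟦ Q x ⟧ * g x
    pointwise x with Q x | e x
    ... | true | e = trans (cong₂ _+_ (*-identityˡ (g′ x)) (*-identityˡ (h x))) (trans (e refl) (sym (*-identityˡ (g x))))
    ... | false | _ = refl

  weight-point : ∀ {n} (v : Fin n) (Q : Fin n → Bool) → weight (λ x → ⟦ v == x ⟧) Q ≡ ⟦ Q v ⟧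
  weight-point v Q = trans (∑-cong λ x → *-comm ⟦ Q x ⟧ _) (∑-indicator v (λ x → ⟦ Q x ⟧))

  Closed : ∀ {n} → Adj n → (Fin n → Bool) → Set
  Closed A P = ∀ x y → A x y ≡ true → P x ≡ P y

  -- With nothing removed the condition allows no odd cell at all; `P` and its complement serve as
  -- the two cells.
  closed-even : ∀ {n} {A : Adj n} {g} → Tutte A g → ∀ P → Closed A P → weight g P % 2 ≡ 0
  closed-even {n} {A} {g} T P cl = n≤0⇒n≡0 (begin
    weight g P % 2          ≡⟨ cong (_% 2) (weight-cong g same) ⟩
    weight g (cell L zero) % 2 ≤⟨ ∑-term _ zero ⟩
    oddCells g L            ≤⟨ T L (λ x y a _ _ → cong (λ z → if z then zero else suc zero) (cl x y a)) ⟩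
    weight g (λ _ → false)  ≡⟨ weight-empty g (λ _ → refl) ⟩
    0                       ∎)
    where
    open ≤-Reasoning
    L : Labelling n
    L = record { labels = 2 ; removed = λ _ → false ; label = λ x → if P x then zero else suc zero }
    same : ∀ x → P x ≡ cell L zero x
    same x with P x
    ... | true = refl
    ... | false = refl

  -- The number of odd cells has the parity of the weight left over, and the weight of all vertices
  -- is even because the whole vertex set is closed.
  oddCells-parity : ∀ {n} {A : Adj n} {g} → Tutte A g → ∀ L → oddCells g L % 2 ≡ weight g (removed L) % 2
  oddCells-parity {A = A} {g} T L = begin
    oddCells g L % 2                            ≡⟨ ∑-%2 _ ⟩
    ∑ (λ i → weight g (cell L i)) % 2           ≡⟨ cong (_% 2) (∑-cong λ i → weight-cong g λ x → sym (∧-identityʳ (cell L i x))) ⟩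
    ∑ (λ i → weight g (λ x → cell L i x ∧ true)) % 2 ≡⟨ cong (_% 2) (∑-weight-cells g L (λ _ → true)) ⟩
    weight g (λ x → not (removed L x) ∧ true) % 2 ≡⟨ cong (_% 2) (weight-cong g λ x → ∧-identityʳ (not (removed L x))) ⟩
    weight g (not ∘ removed L) % 2              ≡⟨ %2-+-cancelˡ (weight g (removed L)) _ even ⟨
    weight g (removed L) % 2                    ∎
    where
    open ≡-Reasoning
    even : (weight g (removed L) + weight g (not ∘ removed L)) % 2 ≡ 0
    even = trans (cong (_% 2) (weight-complement g (removed L))) (closed-even {A = A} T (λ _ → true) λ _ _ _ → refl)

  tutte-gap : ∀ {n} {A : Adj n} {g} → Tutte A g → ∀ L → Valid A L →
    oddCells g L ≢ weight g (removed L) → 2 + oddCells g L ≤ weight g (removed L)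
  tutte-gap {A = A} T L v ne = parity-gap (T L v) ne (oddCells-parity {A = A} T L)

  size-∨-disjoint : ∀ {n} (P Q : Fin n → Bool) → (∀ x → P x ≡ true → Q x ≡ false) →
    size (λ x → P x ∨ Q x) ≡ size P + size Q
  size-∨-disjoint P Q d = trans (∑-cong pointwise) (∑-distrib-+ _ _)
    where
    pointwise : ∀ x → ⟦ P x ∨ Q x ⟧ ≡ ⟦ P x ⟧ + ⟦ Q x ⟧
    pointwise x with P x | d x
    ... | true | d rewrite d refl = refl
    ... | false | _ = refl

  -- `M` holds the edges already committed and `g₁` what remains of `g`. Disjointness makes degrees
  -- add, so both parity and upper bound carry over.
  extend-factor : ∀ {n} {A A₁ : Adj n} {g g₁} (M : Adj n) → Symmetric M →
    (∀ x y → M x y ≡ true → A x y ≡ true) → (∀ x y → A₁ x y ≡ true → A x y ≡ true) →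
    (∀ x y → A₁ x y ≡ true → M x y ≡ false) → (∀ x → g₁ x + size (M x) ≡ g x) →
    ParityFactor A₁ g₁ → ParityFactor A g
  extend-factor {A = A} {g = g} {g₁} M M-sym M⊆A A₁⊆A disjoint split (F , F-sym , F⊆A₁ , F-deg) =
    (λ x y → F x y ∨ M x y) , (λ x y → cong₂ _∨_ (F-sym x y) (M-sym x y)) ,
    (λ x y e → [ (λ p → A₁⊆A x y (F⊆A₁ x y p)) , M⊆A x y ]′ (∨-true e)) , degrees
    where
    open ≡-Reasoning
    degrees : ∀ v → size (λ y → F v y ∨ M v y) % 2 ≡ g v % 2 × size (λ y → F v y ∨ M v y) ≤ g v
    degrees v = (begin
        size (λ y → F v y ∨ M v y) % 2               ≡⟨ cong (_% 2) add ⟩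
        (size (F v) + size (M v)) % 2                ≡⟨ %2-+ (size (F v)) _ ⟩
        (size (F v) % 2 + size (M v) % 2) % 2        ≡⟨ cong (λ z → (z + size (M v) % 2) % 2) (proj₁ (F-deg v)) ⟩
        (g₁ v % 2 + size (M v) % 2) % 2              ≡⟨ %2-+ (g₁ v) _ ⟨
        (g₁ v + size (M v)) % 2                      ≡⟨ cong (_% 2) (split v) ⟩
        g v % 2                                      ∎) ,
      ≤-trans (≤-reflexive add) (≤-trans (+-monoˡ-≤ (size (M v)) (proj₂ (F-deg v))) (≤-reflexive (split v)))
      where
      add : size (λ y → F v y ∨ M v y) ≡ size (F v) + size (M v)
      add = size-∨-disjoint (F v) (M v) λ y p → disjoint v y (F⊆A₁ v y p)

  arcs : ∀ {n} → Adj n → ℕ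
  arcs A = ∑ λ x → ∑ λ y → ⟦ A x y ⟧

  -- The induction runs on `arcs`, and isolating a removed set lowers it only if the set meets an
  -- edge. In particular the empty set, for which equality is automatic, is ruled out.
  Touches : ∀ {n} → Adj n → (Fin n → Bool) → Set
  Touches A S = ∃ λ x → ∃ λ y → S x ≡ true × A x y ≡ true

  touches? : ∀ {n} (A : Adj n) S → Dec (Touches A S)
  touches? A S = any? λ x → any? λ y → (S x Bool.≟ true) ×-dec (A x y Bool.≟ true)

  FactorsBelow : ∀ {n} → Adj n → Set
  FactorsBelow {n} A = ∀ (A₁ : Adj n) g₁ → Symmetric A₁ → Irreflexive A₁ → arcs A₁ < arcs A →
    Tutte A₁ g₁ → ¬ ¬ ParityFactor A₁ g₁

  -- Using or deleting a single edge

  edge : ∀ {n} → Fin n → Fin n → Adj n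
  edge u v x y = ((u == x) ∧ (v == y)) ∨ ((v == x) ∧ (u == y))

  edge-sym : ∀ {n} (u v : Fin n) → Symmetric (edge u v)
  edge-sym u v x y = trans (∨-comm ((u == x) ∧ (v == y)) _) (cong₂ _∨_ (∧-comm (v == x) _) (∧-comm (u == x) _))

  edge-true : ∀ {n} {u v x y : Fin n} → edge u v x y ≡ true → (u ≡ x × v ≡ y) ⊎ (v ≡ x × u ≡ y)
  edge-true {u = u} {v} {x} {y} e with ∨-true {(u == x) ∧ (v == y)} e
  ... | inj₁ p = inj₁ (==⇒≡ (proj₁ (∧-true {u == x} p)) , ==⇒≡ (proj₂ (∧-true {u == x} p)))
  ... | inj₂ p = inj₂ (==⇒≡ (proj₁ (∧-true {v == x} p)) , ==⇒≡ (proj₂ (∧-true {v == x} p)))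

  size-edge : ∀ {n} {u v : Fin n} → u ≢ v → ∀ x → size (edge u v x) ≡ ⟦ u == x ⟧ + ⟦ v == x ⟧
  size-edge {u = u} {v} u≢v x = trans (size-∨-disjoint _ _ disjoint)
    (cong₂ _+_ (row (u == x) v) (row (v == x) u))
    where
    row : ∀ a w → size (λ y → a ∧ (w == y)) ≡ ⟦ a ⟧
    row a w = trans (∑-cong λ y → trans (⟦∧⟧ a (w == y)) (*-comm ⟦ a ⟧ _)) (∑-indicator w (λ _ → ⟦ a ⟧))
    disjoint : ∀ y → ((u == x) ∧ (v == y)) ≡ true → ((v == x) ∧ (u == y)) ≡ false
    disjoint y p rewrite ≢⇒== {i = v} {x} (λ v≡x → u≢v (trans (==⇒≡ (proj₁ (∧-true {u == x} p))) (sym v≡x))) = refl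

  delete : ∀ {n} → Adj n → Fin n → Fin n → Adj n
  delete A u v x y = A x y ∧ not (edge u v x y)

  delete-cases : ∀ {n} (A : Adj n) u v {x y} → A x y ≡ true →
    delete A u v x y ≡ true ⊎ ((u ≡ x × v ≡ y) ⊎ (v ≡ x × u ≡ y))
  delete-cases A u v {x} {y} a with bool? (edge u v x y)
  ... | inj₁ e = inj₂ (edge-true e)
  ... | inj₂ e = inj₁ (cong₂ _∧_ a (cong not e))

  delete-⊆ : ∀ {n} (A : Adj n) u v x y → delete A u v x y ≡ true → A x y ≡ true
  delete-⊆ A u v x y e = proj₁ (∧-true e)

  delete-self : ∀ {n} (A : Adj n) u v → delete A u v u v ≡ false
  delete-self A u v rewrite ==-refl u | ==-refl v with A u v
  ... | true = refl
  ... | false = refl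

  -- Restoring the edge between `u` and `v` may connect two cells, and relabelling the cell of `v`
  -- repairs validity. If an end is removed, the edge imposes nothing and the labels stay.
  mergeEnds : ∀ {n} → Labelling n → Fin n → Fin n → Labelling n
  mergeEnds L u v = record
    { labels = labels L
    ; removed = removed L
    ; label = λ x → if (not (removed L u) ∧ not (removed L v)) ∧ (label L x == label L v) then label L u else label L x
    }

  mergeEnds-valid : ∀ {n} (A : Adj n) {u v} L → Valid (delete A u v) L → Valid A (mergeEnds L u v)
  mergeEnds-valid A {u} {v} L val x y a rx ry with delete-cases A u v {x} {y} a
  ... | inj₁ d = cong (λ z → if (not (removed L u) ∧ not (removed L v)) ∧ (z == label L v) then label L u else z) (val x y d rx ry)
  ... | inj₂ (inj₁ (refl , refl)) = both rx ry
    where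
    both : removed L u ≡ false → removed L v ≡ false → label (mergeEnds L u v) u ≡ label (mergeEnds L u v) v
    both ru rv rewrite ru | rv | ==-refl (label L v) with label L u == label L v
    ... | true = refl
    ... | false = refl
  ... | inj₂ (inj₂ (refl , refl)) = both rx ry
    where
    both : removed L v ≡ false → removed L u ≡ false → label (mergeEnds L u v) v ≡ label (mergeEnds L u v) u
    both rv ru rewrite ru | rv | ==-refl (label L v) with label L u == label L v
    ... | true = refl
    ... | false = refl

  -- A cell without an end survives the merge with the same weight, and each unremoved end spoils
  -- only the one cell that contains it. Letting `g′` differ from `g` at the ends makes one estimate
  -- serve both for deleting and for using the edge.
  oddCells-mergeEnds : ∀ {n} (g g′ : Fin n → ℕ) u v → (∀ x → x ≢ u → x ≢ v → g′ x ≡ g x) → ∀ L →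
    oddCells g′ L ≤ oddCells g (mergeEnds L u v) + (⟦ not (removed L u) ⟧ + ⟦ not (removed L v) ⟧)
  oddCells-mergeEnds g g′ u v off L = ≤-trans (∑-mono bound) (≤-reflexive total)
    where
    L′ = mergeEnds L u v
    end : _ → _ → ℕ
    end w i = ⟦ label L w == i ⟧ * ⟦ not (removed L w) ⟧
    total : ∑ (λ i → weight g (cell L′ i) % 2 + (end u i + end v i)) ≡ oddCells g L′ + (⟦ not (removed L u) ⟧ + ⟦ not (removed L v) ⟧)
    total = trans (∑-distrib-+ _ _) (cong (oddCells g L′ +_) (trans (∑-distrib-+ _ _)
      (cong₂ _+_ (∑-indicator (label L u) _) (∑-indicator (label L v) _))))
    hit : ∀ w i → cell L i w ≡ true → end w i ≡ 1
    hit w i e rewrite proj₁ (∧-true {not (removed L w)} e) | proj₂ (∧-true {not (removed L w)} e) = refl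
    miss : ∀ i → cell L i u ≡ false → cell L i v ≡ false → ∀ x → ⟦ cell L i x ⟧ * g′ x ≡ ⟦ cell L′ i x ⟧ * g x
    miss i cu cv x = trans value (cong (λ z → ⟦ z ⟧ * g x) same)
      where
      value : ⟦ cell L i x ⟧ * g′ x ≡ ⟦ cell L i x ⟧ * g x
      value with x ≟ u
      ... | yes refl rewrite cu = refl
      ... | no x≢u with x ≟ v
      ... | yes refl rewrite cv = refl
      ... | no x≢v = cong (⟦ cell L i x ⟧ *_) (off x x≢u x≢v)
      same : cell L i x ≡ cell L′ i x
      same = cells (removed L x) (removed L u) (removed L v) (label L x) (label L u) (label L v) cu cv
        where
        cells : ∀ rx ru rv lx lu lv → (not ru ∧ (lu == i)) ≡ false → (not rv ∧ (lv == i)) ≡ false →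
          (not rx ∧ (lx == i)) ≡ (not rx ∧ ((if (not ru ∧ not rv) ∧ (lx == lv) then lu else lx) == i))
        cells true _ _ _ _ _ _ _ = refl
        cells false true _ _ _ _ _ _ = refl
        cells false false true _ _ _ _ _ = refl
        cells false false false lx lu lv eu ev with lx ≟ lv
        ... | no _ = refl
        ... | yes e = trans (trans (cong (_== i) e) ev) (sym eu)
    bound : ∀ i → weight g′ (cell L i) % 2 ≤ weight g (cell L′ i) % 2 + (end u i + end v i)
    bound i with bool? (cell L i u) | bool? (cell L i v)
    ... | inj₁ e | _ = ≤-trans (%2≤1 (weight g′ (cell L i))) (≤-trans (≤-trans (≤-reflexive (sym (hit u i e))) (m≤m+n (end u i) (end v i))) (m≤n+m _ (weight g (cell L′ i) % 2)))
    ... | inj₂ _ | inj₁ e = ≤-trans (%2≤1 (weight g′ (cell L i))) (≤-trans (≤-trans (≤-reflexive (sym (hit v i e))) (m≤n+m (end v i) (end u i))) (m≤n+m _ (weight g (cell L′ i) % 2)))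
    ... | inj₂ cu | inj₂ cv = ≤-trans (≤-reflexive (cong (_% 2) (∑-cong (miss i cu cv)))) (m≤m+n _ _)

  untouched-cell-closed : ∀ {n} {A A₁ : Adj n} → Symmetric A₁ → (∀ x y → A₁ x y ≡ true → A x y ≡ true) →
    ∀ L → Valid A₁ L → ¬ Touches A (removed L) → ∀ i → Closed A₁ (cell L i)
  untouched-cell-closed {A₁ = A₁} A₁-sym A₁⊆A L val ¬touch i x y a =
    cong₂ _∧_ (cong not (trans rx (sym ry))) (cong (_== i) (val x y a rx ry))
    where
    rx : removed L x ≡ false
    rx = ¬true λ r → ¬touch (x , y , r , A₁⊆A x y a)
    ry : removed L y ≡ false
    ry = ¬true λ r → ¬touch (y , x , r , A₁⊆A y x (trans (A₁-sym y x) a))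

  module SingleEdge {n : ℕ} (A : Adj n) (g : Fin n → ℕ) (A-sym : Symmetric A) (A-irr : Irreflexive A)
    (T : Tutte A g) (u v : Fin n) (uv : A u v ≡ true)
    (loose : ∀ L → Valid A L → Touches A (removed L) → 2 + oddCells g L ≤ weight g (removed L)) where

    A₁ : Adj n
    A₁ = delete A u v

    A₁-sym : Symmetric A₁
    A₁-sym x y = cong₂ _∧_ (A-sym x y) (cong not (edge-sym u v x y))

    A₁-irr : Irreflexive A₁
    A₁-irr x rewrite A-irr x = refl

    fewer : arcs A₁ < arcs A
    fewer = ∑∑-mono-< (delete-⊆ A u v) u v (delete-self A u v) uv

    u≢v : u ≢ v
    u≢v refl = true≢false (trans (sym uv) (A-irr u))

    reclose : ∀ {P} → Closed A₁ P → P u ≡ P v → Closed A P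
    reclose cl e x y a with delete-cases A u v {x} {y} a
    ... | inj₁ d = cl x y d
    ... | inj₂ (inj₁ (refl , refl)) = e
    ... | inj₂ (inj₂ (refl , refl)) = sym e

    -- Remove `w` alone and put the rest into one cell: the slack then falls entirely on `g w`. This
    -- makes it safe to lower `g` at both ends of the edge.
    2≤g : ∀ w y → A w y ≡ true → 2 ≤ g w
    2≤g w y a = ≤-trans (m≤m+n 2 _) (≤-trans
      (loose (record { labels = 1 ; removed = w ==_ ; label = λ _ → zero }) (λ _ _ _ _ _ → refl) (w , y , ==-refl w , a))
      (≤-reflexive (weight-singleton g w)))

    -- The obstruction to deleting the edge: a factor that avoids it would have an odd degree sum
    -- inside `P`.
    OddBridge : Set
    OddBridge = Σ (Fin n → Bool) λ P → P u ≡ true × P v ≡ false × Closed A₁ P × weight g P % 2 ≡ 1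

    total-even : (P : Fin n → Bool) → weight g P % 2 ≡ weight g (not ∘ P) % 2
    total-even P = %2-+-cancelˡ (weight g P) _
      (trans (cong (_% 2) (weight-complement g P)) (closed-even {A = A} T (λ _ → true) λ _ _ _ → refl))

    -- For a touching removed set, slack 2 pays for the odd cells lost in the merge. Otherwise all
    -- cells are closed in `A₁`, and an odd cell that separates `u` from `v`, or its complement,
    -- would be an odd bridge.
    delete-tutte : ¬ OddBridge → Tutte A₁ g
    delete-tutte ¬bridge L val with touches? A (removed L)
    ... | yes touch = ≤-trans (oddCells-mergeEnds g g u v (λ _ _ _ → refl) L)
          (≤-trans (+-monoʳ-≤ _ (+-mono-≤ (⟦⟧≤1 (not (removed L u))) (⟦⟧≤1 (not (removed L v))))) (≤-trans (≤-reflexive (+-comm _ 2))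
            (loose (mergeEnds L u v) (mergeEnds-valid A L val) touch)))
    ... | no ¬touch = ≤-trans (≤-reflexive (∑-zero even)) z≤n
      where
      even : ∀ i → weight g (cell L i) % 2 ≡ 0
      even i with bool? (cell L i u) | bool? (cell L i v) | untouched-cell-closed {A = A} A₁-sym (delete-⊆ A u v) L val ¬touch i
      ... | inj₁ p | inj₁ q | cl = closed-even {A = A} T _ (reclose cl (trans p (sym q)))
      ... | inj₂ p | inj₂ q | cl = closed-even {A = A} T _ (reclose cl (trans p (sym q)))
      ... | inj₁ p | inj₂ q | cl with %2-cases (weight g (cell L i))
      ...   | inj₁ e = e
      ...   | inj₂ e = ⊥-elim (¬bridge (cell L i , p , q , cl , e))
      even i | inj₂ p | inj₁ q | cl with %2-cases (weight g (cell L i))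
      ...   | inj₁ e = e
      ...   | inj₂ e = ⊥-elim (¬bridge (not ∘ cell L i , cong not p , cong not q , (λ x y a → cong not (cl x y a)) ,
                         trans (sym (total-even (cell L i))) e))

    g₁ : Fin n → ℕ
    g₁ x = g x ∸ (⟦ u == x ⟧ + ⟦ v == x ⟧)

    g₁-restore : ∀ x → g₁ x + (⟦ u == x ⟧ + ⟦ v == x ⟧) ≡ g x
    g₁-restore x = m∸n+n≡m bounded
      where
      bounded : ⟦ u == x ⟧ + ⟦ v == x ⟧ ≤ g x
      bounded with u ≟ x | v ≟ x
      ... | yes refl | _ = ≤-trans (s≤s (⟦⟧≤1 _)) (2≤g u v uv)
      ... | no _ | yes refl = ≤-trans (s≤s z≤n) (2≤g v u (trans (A-sym v u) uv))
      ... | no _ | no _ = z≤n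

    weight-g₁ : ∀ Q → weight g₁ Q + (⟦ Q u ⟧ + ⟦ Q v ⟧) ≡ weight g Q
    weight-g₁ Q = trans (cong (weight g₁ Q +_) (sym (trans
        (trans (∑-cong λ x → *-distribˡ-+ ⟦ Q x ⟧ _ _) (∑-distrib-+ _ _))
        (cong₂ _+_ (weight-point u Q) (weight-point v Q)))))
      (weight-shift Q λ x _ → g₁-restore x)

    -- A side of the bridge is odd and only the end of uv in it changes parity.
    half-even : ∀ P Q w → Q w ≡ true → Closed A₁ P → Closed A₁ Q → weight g Q % 2 ≡ 1 →
      (∀ R → R w ≡ false → (∀ x → R x ≡ true → Q x ≡ true) → Closed A₁ R → weight g R % 2 ≡ 0) →
      (∀ R → (∀ x → R x ≡ true → Q x ≡ true) → weight g₁ R + ⟦ R w ⟧ ≡ weight g R) →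
      weight g₁ (λ x → P x ∧ Q x) % 2 ≡ 0
    half-even P Q w w∈Q P-closed Q-closed odd even shift with bool? (P w)
    ... | inj₂ w∉P = trans (cong (_% 2) (trans (sym (+-identityʳ _)) (trans (cong (λ z → weight g₁ PQ + ⟦ z ⟧) (sym w∉PQ)) (shift PQ sub))))
                       (even PQ w∉PQ sub PQ-closed)
      where
      PQ = λ x → P x ∧ Q x
      sub : ∀ x → PQ x ≡ true → Q x ≡ true
      sub x e = proj₂ (∧-true {P x} e)
      w∉PQ : PQ w ≡ false
      w∉PQ rewrite w∉P = refl
      PQ-closed : Closed A₁ PQ
      PQ-closed x y a = cong₂ _∧_ (P-closed x y a) (Q-closed x y a)
    ... | inj₁ w∈P = %2-suc-odd (weight g₁ PQ) (begin
        (1 + weight g₁ PQ) % 2           ≡⟨ cong (_% 2) (+-comm 1 (weight g₁ PQ)) ⟩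
        (weight g₁ PQ + 1) % 2           ≡⟨ cong (λ z → (weight g₁ PQ + ⟦ z ⟧) % 2) w∈PQ ⟨
        (weight g₁ PQ + ⟦ PQ w ⟧) % 2    ≡⟨ cong (_% 2) (shift PQ sub) ⟩
        weight g PQ % 2                  ≡⟨ m%n%n≡m%n (weight g PQ) 2 ⟨
        weight g PQ % 2 % 2              ≡⟨ cong (_% 2) (+-identityʳ (weight g PQ % 2)) ⟨
        (weight g PQ % 2 + 0) % 2        ≡⟨ cong (λ z → (weight g PQ % 2 + z) % 2) (even rest w∉rest rest-sub rest-closed) ⟨
        (weight g PQ % 2 + weight g rest % 2) % 2 ≡⟨ %2-+ (weight g PQ) _ ⟨
        (weight g PQ + weight g rest) % 2 ≡⟨ cong (_% 2) (weight-+ g PQ rest Q parts) ⟩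
        weight g Q % 2                   ≡⟨ odd ⟩
        1                                ∎)
      where
      open ≡-Reasoning
      PQ = λ x → P x ∧ Q x
      rest = λ x → not (P x) ∧ Q x
      sub : ∀ x → PQ x ≡ true → Q x ≡ true
      sub x e = proj₂ (∧-true {P x} e)
      rest-sub : ∀ x → rest x ≡ true → Q x ≡ true
      rest-sub x e = proj₂ (∧-true {not (P x)} e)
      w∈PQ : PQ w ≡ true
      w∈PQ = cong₂ _∧_ w∈P w∈Q
      w∉rest : rest w ≡ false
      w∉rest rewrite w∈P = refl
      rest-closed : Closed A₁ rest
      rest-closed x y a = cong₂ _∧_ (cong not (P-closed x y a)) (Q-closed x y a)
      parts : ∀ x → ⟦ PQ x ⟧ + ⟦ rest x ⟧ ≡ ⟦ Q x ⟧
      parts x with P x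
      ... | true = +-identityʳ _
      ... | false = refl

    -- For a touching removed set each end costs 1, either in the weight if it is removed or in the
    -- odd cells if it is not, and slack 2 pays for both. Otherwise each cell is cut along `P`; each
    -- half contains at most one end, and `half-even` applies to it.
    use-tutte : OddBridge → Tutte A₁ g₁
    use-tutte (P , u∈P , v∉P , P-closed , P-odd) L val with touches? A (removed L)
    ... | yes touch = +-cancelʳ-≤ 2 _ _ (begin
        oddCells g₁ L + 2                   ≤⟨ +-monoˡ-≤ 2 (oddCells-mergeEnds g g₁ u v off L) ⟩
        oddCells g L′ + (⟦ not (S u) ⟧ + ⟦ not (S v) ⟧) + 2 ≡⟨ rearrange (oddCells g L′) (⟦ not (S u) ⟧ + ⟦ not (S v) ⟧) ⟩
        2 + oddCells g L′ + (⟦ not (S u) ⟧ + ⟦ not (S v) ⟧) ≤⟨ +-monoˡ-≤ _ (loose L′ (mergeEnds-valid A L val) touch) ⟩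
        weight g S + (⟦ not (S u) ⟧ + ⟦ not (S v) ⟧) ≡⟨ cong (_+ (⟦ not (S u) ⟧ + ⟦ not (S v) ⟧)) (weight-g₁ S) ⟨
        weight g₁ S + (⟦ S u ⟧ + ⟦ S v ⟧) + (⟦ not (S u) ⟧ + ⟦ not (S v) ⟧) ≡⟨ regroup (weight g₁ S) ⟦ S u ⟧ ⟦ S v ⟧ ⟦ not (S u) ⟧ ⟦ not (S v) ⟧ ⟩
        weight g₁ S + ((⟦ S u ⟧ + ⟦ not (S u) ⟧) + (⟦ S v ⟧ + ⟦ not (S v) ⟧)) ≡⟨ cong₂ (λ a b → weight g₁ S + (a + b)) (⟦⟧-not (S u)) (⟦⟧-not (S v)) ⟩
        weight g₁ S + 2                     ∎)
      where
      open ≤-Reasoning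
      S = removed L
      L′ = mergeEnds L u v
      rearrange : ∀ a b → a + b + 2 ≡ 2 + a + b
      rearrange = solve-∀
      regroup : ∀ w a b c d → w + (a + b) + (c + d) ≡ w + ((a + c) + (b + d))
      regroup = solve-∀
      off : ∀ x → x ≢ u → x ≢ v → g₁ x ≡ g x
      off x x≢u x≢v = trans (sym (+-identityʳ _)) (trans (cong₂ (λ a b → g₁ x + (⟦ a ⟧ + ⟦ b ⟧))
        (sym (≢⇒== (x≢u ∘ sym))) (sym (≢⇒== (x≢v ∘ sym)))) (g₁-restore x))
    ... | no ¬touch = ≤-trans (≤-reflexive (∑-zero even)) z≤n
      where
      even : ∀ i → weight g₁ (cell L i) % 2 ≡ 0
      even i = begin
        weight g₁ K % 2 ≡⟨ cong (_% 2) (weight-+ g₁ (λ x → K x ∧ P x) (λ x → K x ∧ not (P x)) K split) ⟨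
        (weight g₁ (λ x → K x ∧ P x) + weight g₁ (λ x → K x ∧ not (P x))) % 2 ≡⟨ %2-+ (weight g₁ (λ x → K x ∧ P x)) _ ⟩
        (weight g₁ (λ x → K x ∧ P x) % 2 + weight g₁ (λ x → K x ∧ not (P x)) % 2) % 2 ≡⟨ cong₂ (λ a b → (a + b) % 2) near far ⟩
        0 ∎
        where
        open ≡-Reasoning
        K = cell L i
        K-closed : Closed A₁ K
        K-closed = untouched-cell-closed {A = A} A₁-sym (delete-⊆ A u v) L val ¬touch i
        split : ∀ x → ⟦ K x ∧ P x ⟧ + ⟦ K x ∧ not (P x) ⟧ ≡ ⟦ K x ⟧
        split x with K x
        ... | true = ⟦⟧-not (P x)
        ... | false = refl
        near : weight g₁ (λ x → K x ∧ P x) % 2 ≡ 0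
        near = half-even K P u u∈P K-closed P-closed P-odd
          (λ R u∉R R⊆P cl → closed-even {A = A} T R (reclose cl (trans u∉R (sym (v∉ R R⊆P)))))
          (λ R R⊆P → trans (cong (weight g₁ R +_) (trans (sym (+-identityʳ _)) (cong (λ z → ⟦ R u ⟧ + ⟦ z ⟧) (sym (v∉ R R⊆P))))) (weight-g₁ R))
          where
          v∉ : ∀ R → (∀ x → R x ≡ true → P x ≡ true) → R v ≡ false
          v∉ R R⊆P = ¬true λ r → true≢false (trans (sym (R⊆P v r)) v∉P)
        far : weight g₁ (λ x → K x ∧ not (P x)) % 2 ≡ 0
        far = half-even K (not ∘ P) v (cong not v∉P) K-closed (λ x y a → cong not (P-closed x y a)) (trans (sym (total-even P)) P-odd)
          (λ R v∉R R⊆ cl → closed-even {A = A} T R (reclose cl (trans (u∉ R R⊆) (sym v∉R))))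
          (λ R R⊆ → trans (cong (λ z → weight g₁ R + (⟦ z ⟧ + ⟦ R v ⟧)) (sym (u∉ R R⊆))) (weight-g₁ R))
          where
          u∉ : ∀ R → (∀ x → R x ≡ true → not (P x) ≡ true) → R u ≡ false
          u∉ R R⊆ = ¬true λ r → true≢false (trans (sym u∈P) (not-true (R⊆ u r)))

    edge⊆A : ∀ x y → edge u v x y ≡ true → A x y ≡ true
    edge⊆A x y e with edge-true {u = u} {v} {x} {y} e
    ... | inj₁ (refl , refl) = uv
    ... | inj₂ (refl , refl) = trans (A-sym v u) uv

    factor : FactorsBelow A → ¬ ¬ ParityFactor A g
    factor below k = em λ where
      (inj₁ bridge) → below A₁ g₁ A₁-sym A₁-irr fewer (use-tutte bridge) λ F → k
        (extend-factor (edge u v) (edge-sym u v) edge⊆A (delete-⊆ A u v) (λ x y e → not-true (proj₂ (∧-true {A x y} e)))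
          (λ x → trans (cong (g₁ x +_) (size-edge u≢v x)) (g₁-restore x)) F)
      (inj₂ ¬bridge) → below A₁ g A₁-sym A₁-irr fewer (delete-tutte ¬bridge) λ (F , s , i , d) →
        k (F , s , (λ x y f → delete-⊆ A u v x y (i x y f)) , d)

  -- Reduction along a tight labelling

  odd? : ℕ → Bool
  odd? a = ⌊ a % 2 ℕ.≟ 1 ⌋

  ⟦odd?⟧ : ∀ a → ⟦ odd? a ⟧ ≡ a % 2
  ⟦odd?⟧ a with %2-cases a
  ... | inj₁ e rewrite e = refl
  ... | inj₂ e rewrite e = refl

  ↑ˡ-== : ∀ {m} n (i j : Fin m) → (i ↑ˡ n == j ↑ˡ n) ≡ (i == j)
  ↑ˡ-== n i j = bool-ext (λ e → subst (λ z → (i == z) ≡ true) (↑ˡ-injective n i j (==⇒≡ e)) (==-refl i))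
                         (λ e → subst (λ z → (i ↑ˡ n == z ↑ˡ n) ≡ true) (==⇒≡ e) (==-refl (i ↑ˡ n)))

  ↑ʳ-== : ∀ m {n} (i j : Fin n) → (m ↑ʳ i == m ↑ʳ j) ≡ (i == j)
  ↑ʳ-== m i j = bool-ext (λ e → subst (λ z → (i == z) ≡ true) (↑ʳ-injective m i j (==⇒≡ e)) (==-refl i))
                         (λ e → subst (λ z → (m ↑ʳ i == m ↑ʳ z) ≡ true) (==⇒≡ e) (==-refl (m ↑ʳ i)))

  ↑ˡ≢↑ʳ : ∀ {m n} (i : Fin m) (j : Fin n) → i ↑ˡ n ≢ m ↑ʳ j
  ↑ˡ≢↑ʳ {m} {n} i j e with trans (sym (splitAt-↑ˡ m i n)) (trans (cong (splitAt m) e) (splitAt-↑ʳ m n j))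
  ... | ()

  cell-label : ∀ {n} (L : Labelling n) {i x} → cell L i x ≡ true → removed L x ≡ false × label L x ≡ i
  cell-label L {i} {x} e = not-true (proj₁ p) , ==⇒≡ (proj₂ p)
    where p = ∧-true {not (removed L x)} e

  size-cells-at : ∀ {n} (L : Labelling n) x → ∑ (λ i → ⟦ cell L i x ⟧) ≡ ⟦ not (removed L x) ⟧
  size-cells-at L x = trans (∑-cong λ i → trans (⟦∧⟧ (not (removed L x)) _) (*-comm ⟦ not (removed L x) ⟧ _))
    (∑-indicator (label L x) (λ _ → ⟦ not (removed L x) ⟧))

  oddVertices : ∀ {n} → (Fin n → ℕ) → Labelling n → ℕ
  oddVertices g L = ∑ λ x → ⟦ not (removed L x) ⟧ * (weight g (cell L (label L x)) % 2)

  -- Vertices lose their edges instead of being deleted, so the vertex type stays `Fin n`. Wherever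
  -- a factor of the result is sought, the weight function vanishes on `S`.
  isolate : ∀ {n} → Adj n → (Fin n → Bool) → Adj n
  isolate A S x y = A x y ∧ (not (S x) ∧ not (S y))

  -- Cell `i` is cut up by `L₂`, whose labels form the second summand. The old label `i` stays with
  -- an empty cell, which avoids renumbering.
  refine : ∀ {n} (L L₂ : Labelling n) → Fin (labels L) → Labelling n
  refine L L₂ i = record
    { labels = labels L + labels L₂
    ; removed = λ x → removed L x ∨ (cell L i x ∧ removed L₂ x)
    ; label = λ x → if label L x == i then labels L ↑ʳ label L₂ x else label L x ↑ˡ labels L₂
    }

  module Refinement {n : ℕ} (L L₂ : Labelling n) (i : Fin (labels L)) where

    L′ : Labelling n
    L′ = refine L L₂ i

    refine-valid : ∀ {A} → Valid A L → Valid (isolate A (removed L)) L₂ → Valid A L′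
    refine-valid {A} val val₂ x y a rx ry = go (piece x rx) (piece y ry)
      where
      piece : ∀ z → removed L′ z ≡ false → removed L z ≡ false × (label L z ≡ i → removed L₂ z ≡ false)
      piece z rz with ∨-false rz
      ... | sz , tz = sz , λ { refl → keep sz tz }
        where
        keep : removed L z ≡ false → (cell L (label L z) z ∧ removed L₂ z) ≡ false → removed L₂ z ≡ false
        keep sz tz rewrite sz | ==-refl (label L z) = tz
      go : removed L x ≡ false × (label L x ≡ i → removed L₂ x ≡ false) →
           removed L y ≡ false × (label L y ≡ i → removed L₂ y ≡ false) → label L′ x ≡ label L′ y
      go (sx , tx) (sy , ty) with label L x ≟ i | label L y ≟ i
      ... | yes p | yes q = cong (labels L ↑ʳ_) (val₂ x y (cong₂ _∧_ a (cong₂ _∧_ (cong not sx) (cong not sy))) (tx p) (ty q))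
      ... | no _ | no _ = cong (_↑ˡ labels L₂) (val x y a sx sy)
      ... | yes p | no q = ⊥-elim (q (trans (sym (val x y a sx sy)) p))
      ... | no p | yes q = ⊥-elim (p (trans (val x y a sx sy) q))

    cell-old : ∀ k x → cell L′ (k ↑ˡ labels L₂) x ≡ (not (i == k) ∧ cell L k x)
    cell-old k x with removed L x
    ... | true with i == k
    ...   | true = refl
    ...   | false = refl
    cell-old k x | false with label L x ≟ i
    ... | yes refl rewrite ≢⇒== (↑ˡ≢↑ʳ k (label L₂ x) ∘ sym) with label L x == k | removed L₂ x
    ...   | true | true = refl
    ...   | true | false = refl
    ...   | false | true = refl
    ...   | false | false = refl
    cell-old k x | false | no ne rewrite ↑ˡ-== (labels L₂) (label L x) k with i ≟ k
    ... | yes refl = ≢⇒== ne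
    ... | no _ = refl

    cell-new : ∀ j x → cell L′ (labels L ↑ʳ j) x ≡ (cell L i x ∧ cell L₂ j x)
    cell-new j x with removed L x
    ... | true = refl
    ... | false with label L x ≟ i
    ...   | yes refl rewrite ↑ʳ-== (labels L) (label L₂ x) j = refl
    ...   | no _ = ≢⇒== (↑ˡ≢↑ʳ (label L x) j)

    pieces : (Fin n → ℕ) → ℕ
    pieces g = ∑ λ j → weight g (λ x → cell L i x ∧ cell L₂ j x) % 2

    oddCells-refine : ∀ g → oddCells g L′ + weight g (cell L i) % 2 ≡ oddCells g L + pieces g
    oddCells-refine g = begin
      oddCells g L′ + d i
        ≡⟨ cong (_+ d i) (∑-split (labels L) _) ⟩
      ∑ (λ k → weight g (cell L′ (k ↑ˡ labels L₂)) % 2) + ∑ (λ j → weight g (cell L′ (labels L ↑ʳ j)) % 2) + d i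
        ≡⟨ cong₂ (λ a b → a + b + d i) (∑-cong λ k → cong (_% 2) (weight-cong g (cell-old k))) (∑-cong λ j → cong (_% 2) (weight-cong g (cell-new j))) ⟩
      ∑ (λ k → others k) + pieces g + d i
        ≡⟨ swap (∑ others) (pieces g) (d i) ⟩
      ∑ (λ k → others k) + d i + pieces g
        ≡⟨ cong (λ z → ∑ others + z + pieces g) (∑-indicator i d) ⟨
      ∑ (λ k → others k) + ∑ (λ k → ⟦ i == k ⟧ * d k) + pieces g
        ≡⟨ cong (_+ pieces g) (trans (sym (∑-distrib-+ _ _)) (∑-cong pointwise)) ⟩
      oddCells g L + pieces g ∎
      where
      open ≡-Reasoning
      d : Fin (labels L) → ℕ
      d k = weight g (cell L k) % 2
      others : Fin (labels L) → ℕ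
      others k = weight g (λ x → not (i == k) ∧ cell L k x) % 2
      swap : ∀ a b c → a + b + c ≡ a + c + b
      swap = solve-∀
      pointwise : ∀ k → others k + ⟦ i == k ⟧ * d k ≡ d k
      pointwise k with i == k
      ... | true = trans (cong (λ z → z % 2 + (d k + 0)) (weight-empty g λ _ → refl)) (+-identityʳ _)
      ... | false = +-identityʳ _

    weight-refine : ∀ g → weight g (removed L′) ≡ weight g (removed L) + weight g (λ x → cell L i x ∧ removed L₂ x)
    weight-refine g = sym (weight-+ g (removed L) (λ x → cell L i x ∧ removed L₂ x) (removed L′) pointwise)
      where
      pointwise : ∀ x → ⟦ removed L x ⟧ + ⟦ cell L i x ∧ removed L₂ x ⟧ ≡ ⟦ removed L′ x ⟧
      pointwise x with removed L x
      ... | true = refl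
      ... | false = refl

    -- All vertices of an odd cell were counted already, so splitting it can only lose some, and
    -- other cells are untouched. The termwise form lets minimality be read off at a single vertex.
    oddVertices-refine : ∀ g → weight g (cell L i) % 2 ≡ 1 → ∀ x →
      ⟦ not (removed L′ x) ⟧ * (weight g (cell L′ (label L′ x)) % 2) ≤
      ⟦ not (removed L x) ⟧ * (weight g (cell L (label L x)) % 2)
    oddVertices-refine g odd x with removed L x
    ... | true = z≤n
    ... | false with label L x ≟ i
    ...   | yes refl = ≤-trans (*-mono-≤ (⟦⟧≤1 (not (removed L₂ x))) (%2≤1 (weight g (cell L′ (labels L ↑ʳ label L₂ x)))))
                         (≤-reflexive (sym (trans (+-identityʳ _) odd)))
    ...   | no ne = ≤-reflexive (cong (λ z → z % 2 + 0) (weight-cong g λ y →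
                      trans (cell-old (label L x) y) (cong (λ z → not z ∧ cell L (label L x) y) (≢⇒== (ne ∘ sym)))))

  module TightReduction {n : ℕ} (A : Adj n) (g : Fin n → ℕ) (A-sym : Symmetric A) (A-irr : Irreflexive A)
    (T : Tutte A g) (L : Labelling n) (val : Valid A L)
    (tight : oddCells g L ≡ weight g (removed L)) (touch : Touches A (removed L))
    (least : ∀ L′ → Valid A L′ × oddCells g L′ ≡ weight g (removed L′) × Touches A (removed L′) →
      oddVertices g L ≤ oddVertices g L′) where

    S : Fin n → Bool
    S = removed L

    D : Fin (labels L) → Bool
    D i = odd? (weight g (cell L i))

    D-odd : ∀ i → D i ≡ true → weight g (cell L i) % 2 ≡ 1
    D-odd i e = trans (sym (⟦odd?⟧ (weight g (cell L i)))) (cong ⟦_⟧ e)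

    D-even : ∀ i → D i ≡ false → weight g (cell L i) % 2 ≡ 0
    D-even i e = trans (sym (⟦odd?⟧ (weight g (cell L i)))) (cong ⟦_⟧ e)

    ∑-D : ∑ (λ i → ⟦ D i ⟧) ≡ weight g S
    ∑-D = trans (∑-cong λ i → ⟦odd?⟧ (weight g (cell L i))) tight

    A₁ : Adj n
    A₁ = isolate A S

    -- Subtracting the equality for `L` from the condition for the refinement leaves a statement
    -- about the cell `i` alone.
    refine-≤ : ∀ L₂ → Valid A₁ L₂ → ∀ i → Refinement.pieces L L₂ i g ≤
      weight g (cell L i) % 2 + weight g (λ x → cell L i x ∧ removed L₂ x)
    refine-≤ L₂ val₂ i = +-cancelˡ-≤ (weight g S) _ _ (begin
      weight g S + pieces g            ≡⟨ cong (_+ pieces g) tight ⟨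
      oddCells g L + pieces g          ≡⟨ oddCells-refine g ⟨
      oddCells g L′ + d                ≤⟨ +-monoˡ-≤ d (T L′ (refine-valid val val₂)) ⟩
      weight g (removed L′) + d        ≡⟨ cong (_+ d) (weight-refine g) ⟩
      weight g S + B + d               ≡⟨ swap (weight g S) B d ⟩
      weight g S + (d + B)             ∎)
      where
      open ≤-Reasoning
      open Refinement L L₂ i
      d = weight g (cell L i) % 2
      B = weight g (λ x → cell L i x ∧ removed L₂ x)
      swap : ∀ a b c → a + b + c ≡ a + (c + b)
      swap = solve-∀

    -- A tight refinement of an odd cell must, by minimality, keep every vertex of the cell in an odd cell.
    refine-odd : ∀ L₂ → Valid A₁ L₂ → ∀ i → D i ≡ true → ∀ v → cell L i v ≡ true →
      (removed L₂ v ≡ false × weight g (λ x → cell L i x ∧ cell L₂ (label L₂ v) x) % 2 ≡ 1 ×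
        Refinement.pieces L L₂ i g ≡ 1 + weight g (λ x → cell L i x ∧ removed L₂ x))
      ⊎ (1 + Refinement.pieces L L₂ i g ≤ weight g (λ x → cell L i x ∧ removed L₂ x))
    refine-odd L₂ val₂ i Di v v∈ with oddCells g (refine L L₂ i) ℕ.≟ weight g (removed (refine L L₂ i))
    ... | yes tight′ = inj₁ (kept (removed L₂ v) refl at-v , odd-piece , +-cancelˡ-≡ (weight g S) _ _ count)
      where
      open Refinement L L₂ i
      B = weight g (λ x → cell L i x ∧ removed L₂ x)
      fv : label L v ≡ i
      fv = proj₂ (cell-label L v∈)
      Sv : S v ≡ false
      Sv = proj₁ (cell-label L {i} v∈)
      equal : ⟦ not (removed L′ v) ⟧ * (weight g (cell L′ (label L′ v)) % 2) ≡ ⟦ not (S v) ⟧ * (weight g (cell L (label L v)) % 2)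
      equal = ∑-≤⇒≗ (oddVertices-refine g (D-odd i Di)) (least L′ (refine-valid val val₂ , tight′ , touch′)) v
        where
        touch′ : Touches A (removed L′)
        touch′ = let (x , y , s , a) = touch in x , y , cong (_∨ (cell L i x ∧ removed L₂ x)) s , a
      removed-v : removed L′ v ≡ removed L₂ v
      removed-v rewrite Sv | fv | ==-refl i = refl
      label-v : label L′ v ≡ labels L ↑ʳ label L₂ v
      label-v rewrite fv | ==-refl i = refl
      at-v : ⟦ not (removed L₂ v) ⟧ * (weight g (cell L′ (labels L ↑ʳ label L₂ v)) % 2) ≡ 1
      at-v = trans (cong₂ (λ a b → ⟦ not a ⟧ * (weight g (cell L′ b) % 2)) (sym removed-v) (sym label-v))
        (trans equal (trans (cong₂ (λ a b → ⟦ not a ⟧ * (weight g (cell L b) % 2)) Sv fv) (trans (+-identityʳ _) (D-odd i Di))))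
      kept : ∀ r {w} → removed L₂ v ≡ r → ⟦ not r ⟧ * w ≡ 1 → removed L₂ v ≡ false
      kept false e _ = e
      odd-piece : weight g (λ x → cell L i x ∧ cell L₂ (label L₂ v) x) % 2 ≡ 1
      odd-piece = trans (cong (_% 2) (sym (weight-cong g (cell-new (label L₂ v))))) (unit (removed L₂ v) at-v)
        where
        unit : ∀ r {w} → ⟦ not r ⟧ * w ≡ 1 → w ≡ 1
        unit false e = trans (sym (+-identityʳ _)) e
      count : weight g S + pieces g ≡ weight g S + (1 + B)
      count = begin
        weight g S + pieces g            ≡⟨ cong (_+ pieces g) tight ⟨
        oddCells g L + pieces g          ≡⟨ oddCells-refine g ⟨
        oddCells g L′ + weight g (cell L i) % 2 ≡⟨ cong₂ _+_ tight′ (D-odd i Di) ⟩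
        weight g (removed L′) + 1        ≡⟨ cong (_+ 1) (weight-refine g) ⟩
        weight g S + B + 1               ≡⟨ swap (weight g S) B ⟩
        weight g S + (1 + B)             ∎
        where
        open ≡-Reasoning
        swap : ∀ a b → a + b + 1 ≡ a + (1 + b)
        swap = solve-∀
    -- Slack 2, less 1 for the odd cell `i` that was split.
    ... | no ¬tight = inj₂ (+-cancelˡ-≤ (1 + weight g S) _ _ (begin
        1 + weight g S + (1 + pieces g)  ≡⟨ shift (weight g S) (pieces g) ⟩
        2 + (weight g S + pieces g)      ≡⟨ cong (λ z → 2 + (z + pieces g)) tight ⟨
        2 + (oddCells g L + pieces g)    ≡⟨ cong (2 +_) (oddCells-refine g) ⟨
        2 + oddCells g L′ + weight g (cell L i) % 2 ≤⟨ +-mono-≤ (tutte-gap {A = A} T L′ (refine-valid val val₂) ¬tight) (%2≤1 (weight g (cell L i))) ⟩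
        weight g (removed L′) + 1        ≡⟨ cong (_+ 1) (weight-refine g) ⟩
        weight g S + B + 1               ≡⟨ swap (weight g S) B ⟩
        1 + weight g S + B               ∎))
      where
      open ≤-Reasoning
      open Refinement L L₂ i
      B = weight g (λ x → cell L i x ∧ removed L₂ x)
      shift : ∀ a b → 1 + a + (1 + b) ≡ 2 + (a + b)
      shift = solve-∀
      swap : ∀ a b → a + b + 1 ≡ 1 + a + b
      swap = solve-∀

    R : Fin (labels L) → Fin n → Bool
    R i s = S s ∧ ⌊ any? (λ x → (cell L i x ∧ A s x) Bool.≟ true) ⌋

    R-intro : ∀ {i s x} → S s ≡ true → cell L i x ≡ true → A s x ≡ true → R i s ≡ true
    R-intro {i} {s} {x} s∈ x∈ a rewrite s∈ with any? (λ x → (cell L i x ∧ A s x) Bool.≟ true)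
    ... | yes _ = refl
    ... | no ¬p = ⊥-elim (¬p (x , cong₂ _∧_ x∈ a))

    R-elim : ∀ {i s} → R i s ≡ true → S s ≡ true × ∃ λ x → cell L i x ≡ true × A s x ≡ true
    R-elim {i} {s} r with S s | any? (λ x → (cell L i x ∧ A s x) Bool.≟ true)
    ... | true | yes (x , e) = refl , x , ∧-true e

    -- Put the vertices of `S` outside `Z` back and merge everything except the cells in `W`. These
    -- stay separate, as all their neighbours in `S` lie in `Z`, so the condition weighs at least
    -- `size W` odd cells against the part of `S` in `Z`.
    hall-condition : Hall R D g
    hall-condition W Z W⊆D cover = begin
      size W                       ≤⟨ ∑-mono odd ⟩
      ∑ (λ i → weight g (cell L″ (suc i)) % 2) ≤⟨ m≤n+m _ _ ⟩
      ∑ (λ (i : Fin 1) → weight g (cell L″ (i ↑ˡ labels L)) % 2) + ∑ (λ i → weight g (cell L″ (suc i)) % 2) ≡⟨ ∑-split 1 _ ⟨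
      oddCells g L″                ≤⟨ T L″ val″ ⟩
      weight g (λ x → S x ∧ Z x)   ≤⟨ ∑-mono (λ x → *-monoˡ-≤ (g x) (⟦⟧-mono λ e → proj₂ (∧-true {S x} e))) ⟩
      weight g Z                   ∎
      where
      open ≤-Reasoning
      chosen : Fin n → Bool
      chosen x = not (S x) ∧ W (label L x)
      L″ : Labelling n
      L″ = record { labels = suc (labels L) ; removed = λ x → S x ∧ Z x
                  ; label = λ x → if chosen x then suc (label L x) else zero }
      escape : ∀ x y → A x y ≡ true → chosen x ≡ true → (S y ∧ Z y) ≡ false → chosen y ≡ true
      escape x y a cx ry with bool? (S y)
      ... | inj₂ sy = cong₂ _∧_ (cong not sy) (trans (cong W (sym (val x y a (not-true (proj₁ p)) sy))) (proj₂ p))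
        where p = ∧-true {not (S x)} cx
      ... | inj₁ sy = ⊥-elim (true≢false (trans (sym (cong₂ _∧_ sy (cover (label L x) y (proj₂ p)
                        (R-intro sy (cong₂ _∧_ (proj₁ p) (==-refl (label L x))) (trans (A-sym y x) a))))) ry))
        where p = ∧-true {not (S x)} cx
      val″ : Valid A L″
      val″ x y a rx ry with bool? (chosen x) | bool? (chosen y)
      ... | inj₁ p | inj₁ q rewrite p | q = cong suc (val x y a (not-true (proj₁ (∧-true {not (S x)} p))) (not-true (proj₁ (∧-true {not (S y)} q))))
      ... | inj₂ p | inj₂ q rewrite p | q = refl
      ... | inj₁ p | inj₂ q = ⊥-elim (true≢false (trans (sym (escape x y a p ry)) q))
      ... | inj₂ p | inj₁ q = ⊥-elim (true≢false (trans (sym (escape y x (trans (A-sym y x) a) q rx)) p))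
      same : ∀ i → W i ≡ true → ∀ x → cell L i x ≡ cell L″ (suc i) x
      same i w x with S x
      ... | true with not (Z x)
      ...   | true = refl
      ...   | false = refl
      same i w x | false with bool? (W (label L x))
      ... | inj₁ e rewrite e = sym (==-suc (label L x) i)
      ... | inj₂ e rewrite e = ≢⇒== λ p → true≢false (trans (sym w) (trans (cong W (sym p)) e))
      odd : ∀ i → ⟦ W i ⟧ ≤ weight g (cell L″ (suc i)) % 2
      odd i with bool? (W i)
      ... | inj₂ w rewrite w = z≤n
      ... | inj₁ w = ≤-trans (⟦⟧≤1 (W i)) (≤-reflexive (sym (trans (cong (_% 2) (sym (weight-cong g (same i w)))) (D-odd i (W⊆D i w)))))

    module Assigned (φ : Fin (labels L) → Fin n) (r : Fin (labels L) → Fin n)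
      (φ∈S : ∀ i → D i ≡ true → S (φ i) ≡ true) (r∈cell : ∀ i → D i ≡ true → cell L i (r i) ≡ true)
      (φr : ∀ i → D i ≡ true → A (φ i) (r i) ≡ true)
      (capacity : ∀ s → size (λ i → D i ∧ (φ i == s)) ≤ g s) where

      -- By tightness the capacities over `S` add up to the number of odd cells, each of which is
      -- assigned to a vertex of `S`; no capacity is left over.
      saturated : ∀ s → S s ≡ true → size (λ i → D i ∧ (φ i == s)) ≡ g s
      saturated s s∈ = cancel (∑-≤⇒≗ (λ s → *-monoʳ-≤ ⟦ S s ⟧ (capacity s)) (≤-reflexive (sym total)) s)
        where
        cancel : ∀ {a c} → ⟦ S s ⟧ * a ≡ ⟦ S s ⟧ * c → a ≡ c
        cancel {a} {c} e rewrite s∈ = trans (sym (+-identityʳ a)) (trans e (+-identityʳ c))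
        pointwise : ∀ s i → ⟦ S s ⟧ * ⟦ D i ∧ (φ i == s) ⟧ ≡ ⟦ φ i == s ⟧ * ⟦ D i ∧ S s ⟧
        pointwise s i = trans (cong (⟦ S s ⟧ *_) (⟦∧⟧ (D i) (φ i == s)))
          (trans (swap ⟦ S s ⟧ ⟦ D i ⟧ ⟦ φ i == s ⟧) (cong (⟦ φ i == s ⟧ *_) (sym (⟦∧⟧ (D i) (S s)))))
          where
          swap : ∀ a b c → a * (b * c) ≡ c * (b * a)
          swap = solve-∀
        D∧S : ∀ i → ⟦ D i ∧ S (φ i) ⟧ ≡ ⟦ D i ⟧
        D∧S i with bool? (D i)
        ... | inj₁ e = trans (cong (λ z → ⟦ D i ∧ z ⟧) (φ∈S i e)) (cong ⟦_⟧ (trans (cong (_∧ true) e) (sym e)))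
        ... | inj₂ e rewrite e = refl
        total : ∑ (λ s → ⟦ S s ⟧ * size (λ i → D i ∧ (φ i == s))) ≡ weight g S
        total = begin
          ∑ (λ s → ⟦ S s ⟧ * size (λ i → D i ∧ (φ i == s))) ≡⟨ ∑-cong (λ s → *-distribˡ-∑ ⟦ S s ⟧ _) ⟩
          ∑ (λ s → ∑ λ i → ⟦ S s ⟧ * ⟦ D i ∧ (φ i == s) ⟧) ≡⟨ ∑-comm _ ⟩
          ∑ (λ i → ∑ λ s → ⟦ S s ⟧ * ⟦ D i ∧ (φ i == s) ⟧) ≡⟨ ∑-cong (λ i → trans (∑-cong λ s → pointwise s i) (trans (∑-indicator (φ i) (λ s → ⟦ D i ∧ S s ⟧)) (D∧S i))) ⟩
          ∑ (λ i → ⟦ D i ⟧) ≡⟨ ∑-D ⟩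
          weight g S ∎
          where open ≡-Reasoning

      -- The representatives of the odd cells: each receives exactly one link and so loses 1 from
      -- `g`.
      E : Fin n → Bool
      E x = (not (S x) ∧ D (label L x)) ∧ (r (label L x) == x)

      E-elim : ∀ {x} → E x ≡ true → S x ≡ false × D (label L x) ≡ true × r (label L x) ≡ x
      E-elim {x} e = not-true (proj₁ q) , proj₂ q , ==⇒≡ (proj₂ p)
        where
        p = ∧-true {not (S x) ∧ D (label L x)} e
        q = ∧-true {not (S x)} (proj₁ p)

      E-intro : ∀ {i} → D i ≡ true → E (r i) ≡ true
      E-intro {i} d with cell-label L {i} (r∈cell i d)
      ... | s , e rewrite s | e | d = ==-refl (r i)

      half : Adj n
      half s y = E y ∧ (φ (label L y) == s)

      half-elim : ∀ {s y} → half s y ≡ true → S s ≡ true × S y ≡ false × A s y ≡ true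
      half-elim {s} {y} e with ∧-true {E y} e
      ... | p , q with E-elim p | ==⇒≡ q
      ... | sy , d , eq | refl = φ∈S _ d , sy , subst (λ z → A (φ (label L y)) z ≡ true) eq (φr _ d)

      M : Adj n
      M x y = half x y ∨ half y x

      M-elim : ∀ {x y} → M x y ≡ true → A x y ≡ true × isolate A S x y ≡ false
      M-elim {x} {y} e with ∨-true {half x y} e
      ... | inj₁ h = let (s , _ , a) = half-elim h in a , cut a s
        where
        cut : A x y ≡ true → S x ≡ true → isolate A S x y ≡ false
        cut a s rewrite a | s = refl
      ... | inj₂ h = let (s , t , a) = half-elim h in trans (A-sym x y) a , cut (trans (A-sym x y) a) s t
        where
        cut : A x y ≡ true → S y ≡ true → S x ≡ false → isolate A S x y ≡ false
        cut a s t rewrite a | s | t = refl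

      M-size-S : ∀ x → S x ≡ true → size (M x) ≡ g x
      M-size-S x s = begin
        size (M x)                                       ≡⟨ ∑-cong one-sided ⟩
        ∑ (λ y → ⟦ half x y ⟧)                           ≡⟨ ∑-cong (λ y → ∑-indicator (label L y) (λ _ → ⟦ half x y ⟧)) ⟨
        ∑ (λ y → ∑ λ i → ⟦ label L y == i ⟧ * ⟦ half x y ⟧) ≡⟨ ∑-cong (λ y → ∑-cong λ i → pointwise y i) ⟩
        ∑ (λ y → ∑ λ i → ⟦ r i == y ⟧ * ⟦ D i ∧ (φ i == x) ⟧) ≡⟨ ∑-comm _ ⟩
        ∑ (λ i → ∑ λ y → ⟦ r i == y ⟧ * ⟦ D i ∧ (φ i == x) ⟧) ≡⟨ ∑-cong (λ i → ∑-indicator (r i) (λ _ → ⟦ D i ∧ (φ i == x) ⟧)) ⟩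
        size (λ i → D i ∧ (φ i == x))                    ≡⟨ saturated x s ⟩
        g x                                              ∎
        where
        open ≡-Reasoning
        one-sided : ∀ y → ⟦ M x y ⟧ ≡ ⟦ half x y ⟧
        one-sided y with half x y
        ... | true = refl
        ... | false rewrite s = refl
        pointwise : ∀ y i → ⟦ label L y == i ⟧ * ⟦ half x y ⟧ ≡ ⟦ r i == y ⟧ * ⟦ D i ∧ (φ i == x) ⟧
        pointwise y i = trans (sym (⟦∧⟧ (label L y == i) (half x y))) (trans (cong ⟦_⟧ (bool-ext forth back)) (⟦∧⟧ (r i == y) _))
          where
          forth : ((label L y == i) ∧ half x y) ≡ true → ((r i == y) ∧ (D i ∧ (φ i == x))) ≡ true
          forth e with ∧-true {label L y == i} e
          ... | p , q with ==⇒≡ p | ∧-true {E y} q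
          ... | refl | e₁ , e₂ with E-elim e₁
          ... | _ , d , eq = cong₂ _∧_ (subst (λ z → (z == y) ≡ true) (sym eq) (==-refl y)) (cong₂ _∧_ d e₂)
          back : ((r i == y) ∧ (D i ∧ (φ i == x))) ≡ true → ((label L y == i) ∧ half x y) ≡ true
          back e with ∧-true {r i == y} e
          ... | p , q with ==⇒≡ p | ∧-true {D i} q
          ... | refl | d , e₂ with proj₂ (cell-label L {i} (r∈cell i d))
          ... | eq = cong₂ _∧_ (subst (λ z → (z == i) ≡ true) (sym eq) (==-refl i))
                       (cong₂ _∧_ (E-intro d) (trans (cong (λ z → φ z == x) eq) e₂))

      M-size-rest : ∀ x → S x ≡ false → size (M x) ≡ ⟦ E x ⟧
      M-size-rest x s = trans (∑-cong pointwise) (∑-indicator (φ (label L x)) (λ _ → ⟦ E x ⟧))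
        where
        pointwise : ∀ y → ⟦ M x y ⟧ ≡ ⟦ φ (label L x) == y ⟧ * ⟦ E x ⟧
        pointwise y with bool? (half x y)
        ... | inj₁ h = ⊥-elim (true≢false (trans (sym (proj₁ (half-elim h))) s))
        ... | inj₂ h rewrite h = trans (⟦∧⟧ (E x) _) (*-comm ⟦ E x ⟧ _)

      g₁ : Fin n → ℕ
      g₁ x = if S x then 0 else g x ∸ ⟦ E x ⟧

      E≤g : ∀ x → ⟦ E x ⟧ ≤ g x
      E≤g x with bool? (E x)
      ... | inj₂ e rewrite e = z≤n
      ... | inj₁ e with E-elim e
      ... | s , d , eq with refine-odd (record { labels = 1 ; removed = x ==_ ; label = λ _ → zero }) (λ _ _ _ _ _ → refl) (label L x) d x (cong₂ _∧_ (cong not s) (==-refl (label L x)))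
      ...   | inj₁ (z , _) = ⊥-elim (true≢false (trans (sym (==-refl x)) z))
      ...   | inj₂ le = ≤-trans (⟦⟧≤1 (E x)) (≤-trans (m≤m+n 1 _) (≤-trans le (≤-trans
                (∑-mono λ y → *-monoˡ-≤ (g y) (⟦⟧-mono λ e → proj₂ (∧-true {cell L (label L x) y} e)))
                (≤-reflexive (weight-singleton g x)))))

      g₁-restore : ∀ x → S x ≡ false → g₁ x + ⟦ E x ⟧ ≡ g x
      g₁-restore x s rewrite s = m∸n+n≡m (≤-trans (≤-reflexive (cong ⟦_⟧ (same s))) (E≤g x))
        where
        same : S x ≡ false → (D (label L x) ∧ (r (label L x) == x)) ≡ E x
        same s rewrite s = refl

      split : ∀ x → g₁ x + size (M x) ≡ g x
      split x with bool? (S x)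
      ... | inj₁ s = cong₂ _+_ zero′ (M-size-S x s)
        where
        zero′ : g₁ x ≡ 0
        zero′ rewrite s = refl
      ... | inj₂ s = trans (cong (g₁ x +_) (M-size-rest x s)) (g₁-restore x s)

      weight-outside : ∀ Q → weight g₁ (λ x → not (S x) ∧ Q x) ≡ weight g₁ Q
      weight-outside Q = ∑-cong pointwise
        where
        pointwise : ∀ x → ⟦ not (S x) ∧ Q x ⟧ * g₁ x ≡ ⟦ Q x ⟧ * g₁ x
        pointwise x with S x
        ... | true = sym (*-zeroʳ ⟦ Q x ⟧)
        ... | false = refl

      weight-even : ∀ i → D i ≡ false → ∀ (Q : Fin n → Bool) → weight g₁ (λ x → cell L i x ∧ Q x) ≡ weight g (λ x → cell L i x ∧ Q x)
      weight-even i d Q = trans (sym (+-identityʳ _)) (trans (cong (weight g₁ cQ +_) (sym none))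
        (weight-shift cQ λ x e → g₁-restore x (proj₁ (cell-label L {i} (proj₁ (∧-true {cell L i x} e))))))
        where
        cQ = λ x → cell L i x ∧ Q x
        none : weight (λ x → ⟦ E x ⟧) cQ ≡ 0
        none = ∑-zero pointwise
          where
          pointwise : ∀ x → ⟦ cQ x ⟧ * ⟦ E x ⟧ ≡ 0
          pointwise x with bool? (cell L i x) | bool? (E x)
          ... | inj₂ c | _ rewrite c = refl
          ... | inj₁ _ | inj₂ e rewrite e = *-zeroʳ ⟦ cQ x ⟧
          ... | inj₁ c | inj₁ e = ⊥-elim (true≢false (trans (sym (proj₁ (proj₂ (E-elim e)))) (trans (cong D (proj₂ (cell-label L {i} c))) d)))

      weight-odd : ∀ i → D i ≡ true → ∀ (Q : Fin n → Bool) → weight g₁ (λ x → cell L i x ∧ Q x) + ⟦ Q (r i) ⟧ ≡ weight g (λ x → cell L i x ∧ Q x)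
      weight-odd i d Q = trans (cong (weight g₁ cQ +_) (sym one))
        (weight-shift cQ λ x e → g₁-restore x (proj₁ (cell-label L {i} (proj₁ (∧-true {cell L i x} e)))))
        where
        cQ = λ x → cell L i x ∧ Q x
        one : weight (λ x → ⟦ E x ⟧) cQ ≡ ⟦ Q (r i) ⟧
        one = trans (∑-cong pointwise) (∑-indicator (r i) (λ x → ⟦ Q x ⟧))
          where
          pointwise : ∀ x → ⟦ cQ x ⟧ * ⟦ E x ⟧ ≡ ⟦ r i == x ⟧ * ⟦ Q x ⟧
          pointwise x = trans (sym (⟦∧⟧ (cQ x) (E x))) (trans (cong ⟦_⟧ (bool-ext forth back)) (⟦∧⟧ (r i == x) _))
            where
            forth : (cQ x ∧ E x) ≡ true → ((r i == x) ∧ Q x) ≡ true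
            forth e with ∧-true {cQ x} e
            ... | p , q with ∧-true {cell L i x} p
            ... | c , q′ = cong₂ _∧_ (subst (λ z → (z == x) ≡ true) (trans (sym (proj₂ (proj₂ (E-elim q)))) (cong r (proj₂ (cell-label L {i} c)))) (==-refl x)) q′
            back : ((r i == x) ∧ Q x) ≡ true → (cQ x ∧ E x) ≡ true
            back e with ∧-true {r i == x} e
            ... | p , q with ==⇒≡ p
            ... | refl = cong₂ _∧_ (cong₂ _∧_ (r∈cell i d) q) (E-intro d)

      -- On an even cell `g` is unchanged. On an odd cell it drops only at `r i`: in the tight
      -- alternative the piece of `r i` was odd and becomes even, which cancels the excess 1; in the
      -- other alternative the slack 1 absorbs the change, wherever `r i` lies.
      pieces-bound : ∀ L₂ → Valid A₁ L₂ → ∀ i →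
        Refinement.pieces L L₂ i g₁ ≤ weight g₁ (λ x → cell L i x ∧ removed L₂ x)
      pieces-bound L₂ val₂ i with bool? (D i)
      ... | inj₂ d = begin
          pieces g₁  ≡⟨ ∑-cong (λ j → cong (_% 2) (weight-even i d (cell L₂ j))) ⟩
          pieces g   ≤⟨ refine-≤ L₂ val₂ i ⟩
          weight g (cell L i) % 2 + weight g (λ x → cell L i x ∧ removed L₂ x) ≡⟨ cong₂ _+_ (D-even i d) (sym (weight-even i d (removed L₂))) ⟩
          weight g₁ (λ x → cell L i x ∧ removed L₂ x) ∎
        where
        open ≤-Reasoning
        open Refinement L L₂ i
      ... | inj₁ d with refine-odd L₂ val₂ i d (r i) (r∈cell i d)
      ...   | inj₁ (kept , odd , count) = +-cancelʳ-≤ 1 _ _ (begin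
          pieces g₁ + 1                             ≡⟨ cong (λ z → pieces g₁ + ⟦ not z ⟧) kept ⟨
          pieces g₁ + ⟦ not (removed L₂ (r i)) ⟧    ≡⟨ cong (pieces g₁ +_) (size-cells-at L₂ (r i)) ⟨
          pieces g₁ + ∑ (λ j → ⟦ cell L₂ j (r i) ⟧) ≡⟨ ∑-distrib-+ _ _ ⟨
          ∑ (λ j → weight g₁ (piece j) % 2 + ⟦ cell L₂ j (r i) ⟧) ≤⟨ ∑-mono pointwise ⟩
          pieces g                                  ≡⟨ count ⟩
          1 + weight g (λ x → cell L i x ∧ removed L₂ x) ≡⟨ cong suc (weight-odd i d (removed L₂)) ⟨
          1 + (weight g₁ B + ⟦ removed L₂ (r i) ⟧)  ≡⟨ cong (λ z → 1 + (weight g₁ B + ⟦ z ⟧)) kept ⟩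
          1 + (weight g₁ B + 0)                     ≡⟨ shift (weight g₁ B) ⟩
          weight g₁ B + 1                           ∎)
        where
        open ≤-Reasoning
        open Refinement L L₂ i
        B = λ x → cell L i x ∧ removed L₂ x
        piece = λ j x → cell L i x ∧ cell L₂ j x
        shift : ∀ a → 1 + (a + 0) ≡ a + 1
        shift = solve-∀
        pointwise : ∀ j → weight g₁ (piece j) % 2 + ⟦ cell L₂ j (r i) ⟧ ≤ weight g (piece j) % 2
        pointwise j with bool? (cell L₂ j (r i)) | weight-odd i d (cell L₂ j)
        ... | inj₂ e | w rewrite e = ≤-reflexive (trans (+-identityʳ _) (cong (_% 2) (trans (sym (+-identityʳ _)) w)))
        ... | inj₁ e | w rewrite e with cell-label L₂ {j} e
        ...   | _ , refl = ≤-reflexive (trans (cong (_+ 1) (%2-suc-odd (weight g₁ (piece j)) (trans (cong (_% 2) (trans (+-comm 1 _) w)) odd))) (sym odd))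
      pieces-bound L₂ val₂ i | inj₁ d | inj₂ le = +-cancelʳ-≤ 1 _ _ (begin
          pieces g₁ + 1                             ≤⟨ +-monoˡ-≤ 1 (∑-mono pointwise) ⟩
          ∑ (λ j → weight g (piece j) % 2 + ⟦ cell L₂ j (r i) ⟧) + 1 ≡⟨ cong (_+ 1) (∑-distrib-+ _ _) ⟩
          pieces g + ∑ (λ j → ⟦ cell L₂ j (r i) ⟧) + 1 ≡⟨ cong (λ z → pieces g + z + 1) (size-cells-at L₂ (r i)) ⟩
          pieces g + ⟦ not (removed L₂ (r i)) ⟧ + 1 ≡⟨ shift (pieces g) ⟦ not (removed L₂ (r i)) ⟧ ⟩
          (1 + pieces g) + ⟦ not (removed L₂ (r i)) ⟧ ≤⟨ +-monoˡ-≤ _ le ⟩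
          weight g B + ⟦ not (removed L₂ (r i)) ⟧   ≡⟨ cong (_+ ⟦ not (removed L₂ (r i)) ⟧) (weight-odd i d (removed L₂)) ⟨
          weight g₁ B + ⟦ removed L₂ (r i) ⟧ + ⟦ not (removed L₂ (r i)) ⟧ ≡⟨ +-assoc (weight g₁ B) _ _ ⟩
          weight g₁ B + (⟦ removed L₂ (r i) ⟧ + ⟦ not (removed L₂ (r i)) ⟧) ≡⟨ cong (weight g₁ B +_) (⟦⟧-not (removed L₂ (r i))) ⟩
          weight g₁ B + 1                           ∎)
        where
        open ≤-Reasoning
        open Refinement L L₂ i
        B = λ x → cell L i x ∧ removed L₂ x
        piece = λ j x → cell L i x ∧ cell L₂ j x
        shift : ∀ a b → a + b + 1 ≡ (1 + a) + b
        shift = solve-∀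
        pointwise : ∀ j → weight g₁ (piece j) % 2 ≤ weight g (piece j) % 2 + ⟦ cell L₂ j (r i) ⟧
        pointwise j with bool? (cell L₂ j (r i)) | weight-odd i d (cell L₂ j)
        ... | inj₂ e | w rewrite e = ≤-reflexive (trans (cong (_% 2) (trans (sym (+-identityʳ _)) w)) (sym (+-identityʳ _)))
        ... | inj₁ e | w rewrite e = ≤-trans (%2≤1 (weight g₁ (piece j))) (m≤n+m 1 _)

      -- Parity is subadditive, so cutting the cells of `L₂` along those of `L` only raises the
      -- number of odd ones; the bound is then proved inside each cell of `L`. The set `S` itself
      -- contributes nothing, as `g₁` vanishes there.
      reduced-tutte : Tutte A₁ g₁
      reduced-tutte L₂ val₂ = begin
        oddCells g₁ L₂ ≡⟨ ∑-cong (λ j → cong (_% 2) (trans (sym (weight-outside (cell L₂ j))) (sym (∑-weight-cells g₁ L (cell L₂ j))))) ⟩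
        ∑ (λ j → ∑ (λ i → weight g₁ (λ x → cell L i x ∧ cell L₂ j x)) % 2) ≤⟨ ∑-mono (λ j → ∑-%2-≤ _) ⟩
        ∑ (λ j → ∑ (λ i → weight g₁ (λ x → cell L i x ∧ cell L₂ j x) % 2)) ≡⟨ ∑-comm _ ⟩
        ∑ (λ i → Refinement.pieces L L₂ i g₁) ≤⟨ ∑-mono (pieces-bound L₂ val₂) ⟩
        ∑ (λ i → weight g₁ (λ x → cell L i x ∧ removed L₂ x)) ≡⟨ ∑-weight-cells g₁ L (removed L₂) ⟩
        weight g₁ (λ x → not (S x) ∧ removed L₂ x) ≡⟨ weight-outside (removed L₂) ⟩
        weight g₁ (removed L₂) ∎
        where open ≤-Reasoning

      factor : FactorsBelow A → ¬ ¬ ParityFactor A g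
      factor below k = below A₁ g₁
        (λ x y → cong₂ _∧_ (A-sym x y) (∧-comm (not (S x)) _)) (λ x → cong (_∧ (not (S x) ∧ not (S x))) (A-irr x)) fewer reduced-tutte
        λ F → k (extend-factor M (λ x y → ∨-comm (half x y) _) (λ x y m → proj₁ (M-elim m)) (λ x y a → proj₁ (∧-true a))
          (λ x y a → ¬true λ m → true≢false (trans (sym a) (proj₂ (M-elim m)))) split F)
        where
        fewer : arcs A₁ < arcs A
        fewer = let (x , y , s , a) = touch in ∑∑-mono-< (λ x y e → proj₁ (∧-true e)) x y (cut a s) a
          where
          cut : ∀ {x y} → A x y ≡ true → S x ≡ true → A₁ x y ≡ false
          cut a s rewrite a | s = refl

    factor : FactorsBelow A → ¬ ¬ ParityFactor A g
    factor below k = hall (suc (∑ λ i → ∑ λ s → ⟦ R i s ⟧)) R D g (proj₁ touch) ≤-refl hall-condition assign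
      where
      assign : Σ (Fin (labels L) → Fin n) (λ φ → (∀ i → D i ≡ true → R i (φ i) ≡ true) ×
        (∀ s → size (λ i → D i ∧ (φ i == s)) ≤ g s)) → ⊥
      assign (φ , related , capacity) = Assigned.factor φ (λ i → proj₁ (pick i)) (λ i d → proj₁ (R-elim (related i d)))
          (λ i d → proj₁ (proj₂ (pick i) d)) (λ i d → proj₂ (proj₂ (pick i) d)) capacity below k
        where
        pick : ∀ i → Σ (Fin n) λ x → D i ≡ true → cell L i x ≡ true × A (φ i) x ≡ true
        pick i with bool? (D i)
        ... | inj₁ d = let (_ , x , c , a) = R-elim (related i d) in x , λ _ → c , a
        -- A filler for cells that are not odd; `touch` supplies some vertex.
        ... | inj₂ d = proj₁ touch , λ d′ → ⊥-elim (true≢false (trans (sym d′) d))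

  -- The strict bound `c` on `arcs A` is the recursion argument. Without edges every single vertex
  -- is closed, hence `g` is even everywhere and the empty factor serves.
  parityFactor : ∀ c {n} (A : Adj n) g → Symmetric A → Irreflexive A → arcs A < c → Tutte A g → ¬ ¬ ParityFactor A g
  parityFactor (suc c) A g A-sym A-irr (s≤s le) T k with any? (λ u → any? λ v → A u v Bool.≟ true)
  ... | no ¬edge = k ((λ _ _ → false) , (λ _ _ → refl) , (λ _ _ ()) , λ v →
          trans (cong (_% 2) (∑-zero λ _ → refl)) (sym (even v)) , ≤-trans (≤-reflexive (∑-zero λ _ → refl)) z≤n)
    where
    even : ∀ v → g v % 2 ≡ 0
    even v = trans (cong (_% 2) (sym (weight-singleton g v))) (closed-even {A = A} T (v ==_) λ x y a → ⊥-elim (¬edge (x , y , a)))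
  ... | yes (u , v , uv) = em λ where
      (inj₁ tight) → minimal _ (oddVertices g) tight λ (L , (val , t , touch) , least) →
        TightReduction.factor A g A-sym A-irr T L val t touch least below k
      (inj₂ ¬tight) → SingleEdge.factor A g A-sym A-irr T u v uv
        (λ L val touch → tutte-gap {A = A} T L val λ t → ¬tight (L , val , t , touch)) below k
    where
    below : FactorsBelow A
    below A₁ g₁ s₁ i₁ lt = parityFactor c A₁ g₁ s₁ i₁ (<-≤-trans lt le)

  -- Searching for a parity factor

  lookup² : ∀ {n} → Subset (n * n) → Adj n
  lookup² {n} p x y = Vec.lookup p (combine x y)

  tabulate² : ∀ {n} → Adj n → Subset (n * n)
  tabulate² {n} F = Vec.tabulate λ q → F (proj₁ (remQuot {n} n q)) (proj₂ (remQuot {n} n q))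

  lookup²∘tabulate² : ∀ {n} (F : Adj n) x y → lookup² (tabulate² F) x y ≡ F x y
  lookup²∘tabulate² {n} F x y = trans (lookup∘tabulate _ (combine x y))
    (cong₂ F (cong proj₁ (remQuot-combine {n} x y)) (cong proj₂ (remQuot-combine {n} x y)))

  -- An adjacency relation becomes a subset of `Fin (n * n)`, and subsets can be searched
  -- exhaustively for a decidable property.
  parityFactor-stable : ∀ {n} {A : Adj n} {g} → ¬ ¬ ParityFactor A g → ParityFactor A g
  parityFactor-stable {n} {A} {g} ¬¬F = let (p , props) = decidable-stable (anySubset? dec) (λ ¬p → ¬¬F λ (F , props) → ¬p (encode F props)) in lookup² p , props
    where
    Props : Adj n → Set
    Props F = Symmetric F × (∀ x y → F x y ≡ true → A x y ≡ true) ×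
      (∀ v → size (F v) % 2 ≡ g v % 2 × size (F v) ≤ g v)
    dec : ∀ p → Dec (Props (lookup² p))
    dec p = (all? λ x → all? λ y → lookup² p x y Bool.≟ lookup² p y x) ×-dec
      ((all? λ x → all? λ y → (lookup² p x y Bool.≟ true) →-dec (A x y Bool.≟ true)) ×-dec
       (all? λ v → (size (lookup² p v) % 2 ℕ.≟ g v % 2) ×-dec (size (lookup² p v) ≤? g v)))
    encode : ∀ F → Props F → ∃ λ p → Props (lookup² p)
    encode F (F-sym , F⊆A , F-deg) = tabulate² F ,
      (λ x y → trans (same x y) (trans (F-sym x y) (sym (same y x)))) ,
      (λ x y e → F⊆A x y (trans (sym (same x y)) e)) ,
      (λ v → subst (λ z → z % 2 ≡ g v % 2 × z ≤ g v) (∑-cong λ y → cong ⟦_⟧ (sym (same v y))) (F-deg v))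
      where
      same : ∀ x y → lookup² (tabulate² F) x y ≡ F x y
      same = lookup²∘tabulate² F

  -- Degrees, edges and cardinalities as finite sums

  ∑-list : ∀ {n} (f : Fin n → ℕ) → sum (map f (allFin n)) ≡ ∑ f
  ∑-list {n} f = trans (cong sum (map-tabulate (λ i → i) f)) (go f)
    where
    go : ∀ {n} (f : Fin n → ℕ) → sum (tabulate f) ≡ ∑ f
    go {zero} f = sym (∑-empty f)
    go {suc n} f = trans (cong (f zero +_) (go (f ∘ suc))) (sym (∑-suc f))

  if≡⟦⟧ : ∀ a → (if a then 1 else 0) ≡ ⟦ a ⟧
  if≡⟦⟧ true = refl
  if≡⟦⟧ false = refl

  deg≡size : ∀ {n} (A : Adj n) v → deg A v ≡ size (A v)
  deg≡size A v = trans (∑-list _) (∑-cong λ y → if≡⟦⟧ (A v y))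

  ∣∣≡size : ∀ {n} (X : Subset n) → ∣ X ∣ ≡ size (Vec.lookup X)
  ∣∣≡size Vec.[] = sym (∑-empty _)
  ∣∣≡size (true Vec.∷ X) = trans (cong suc (∣∣≡size X)) (sym (∑-suc _))
  ∣∣≡size (false Vec.∷ X) = trans (∣∣≡size X) (sym (∑-suc _))

  double-edges : ∀ {n} {A : Adj n} → Symmetric A → Irreflexive A → edges A + edges A ≡ arcs A
  double-edges {n} {A} A-sym A-irr = trans (cong₂ _+_ unfolded (trans unfolded (∑-comm _)))
    (trans (sym (∑-distrib-+ _ _)) (∑-cong λ x → trans (sym (∑-distrib-+ _ _)) (∑-cong λ y → pointwise x y)))
    where
    unfolded : edges A ≡ ∑ λ x → ∑ λ y → ⟦ (toℕ x <ᵇ toℕ y) ∧ A x y ⟧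
    unfolded = trans (∑-list _) (∑-cong λ x → trans (∑-list _) (∑-cong λ y → if≡⟦⟧ ((toℕ x <ᵇ toℕ y) ∧ A x y)))
    trichotomy : ∀ a c → (a ≡ c) ⊎ (⟦ a <ᵇ c ⟧ + ⟦ c <ᵇ a ⟧ ≡ 1)
    trichotomy zero zero = inj₁ refl
    trichotomy zero (suc c) = inj₂ refl
    trichotomy (suc a) zero = inj₂ refl
    trichotomy (suc a) (suc c) with trichotomy a c
    ... | inj₁ e = inj₁ (cong suc e)
    ... | inj₂ e = inj₂ e
    pointwise : ∀ x y → ⟦ (toℕ x <ᵇ toℕ y) ∧ A x y ⟧ + ⟦ (toℕ y <ᵇ toℕ x) ∧ A y x ⟧ ≡ ⟦ A x y ⟧
    pointwise x y rewrite A-sym y x with A x y in eq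
    ... | false = trans (cong₂ _+_ (⟦∧⟧ (toℕ x <ᵇ toℕ y) false) (⟦∧⟧ (toℕ y <ᵇ toℕ x) false)) (cong₂ _+_ (*-zeroʳ ⟦ toℕ x <ᵇ toℕ y ⟧) (*-zeroʳ ⟦ toℕ y <ᵇ toℕ x ⟧))
    ... | true with trichotomy (toℕ x) (toℕ y)
    ...   | inj₁ e = ⊥-elim (true≢false (trans (sym eq) (trans (cong (A x) (sym (toℕ-injective e))) (A-irr x))))
    ...   | inj₂ e = trans (cong₂ _+_ (trans (⟦∧⟧ (toℕ x <ᵇ toℕ y) true) (*-identityʳ ⟦ toℕ x <ᵇ toℕ y ⟧)) (trans (⟦∧⟧ (toℕ y <ᵇ toℕ x) true) (*-identityʳ ⟦ toℕ y <ᵇ toℕ x ⟧))) e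

  size-pos : ∀ {n} (P : Fin n → Bool) → 0 < size P → ∃ λ x → P x ≡ true
  size-pos P lt with any? (λ x → P x Bool.≟ true)
  ... | yes p = p
  ... | no ¬p = ⊥-elim (n≮0 (subst (0 <_) (∑-zero λ x → cong ⟦_⟧ (¬true λ e → ¬p (x , e))) lt))

  size-pair : ∀ {n} (P : Fin n → Bool) {x y} → x ≢ y → P x ≡ true → P y ≡ true → 2 ≤ size P
  size-pair P {x} {y} x≢y px py = ≤-trans (≤-reflexive (sym (trans (∑-distrib-+ _ _) (cong₂ _+_ (∑-indicator₁ x) (∑-indicator₁ y))))) (∑-mono pointwise)
    where
    pointwise : ∀ z → ⟦ x == z ⟧ + ⟦ y == z ⟧ ≤ ⟦ P z ⟧
    pointwise z with x ≟ z | y ≟ z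
    ... | yes refl | yes e = ⊥-elim (x≢y (sym e))
    ... | yes refl | no _ rewrite px = ≤-refl
    ... | no _ | yes refl rewrite py = ≤-refl
    ... | no _ | no _ = z≤n

  size-all : ∀ n → size {n} (λ _ → true) ≡ n
  size-all n = trans (∑-const n 1) (*-identityʳ n)

  -- Joins, unions and the extremal graph

  join-ll : ∀ {a c} (A : Adj a) (C : Adj c) x y → join A C (x ↑ˡ c) (y ↑ˡ c) ≡ A x y
  join-ll {a} {c} A C x y rewrite splitAt-↑ˡ a x c | splitAt-↑ˡ a y c = refl

  join-lr : ∀ {a c} (A : Adj a) (C : Adj c) x y → join A C (x ↑ˡ c) (a ↑ʳ y) ≡ true
  join-lr {a} {c} A C x y rewrite splitAt-↑ˡ a x c | splitAt-↑ʳ a c y = refl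

  join-rl : ∀ {a c} (A : Adj a) (C : Adj c) x y → join A C (a ↑ʳ x) (y ↑ˡ c) ≡ true
  join-rl {a} {c} A C x y rewrite splitAt-↑ʳ a c x | splitAt-↑ˡ a y c = refl

  join-rr : ∀ {a c} (A : Adj a) (C : Adj c) x y → join A C (a ↑ʳ x) (a ↑ʳ y) ≡ C x y
  join-rr {a} {c} A C x y rewrite splitAt-↑ʳ a c x | splitAt-↑ʳ a c y = refl

  union-ll : ∀ {a c} (A : Adj a) (C : Adj c) x y → union A C (x ↑ˡ c) (y ↑ˡ c) ≡ A x y
  union-ll {a} {c} A C x y rewrite splitAt-↑ˡ a x c | splitAt-↑ˡ a y c = refl

  union-lr : ∀ {a c} (A : Adj a) (C : Adj c) x y → union A C (x ↑ˡ c) (a ↑ʳ y) ≡ false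
  union-lr {a} {c} A C x y rewrite splitAt-↑ˡ a x c | splitAt-↑ʳ a c y = refl

  union-rl : ∀ {a c} (A : Adj a) (C : Adj c) x y → union A C (a ↑ʳ x) (y ↑ˡ c) ≡ false
  union-rl {a} {c} A C x y rewrite splitAt-↑ʳ a c x | splitAt-↑ˡ a y c = refl

  union-rr : ∀ {a c} (A : Adj a) (C : Adj c) x y → union A C (a ↑ʳ x) (a ↑ʳ y) ≡ C x y
  union-rr {a} {c} A C x y rewrite splitAt-↑ʳ a c x | splitAt-↑ʳ a c y = refl

  join-sym : ∀ {a c} {A : Adj a} {C : Adj c} → Symmetric A → Symmetric C → Symmetric (join A C)
  join-sym {a} A-sym C-sym x y with splitAt a x | splitAt a y
  ... | inj₁ i | inj₁ j = A-sym i j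
  ... | inj₁ i | inj₂ j = refl
  ... | inj₂ i | inj₁ j = refl
  ... | inj₂ i | inj₂ j = C-sym i j

  union-sym : ∀ {a c} {A : Adj a} {C : Adj c} → Symmetric A → Symmetric C → Symmetric (union A C)
  union-sym {a} A-sym C-sym x y with splitAt a x | splitAt a y
  ... | inj₁ i | inj₁ j = A-sym i j
  ... | inj₁ i | inj₂ j = refl
  ... | inj₂ i | inj₁ j = refl
  ... | inj₂ i | inj₂ j = C-sym i j

  join-irr : ∀ {a c} {A : Adj a} {C : Adj c} → Irreflexive A → Irreflexive C → Irreflexive (join A C)
  join-irr {a} A-irr C-irr x with splitAt a x
  ... | inj₁ i = A-irr i
  ... | inj₂ i = C-irr i

  union-irr : ∀ {a c} {A : Adj a} {C : Adj c} → Irreflexive A → Irreflexive C → Irreflexive (union A C)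
  union-irr {a} A-irr C-irr x with splitAt a x
  ... | inj₁ i = A-irr i
  ... | inj₂ i = C-irr i

  complete-sym : ∀ m → Symmetric (complete m)
  complete-sym m x y = cong not (==-sym x y)

  complete-irr : ∀ m → Irreflexive (complete m)
  complete-irr m x = cong not (==-refl x)

  ∑∑-split : ∀ a {c} (h : Fin (a + c) → Fin (a + c) → ℕ) → ∑ (λ x → ∑ (h x)) ≡
    (∑ (λ x → ∑ λ y → h (x ↑ˡ c) (y ↑ˡ c)) + ∑ (λ x → ∑ λ y → h (x ↑ˡ c) (a ↑ʳ y))) +
    (∑ (λ x → ∑ λ y → h (a ↑ʳ x) (y ↑ˡ c)) + ∑ (λ x → ∑ λ y → h (a ↑ʳ x) (a ↑ʳ y)))
  ∑∑-split a h = trans (∑-split a _) (cong₂ _+_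
    (trans (∑-cong λ x → ∑-split a _) (∑-distrib-+ _ _)) (trans (∑-cong λ x → ∑-split a _) (∑-distrib-+ _ _)))

  ∑∑-cong : ∀ {m n} {f h : Fin m → Fin n → ℕ} → (∀ x y → f x y ≡ h x y) → ∑ (λ x → ∑ (f x)) ≡ ∑ (λ x → ∑ (h x))
  ∑∑-cong e = ∑-cong λ x → ∑-cong (e x)

  ∑∑-const : ∀ m n c → ∑ {m} (λ _ → ∑ {n} (λ _ → c)) ≡ m * (n * c)
  ∑∑-const m n c = trans (∑-cong {m} λ _ → ∑-const n c) (∑-const m (n * c))

  arcs-join : ∀ {a c} (A : Adj a) (C : Adj c) → arcs (join A C) ≡ (arcs A + a * (c * 1)) + (c * (a * 1) + arcs C)
  arcs-join {a} {c} A C = trans (∑∑-split a _) (cong₂ _+_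
    (cong₂ _+_ (∑∑-cong λ x y → cong ⟦_⟧ (join-ll A C x y)) (trans (∑∑-cong λ x y → cong ⟦_⟧ (join-lr A C x y)) (∑∑-const a c 1)))
    (cong₂ _+_ (trans (∑∑-cong λ x y → cong ⟦_⟧ (join-rl A C x y)) (∑∑-const c a 1)) (∑∑-cong λ x y → cong ⟦_⟧ (join-rr A C x y))))

  arcs-union : ∀ {a c} (A : Adj a) (C : Adj c) → arcs (union A C) ≡ arcs A + arcs C
  arcs-union {a} {c} A C = trans (∑∑-split a _) (cong₂ _+_
    (trans (cong₂ _+_ (∑∑-cong λ x y → cong ⟦_⟧ (union-ll A C x y)) (trans (∑∑-cong λ x y → cong ⟦_⟧ (union-lr A C x y)) (trans (∑∑-const a c 0) (trans (cong (a *_) (*-zeroʳ c)) (*-zeroʳ a))))) (+-identityʳ _))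
    (cong₂ _+_ (trans (∑∑-cong λ x y → cong ⟦_⟧ (union-rl A C x y)) (trans (∑∑-const c a 0) (trans (cong (c *_) (*-zeroʳ a)) (*-zeroʳ c)))) (∑∑-cong λ x y → cong ⟦_⟧ (union-rr A C x y))))

  arcs-complete : ∀ m → arcs (complete m) + m ≡ m * m
  arcs-complete m = trans (cong (arcs (complete m) +_) (sym (size-all m))) (trans (sym (∑-distrib-+ _ _))
    (trans (∑-cong λ x → trans (cong (size (complete m x) +_) (sym (∑-indicator₁ x))) (trans (sym (∑-distrib-+ _ _))
      (trans (∑-cong λ y → trans (+-comm ⟦ complete m x y ⟧ _) (⟦⟧-not (x == y))) (size-all m)))) (∑-const m m)))

  arcs-empty : ∀ t → arcs (empty t) ≡ 0
  arcs-empty t = trans (∑∑-const t t 0) (trans (cong (t *_) (*-zeroʳ t)) (*-zeroʳ t))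

  -- The extremal graph with free part sizes, which keeps the truncated subtractions of `cliqueSize`
  -- and `indepSize` out of the calculations.
  spoke : (d c t : ℕ) → Adj (d + (c + t))
  spoke d c t = join (complete d) (union (complete c) (empty t))

  spoke-sym : ∀ d c t → Symmetric (spoke d c t)
  spoke-sym d c t = join-sym (complete-sym d) (union-sym (complete-sym c) λ _ _ → refl)

  spoke-irr : ∀ d c t → Irreflexive (spoke d c t)
  spoke-irr d c t = join-irr (complete-irr d) (union-irr (complete-irr c) λ _ → refl)

  -- Adding the order fills the diagonal. The right-hand side has the shape of `arcs-upper` for `d`
  -- removed vertices, one cell of size `c` and `t` singletons.
  arcs-spoke : ∀ d c t → arcs (spoke d c t) + (d + (c + t)) ≡ d * (d + (c + t)) + (c + t) * d + c * c + t
  arcs-spoke d c t = begin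
    arcs (spoke d c t) + (d + (c + t))
      ≡⟨ cong (_+ (d + (c + t))) (trans (arcs-join (complete d) _) (cong (λ z → (arcs (complete d) + d * ((c + t) * 1)) + ((c + t) * (d * 1) + z))
          (trans (arcs-union (complete c) (empty t)) (cong (arcs (complete c) +_) (arcs-empty t))))) ⟩
    (arcs (complete d) + d * ((c + t) * 1)) + ((c + t) * (d * 1) + (arcs (complete c) + 0)) + (d + (c + t))
      ≡⟨ regroup (arcs (complete d)) (arcs (complete c)) d c t ⟩
    (arcs (complete d) + d) + d * (c + t) + (c + t) * d + (arcs (complete c) + c) + t
      ≡⟨ cong₂ (λ a e → a + d * (c + t) + (c + t) * d + e + t) (arcs-complete d) (arcs-complete c) ⟩
    d * d + d * (c + t) + (c + t) * d + c * c + t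
      ≡⟨ cong (λ z → z + (c + t) * d + c * c + t) (*-distribˡ-+ d d (c + t)) ⟨
    d * (d + (c + t)) + (c + t) * d + c * c + t ∎
    where
    open ≡-Reasoning
    regroup : ∀ a e d c t → (a + d * ((c + t) * 1)) + ((c + t) * (d * 1) + (e + 0)) + (d + (c + t)) ≡
      (a + d) + d * (c + t) + (c + t) * d + (e + c) + t
    regroup = solve-∀

  -- Graphs determined by a vertex colouring

  colour-count : ∀ {n} → (Fin n → Fin 3) → Fin 3 → ℕ
  colour-count τ c = size λ x → τ x == c

  colour-count-remove : ∀ {n} (σ : Fin (suc n) → Fin 3) y c → colour-count σ c ≡ ⟦ σ y == c ⟧ + colour-count (σ ∘ punchIn y) c
  colour-count-remove σ zero c = ∑-suc _
  colour-count-remove {suc n} σ (suc y) c = trans (∑-suc _) (trans (cong (⟦ σ zero == c ⟧ +_) (colour-count-remove (σ ∘ suc) y c))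
    (trans (swap ⟦ σ zero == c ⟧ ⟦ σ (suc y) == c ⟧ _) (cong (⟦ σ (suc y) == c ⟧ +_) (sym (∑-suc _)))))
    where
    swap : ∀ a b c → a + (b + c) ≡ b + (a + c)
    swap = solve-∀

  -- Match the first vertex with any vertex `y` of its colour, take both away, and continue with the
  -- counts that remain equal.
  colour-permutation : ∀ {n m} (τ : Fin n → Fin 3) (σ : Fin m → Fin 3) → (∀ c → colour-count τ c ≡ colour-count σ c) →
    Σ (Permutation n m) λ π → ∀ x → σ (π ⟨$⟩ʳ x) ≡ τ x
  colour-permutation {zero} {zero} τ σ e = Permutation.id , λ ()
  colour-permutation {zero} {suc m} τ σ e = ⊥-elim (0≢1+n (trans (sym (∑-empty _)) (trans (e (σ zero))
    (trans (∑-suc _) (cong (λ z → ⟦ z ⟧ + colour-count (σ ∘ suc) (σ zero)) (==-refl (σ zero)))))))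
  colour-permutation {suc n} {m} τ σ e with size-pos (λ y → σ y == τ zero) (≤-trans (s≤s z≤n) (≤-reflexive (trans
      (sym (trans (∑-suc _) (cong (λ z → ⟦ z ⟧ + colour-count (τ ∘ suc) (τ zero)) (==-refl (τ zero))))) (e (τ zero)))))
  colour-permutation {suc n} {suc m} τ σ e | y , p = insert zero y π , matches
    where
    σy : σ y ≡ τ zero
    σy = ==⇒≡ p
    rest : ∀ c → colour-count (τ ∘ suc) c ≡ colour-count (σ ∘ punchIn y) c
    rest c = +-cancelˡ-≡ ⟦ τ zero == c ⟧ _ _ (trans (sym (∑-suc _)) (trans (e c)
      (trans (colour-count-remove σ y c) (cong (λ z → ⟦ z == c ⟧ + colour-count (σ ∘ punchIn y) c) σy))))
    ih = colour-permutation (τ ∘ suc) (σ ∘ punchIn y) rest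
    π = proj₁ ih
    matches : ∀ x → σ (insert zero y π ⟨$⟩ʳ x) ≡ τ x
    matches zero = σy
    matches (suc x) = trans (cong σ (insert-punchIn zero y π x)) (proj₂ ih x)

  pattern core = zero
  pattern clique = suc zero
  pattern pendant = suc (suc zero)

  linked : Fin 3 → Fin 3 → Bool
  linked core _ = true
  linked clique core = true
  linked clique clique = true
  linked clique pendant = false
  linked pendant core = true
  linked pendant (suc _) = false

  linked-core : ∀ i → linked i core ≡ true
  linked-core core = refl
  linked-core clique = refl
  linked-core pendant = refl

  spoke-colour : ∀ d c t → Fin (d + (c + t)) → Fin 3
  spoke-colour d c t x with splitAt d x
  ... | inj₁ _ = core
  ... | inj₂ y with splitAt c y
  ...   | inj₁ _ = clique
  ...   | inj₂ _ = pendant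

  data Summand (a c : ℕ) : Fin (a + c) → Set where
    left  : ∀ x → Summand a c (x ↑ˡ c)
    right : ∀ y → Summand a c (a ↑ʳ y)

  summand : ∀ a c x → Summand a c x
  summand a c x with splitAt a x | join-splitAt a c x
  ... | inj₁ i | refl = left i
  ... | inj₂ j | refl = right j

  spoke-colour-core : ∀ d c t x → spoke-colour d c t (x ↑ˡ (c + t)) ≡ core
  spoke-colour-core d c t x rewrite splitAt-↑ˡ d x (c + t) = refl

  spoke-colour-clique : ∀ d c t x → spoke-colour d c t (d ↑ʳ (x ↑ˡ t)) ≡ clique
  spoke-colour-clique d c t x rewrite splitAt-↑ʳ d (c + t) (x ↑ˡ t) | splitAt-↑ˡ c x t = refl

  spoke-colour-pendant : ∀ d c t x → spoke-colour d c t (d ↑ʳ (c ↑ʳ x)) ≡ pendant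
  spoke-colour-pendant d c t x rewrite splitAt-↑ʳ d (c + t) (c ↑ʳ x) | splitAt-↑ʳ c t x = refl

  spoke-adj : ∀ d c t x y → spoke d c t x y ≡ (not (x == y) ∧ linked (spoke-colour d c t x) (spoke-colour d c t y))
  spoke-adj d c t x y with summand d (c + t) x | summand d (c + t) y
  ... | left x | left y rewrite join-ll (complete d) (union (complete c) (empty t)) x y | spoke-colour-core d c t x | ↑ˡ-== (c + t) x y with x == y
  ...   | true = refl
  ...   | false = refl
  spoke-adj d c t _ _ | left x | right y rewrite join-lr (complete d) (union (complete c) (empty t)) x y | spoke-colour-core d c t x | ≢⇒== (↑ˡ≢↑ʳ x y) = refl
  spoke-adj d c t _ _ | right x | left y rewrite join-rl (complete d) (union (complete c) (empty t)) x y | spoke-colour-core d c t y | ≢⇒== (↑ˡ≢↑ʳ y x ∘ sym) = sym (linked-core (spoke-colour d c t (d ↑ʳ x)))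
  spoke-adj d c t _ _ | right x | right y rewrite join-rr (complete d) (union (complete c) (empty t)) x y | ↑ʳ-== d x y with summand c t x | summand c t y
  ... | left x | left y rewrite union-ll (complete c) (empty t) x y | spoke-colour-clique d c t x | spoke-colour-clique d c t y | ↑ˡ-== t x y with x == y
  ...   | true = refl
  ...   | false = refl
  spoke-adj d c t _ _ | right _ | right _ | left x | right y rewrite union-lr (complete c) (empty t) x y | spoke-colour-clique d c t x | spoke-colour-pendant d c t y with (x ↑ˡ t) == (c ↑ʳ y)
  ...   | true = refl
  ...   | false = refl
  spoke-adj d c t _ _ | right _ | right _ | right x | left y rewrite union-rl (complete c) (empty t) x y | spoke-colour-pendant d c t x | spoke-colour-clique d c t y with (c ↑ʳ x) == (y ↑ˡ t)
  ...   | true = refl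
  ...   | false = refl
  spoke-adj d c t _ _ | right _ | right _ | right x | right y rewrite union-rr (complete c) (empty t) x y | spoke-colour-pendant d c t x | spoke-colour-pendant d c t y with (c ↑ʳ x) == (c ↑ʳ y)
  ...   | true = refl
  ...   | false = refl

  spoke-colour-count : ∀ d c t i → colour-count (spoke-colour d c t) i ≡
    d * ⟦ core == i ⟧ + (c * ⟦ clique == i ⟧ + t * ⟦ pendant == i ⟧)
  spoke-colour-count d c t i = trans (∑-split d _) (cong₂ _+_
    (trans (∑-cong λ x → cong (λ z → ⟦ z == i ⟧) (spoke-colour-core d c t x)) (∑-const d _))
    (trans (∑-split c _) (cong₂ _+_
      (trans (∑-cong λ x → cong (λ z → ⟦ z == i ⟧) (spoke-colour-clique d c t x)) (∑-const c _))
      (trans (∑-cong λ x → cong (λ z → ⟦ z == i ⟧) (spoke-colour-pendant d c t x)) (∑-const t _)))))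

  -- Between distinct vertices adjacency depends on the colours alone, in `G` as in `spoke`, so
  -- every colour-preserving bijection is an isomorphism.
  coloured-iso : ∀ {n} (G : Graph n) d c t (τ : Fin n → Fin 3) →
    (∀ x y → adj G x y ≡ (not (x == y) ∧ linked (τ x) (τ y))) →
    (∀ i → colour-count τ i ≡ d * ⟦ core == i ⟧ + (c * ⟦ clique == i ⟧ + t * ⟦ pendant == i ⟧)) →
    Iso G (spoke d c t)
  coloured-iso G d c t τ adj-τ counts = ↔⇒⤖ π , λ x y → trans (adj-τ x y) (trans
      (cong₂ (λ a e → not a ∧ e) (same x y) (cong₂ linked (sym (matches x)) (sym (matches y))))
      (sym (spoke-adj d c t (π ⟨$⟩ʳ x) (π ⟨$⟩ʳ y))))
    where
    found = colour-permutation τ (spoke-colour d c t) (λ i → trans (counts i) (sym (spoke-colour-count d c t i)))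
    π = proj₁ found
    matches = proj₂ found
    same : ∀ x y → (x == y) ≡ ((π ⟨$⟩ʳ x) == (π ⟨$⟩ʳ y))
    same x y = bool-ext (λ e → subst (λ z → ((π ⟨$⟩ʳ x) == (π ⟨$⟩ʳ z)) ≡ true) (==⇒≡ e) (==-refl (π ⟨$⟩ʳ x)))
      (λ e → subst (λ z → (x == z) ≡ true) (Bijection.injective (↔⇒⤖ π) (==⇒≡ e)) (==-refl x))

  -- Sums of squares of the parts of a partition

  pos : ℕ → ℕ
  pos zero = 0
  pos (suc _) = 1

  pos≤ : ∀ a → pos a ≤ a
  pos≤ zero = z≤n
  pos≤ (suc a) = s≤s z≤n

  pos≤1 : ∀ a → pos a ≤ 1
  pos≤1 zero = z≤n
  pos≤1 (suc _) = ≤-refl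

  *-pos-≤ : ∀ m a → (0 < a → m ≤ a) → m * pos a ≤ a
  *-pos-≤ m zero _ = ≤-reflexive (*-zeroʳ m)
  *-pos-≤ m (suc a) h = ≤-trans (≤-reflexive (*-identityʳ m)) (h (s≤s z≤n))

  %2≤pos : ∀ a → a % 2 ≤ pos a
  %2≤pos zero = z≤n
  %2≤pos (suc a) = %2≤1 (suc a)

  -- Since (v - m)(r - v) is nonnegative.
  between : ∀ m r v → m ≤ v → v ≤ r → v * v + r * m * 1 ≤ (r + m) * v
  between m r v m≤v v≤r with m≤n⇒∃[o]m+o≡n m≤v | m≤n⇒∃[o]m+o≡n v≤r
  ... | x , refl | y , refl = ≤-trans (m≤m+n _ (x * y)) (≤-reflexive (identity m x y))
    where
    identity : ∀ m x y → (m + x) * (m + x) + (m + x + y) * m * 1 + x * y ≡ (m + x + y + m) * (m + x)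
    identity = solve-∀

  module Squares {l : ℕ} (N : Fin l → ℕ) (m t r : ℕ) (m≤N : ∀ i → 0 < N i → m ≤ N i)
    (total : ∑ N ≡ r + t * m) (many : 1 + t ≤ ∑ (λ i → pos (N i))) where

    -- At least `t` other parts are nonempty and use up at least `t * m` of the total.
    part≤ : ∀ i → N i ≤ r
    part≤ i = +-cancelʳ-≤ (m * (1 + t)) (N i) r (begin
      N i + m * (1 + t)                        ≤⟨ +-monoʳ-≤ (N i) (*-monoʳ-≤ m many) ⟩
      N i + m * ∑ (λ j → pos (N j))            ≡⟨ cong₂ _+_ (sym (∑-indicator i N)) (*-distribˡ-∑ m _) ⟩
      ∑ (λ j → ⟦ i == j ⟧ * N j) + ∑ (λ j → m * pos (N j)) ≡⟨ ∑-distrib-+ _ _ ⟨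
      ∑ (λ j → ⟦ i == j ⟧ * N j + m * pos (N j)) ≤⟨ ∑-mono pointwise ⟩
      ∑ (λ j → N j + ⟦ i == j ⟧ * m)           ≡⟨ ∑-distrib-+ _ _ ⟩
      ∑ N + ∑ (λ j → ⟦ i == j ⟧ * m)           ≡⟨ cong₂ _+_ total (∑-indicator i (λ _ → m)) ⟩
      r + t * m + m                            ≡⟨ regroup r t m ⟩
      r + m * (1 + t)                          ∎)
      where
      open ≤-Reasoning
      regroup : ∀ r t m → r + t * m + m ≡ r + m * (1 + t)
      regroup = solve-∀
      pointwise : ∀ j → ⟦ i == j ⟧ * N j + m * pos (N j) ≤ N j + ⟦ i == j ⟧ * m
      pointwise j with i == j
      ... | true = +-mono-≤ (≤-reflexive (+-identityʳ (N j))) (≤-trans (*-monoʳ-≤ m (pos≤1 (N j))) (≤-reflexive (*-comm m 1)))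
      ... | false = ≤-trans (*-pos-≤ m (N j) (m≤N j)) (m≤m+n (N j) 0)

    square≤ : ∀ i → N i * N i + r * m * pos (N i) ≤ (r + m) * N i
    square≤ i with N i | m≤N i | part≤ i
    ... | zero | _ | _ = ≤-reflexive (trans (*-zeroʳ (r * m)) (sym (*-zeroʳ (r + m))))
    ... | suc a | h | le = between m r (suc a) (h (s≤s z≤n)) le

    expand : ∀ r t m → (r + m) * (r + t * m) ≡ r * r + t * (m * m) + r * m * (1 + t)
    expand = solve-∀

    -- Sum of the chord inequalities `square≤`. The number of nonempty parts enters on the smaller
    -- side, so the lower bound `many` is the one required.
    squares≤ : ∑ (λ i → N i * N i) ≤ r * r + t * (m * m)
    squares≤ = +-cancelʳ-≤ (r * m * (1 + t)) _ _ (begin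
      ∑ (λ i → N i * N i) + r * m * (1 + t)   ≤⟨ +-monoʳ-≤ _ (*-monoʳ-≤ (r * m) many) ⟩
      ∑ (λ i → N i * N i) + r * m * ∑ (λ i → pos (N i)) ≡⟨ cong (∑ (λ i → N i * N i) +_) (*-distribˡ-∑ (r * m) _) ⟩
      ∑ (λ i → N i * N i) + ∑ (λ i → r * m * pos (N i)) ≡⟨ ∑-distrib-+ _ _ ⟨
      ∑ (λ i → N i * N i + r * m * pos (N i)) ≤⟨ ∑-mono square≤ ⟩
      ∑ (λ i → (r + m) * N i)                 ≡⟨ *-distribˡ-∑ (r + m) N ⟨
      (r + m) * ∑ N                           ≡⟨ cong ((r + m) *_) total ⟩
      (r + m) * (r + t * m)                   ≡⟨ expand r t m ⟩
      r * r + t * (m * m) + r * m * (1 + t)   ∎)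
      where open ≤-Reasoning

    -- Equality in the sum is equality in each chord inequality, that is, every nonempty part has
    -- size `m` or `r`.
    squares-equal : r * r + t * (m * m) ≤ ∑ (λ i → N i * N i) →
      ∀ i → N i * N i + r * m * pos (N i) ≡ (r + m) * N i
    squares-equal ge = ∑-≤⇒≗ square≤ (begin
      ∑ (λ i → (r + m) * N i)                 ≡⟨ *-distribˡ-∑ (r + m) N ⟨
      (r + m) * ∑ N                           ≡⟨ cong ((r + m) *_) total ⟩
      (r + m) * (r + t * m)                   ≡⟨ expand r t m ⟩
      r * r + t * (m * m) + r * m * (1 + t)   ≤⟨ +-mono-≤ ge (*-monoʳ-≤ (r * m) many) ⟩
      ∑ (λ i → N i * N i) + r * m * ∑ (λ i → pos (N i)) ≡⟨ cong (∑ (λ i → N i * N i) +_) (*-distribˡ-∑ (r * m) _) ⟩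
      ∑ (λ i → N i * N i) + ∑ (λ i → r * m * pos (N i)) ≡⟨ ∑-distrib-+ _ _ ⟨
      ∑ (λ i → N i * N i + r * m * pos (N i)) ∎)
      where open ≤-Reasoning

  -- By `squares-equal` the nonempty parts have size 1 or `suc r`. If no part had size `suc r`, all
  -- would be singletons and the squares would sum to `suc r + t`; then `r` is 0, and a singleton
  -- has size `suc r` after all.
  largest-part : ∀ {l} (N : Fin l → ℕ) t r → ∑ N ≡ suc r + t → 1 + t ≤ ∑ (λ i → pos (N i)) →
    suc r * suc r + t ≤ ∑ (λ i → N i * N i) →
    Σ (Fin l) λ i → N i ≡ suc r × (∀ j → i ≢ j → N j ≤ 1)
  largest-part {l} N t r total many ge with any? (λ i → N i ℕ.≟ suc r)
  ... | yes (i , e) = i , e , λ j i≢j → ≤-trans (≤-reflexive (sym (others j i≢j))) (pos≤1 (N j))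
    where
    open ≤-Reasoning
    -- Beside a part of size `suc r` a total of `t` remains for at least `t` nonempty parts, so this
    -- estimate is sharp for every `j`.
    below : ∀ j → pos (N j) + ⟦ i == j ⟧ * r ≤ N j
    below j with i ≟ j
    ... | yes refl rewrite e = ≤-reflexive (cong suc (+-identityʳ r))
    ... | no _ = ≤-trans (≤-reflexive (+-identityʳ _)) (pos≤ (N j))
    equal : ∀ j → pos (N j) + ⟦ i == j ⟧ * r ≡ N j
    equal = ∑-≤⇒≗ below (begin
      ∑ N                                      ≡⟨ total ⟩
      suc r + t                                ≡⟨ cong suc (+-comm r t) ⟩
      (1 + t) + r                              ≤⟨ +-monoˡ-≤ r many ⟩
      ∑ (λ j → pos (N j)) + r                  ≡⟨ cong (∑ (λ j → pos (N j)) +_) (∑-indicator i (λ _ → r)) ⟨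
      ∑ (λ j → pos (N j)) + ∑ (λ j → ⟦ i == j ⟧ * r) ≡⟨ ∑-distrib-+ _ _ ⟨
      ∑ (λ j → pos (N j) + ⟦ i == j ⟧ * r)     ∎)
    others : ∀ j → i ≢ j → pos (N j) ≡ N j
    others j i≢j = trans (sym (+-identityʳ _)) (trans (cong (λ z → pos (N j) + ⟦ z ⟧ * r) (sym (≢⇒== i≢j))) (equal j))
  ... | no none = ⊥-elim (none (proj₁ nonempty , unit))
    where
    open Squares N 1 t (suc r) (λ _ p → p) (trans total (cong (suc r +_) (sym (*-identityʳ t)))) many
    equal : ∀ i → N i * N i + suc r * 1 * pos (N i) ≡ (suc r + 1) * N i
    equal = squares-equal (≤-trans (≤-reflexive (cong (suc r * suc r +_) (*-identityʳ t))) ge)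
    square : ∀ i → N i * N i ≡ N i
    square i with N i | none ∘ (i ,_) | part≤ i | equal i
    ... | zero | _ | _ | _ = refl
    ... | suc a | ne | le | eq with m≤n⇒∃[o]m+o≡n (≤-pred le)
    ...   | y , refl with a | y
    ...     | zero | _ = refl
    ...     | suc a′ | zero = ⊥-elim (ne (cong (2 +_) (sym (+-identityʳ a′))))
    -- A size strictly between 1 and `suc r` would miss equality by the product of its two positive
    -- distances, which is `suc (a + y + a * y)` in `identity`.
    ...     | suc a′ | suc y′ = ⊥-elim (m+1+n≢m (u * u + w * 1 * 1) (trans (identity a′ y′) (sym eq)))
      where
      u = suc (suc a′)
      w = suc (suc a′ + suc y′)
      identity : ∀ a y → (2 + a) * (2 + a) + (2 + a + (1 + y)) * 1 * 1 + suc (a + y + a * y) ≡ ((2 + a + (1 + y)) + 1) * (2 + a)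
      identity = solve-∀
    r≡0 : r ≡ 0
    r≡0 = n≤0⇒n≡0 (≤-trans (m≤n*m r (suc r)) (+-cancelˡ-≤ (suc r + t) _ _ (begin
      suc r + t + suc r * r   ≡⟨ regroup r t ⟩
      suc r * suc r + t       ≤⟨ ge ⟩
      ∑ (λ i → N i * N i)     ≡⟨ ∑-cong square ⟩
      ∑ N                     ≡⟨ trans total (sym (+-identityʳ _)) ⟩
      suc r + t + 0           ∎)))
      where
      open ≤-Reasoning
      regroup : ∀ r t → suc r + t + suc r * r ≡ suc r * suc r + t
      regroup = solve-∀
    nonempty : ∃ λ i → 0 < N i
    nonempty with any? (λ i → 1 ≤? N i)
    ... | yes p = p
    ... | no ¬p = ⊥-elim (1+n≢0 (trans (sym total) (∑-zero λ i → n≤0⇒n≡0 (≮⇒≥ λ lt → ¬p (i , lt)))))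
    unit : N (proj₁ nonempty) ≡ suc r
    unit with N (proj₁ nonempty) | proj₂ nonempty | square (proj₁ nonempty)
    ... | suc a | _ | e = cong suc (trans a≡0 (sym r≡0))
      where
      a≡0 : a ≡ 0
      a≡0 = m+n≡0⇒m≡0 a (+-cancelˡ-≡ (suc a) _ _ (trans (regroup a) (trans e (sym (+-identityʳ _)))))
        where
        regroup : ∀ a → suc a + (a + a * a) ≡ suc a * suc a
        regroup = solve-∀

  -- Bounding the number of edges through a labelling

  upper : ∀ {n} → Labelling n → Adj n
  upper L x y = removed L x ∨ (removed L y ∨ (label L x == label L y))

  module Count {n : ℕ} (A : Adj n) (A-irr : Irreflexive A) (L : Labelling n) (val : Valid A L) where

    N : Fin (labels L) → ℕ
    N i = size (cell L i)

    s p : ℕ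
    s = size (removed L)
    p = size (not ∘ removed L)

    s+p≡n : s + p ≡ n
    s+p≡n = trans (sym (∑-distrib-+ _ _)) (trans (∑-cong λ x → ⟦⟧-not (removed L x)) (size-all n))

    ∑N≡p : ∑ N ≡ p
    ∑N≡p = trans (∑-comm _) (∑-cong (size-cells-at L))

    A≤upper : ∀ x y → ⟦ A x y ⟧ + ⟦ x == y ⟧ ≤ ⟦ upper L x y ⟧
    A≤upper x y with x ≟ y
    ... | yes refl rewrite A-irr x | ==-refl (label L x) with removed L x
    ...   | true = ≤-refl
    ...   | false = ≤-refl
    A≤upper x y | no _ = ≤-trans (≤-reflexive (+-identityʳ _)) (⟦⟧-mono within)
      where
      within : A x y ≡ true → upper L x y ≡ true
      within a with bool? (removed L x) | bool? (removed L y)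
      ... | inj₁ e | _ rewrite e = refl
      ... | inj₂ e | inj₁ f rewrite e | f = refl
      ... | inj₂ e | inj₂ f rewrite e | f | val x y a e f = ==-refl (label L y)

    row : ∀ x → removed L x ≡ false → size (upper L x) ≡ s + N (label L x)
    row x e = trans (∑-cong pointwise) (∑-distrib-+ _ _)
      where
      pointwise : ∀ y → ⟦ upper L x y ⟧ ≡ ⟦ removed L y ⟧ + ⟦ cell L (label L x) y ⟧
      pointwise y rewrite e with removed L y
      ... | true = refl
      ... | false = cong ⟦_⟧ (==-sym (label L x) (label L y))

    -- A removed vertex is paired with all `n` vertices, any other with the `s` removed ones and its
    -- own cell. Since the diagonal is included, each cell contributes a full square.
    arcs-upper : ∑ (λ x → size (upper L x)) ≡ s * n + p * s + ∑ (λ i → N i * N i)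
    arcs-upper = begin
      ∑ (λ x → size (upper L x)) ≡⟨ ∑-cong pointwise ⟩
      ∑ (λ x → ⟦ removed L x ⟧ * n + ⟦ not (removed L x) ⟧ * s + ⟦ not (removed L x) ⟧ * N (label L x))
        ≡⟨ trans (∑-distrib-+ _ _) (cong (_+ ∑ (λ x → ⟦ not (removed L x) ⟧ * N (label L x))) (∑-distrib-+ _ _)) ⟩
      ∑ (λ x → ⟦ removed L x ⟧ * n) + ∑ (λ x → ⟦ not (removed L x) ⟧ * s) + ∑ (λ x → ⟦ not (removed L x) ⟧ * N (label L x))
        ≡⟨ cong₂ _+_ (cong₂ _+_ (sym (*-distribʳ-∑ n _)) (sym (*-distribʳ-∑ s _))) squares ⟩
      s * n + p * s + ∑ (λ i → N i * N i) ∎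
      where
      open ≡-Reasoning
      pointwise : ∀ x → size (upper L x) ≡ ⟦ removed L x ⟧ * n + ⟦ not (removed L x) ⟧ * s + ⟦ not (removed L x) ⟧ * N (label L x)
      pointwise x with bool? (removed L x)
      ... | inj₁ e rewrite e = trans (size-all n) (sym (trans (+-identityʳ _) (trans (+-identityʳ _) (+-identityʳ n))))
      ... | inj₂ e = trans (row x e) (sym (trans (cong (λ z → ⟦ z ⟧ * n + ⟦ not z ⟧ * s + ⟦ not z ⟧ * N (label L x)) e)
                       (cong₂ _+_ (+-identityʳ s) (+-identityʳ _))))
      squares : ∑ (λ x → ⟦ not (removed L x) ⟧ * N (label L x)) ≡ ∑ (λ i → N i * N i)
      squares = begin
        ∑ (λ x → ⟦ not (removed L x) ⟧ * N (label L x)) ≡⟨ ∑-cong (λ x → sym (∑-indicator (label L x) (λ i → ⟦ not (removed L x) ⟧ * N i))) ⟩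
        ∑ (λ x → ∑ λ i → ⟦ label L x == i ⟧ * (⟦ not (removed L x) ⟧ * N i)) ≡⟨ ∑-comm _ ⟩
        ∑ (λ i → ∑ λ x → ⟦ label L x == i ⟧ * (⟦ not (removed L x) ⟧ * N i)) ≡⟨ ∑-cong (λ i → trans (∑-cong λ x → cellwise x i) (sym (*-distribʳ-∑ (N i) _))) ⟩
        ∑ (λ i → N i * N i) ∎
        where
        cellwise : ∀ x i → ⟦ label L x == i ⟧ * (⟦ not (removed L x) ⟧ * N i) ≡ ⟦ cell L i x ⟧ * N i
        cellwise x i = trans (sym (*-assoc ⟦ label L x == i ⟧ ⟦ not (removed L x) ⟧ (N i))) (cong (_* N i)
          (trans (*-comm ⟦ label L x == i ⟧ ⟦ not (removed L x) ⟧) (sym (⟦∧⟧ (not (removed L x)) _))))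

    arcs+n : arcs A + n ≡ ∑ (λ x → ∑ λ y → ⟦ A x y ⟧ + ⟦ x == y ⟧)
    arcs+n = trans (cong (arcs A +_) (sym (trans (∑-cong λ x → ∑-indicator₁ x) (size-all n))))
      (trans (sym (∑-distrib-+ _ _)) (∑-cong λ x → sym (∑-distrib-+ _ _)))

    arcs≤ : arcs A + n ≤ s * n + p * s + ∑ (λ i → N i * N i)
    arcs≤ = ≤-trans (≤-reflexive arcs+n) (≤-trans (∑-mono λ x → ∑-mono (A≤upper x)) (≤-reflexive arcs-upper))

    -- A sum that reaches its termwise bound reaches it in every term, so no permitted edge is
    -- missing.
    arcs-equal : s * n + p * s + ∑ (λ i → N i * N i) ≤ arcs A + n → ∀ x y → ⟦ A x y ⟧ + ⟦ x == y ⟧ ≡ ⟦ upper L x y ⟧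
    arcs-equal ge x = ∑-≤⇒≗ (A≤upper x) (≤-reflexive (sym (∑-≤⇒≗ (λ x → ∑-mono (A≤upper x))
      (≤-trans (≤-reflexive arcs-upper) (≤-trans ge (≤-reflexive arcs+n))) x)))

    degree≤ : ∀ i x → cell L i x ≡ true → size (A x) + 1 ≤ s + N i
    degree≤ i x x∈ with cell-label L {i} x∈
    ... | e , refl = ≤-trans (≤-reflexive (trans (cong (size (A x) +_) (sym (∑-indicator₁ x))) (sym (∑-distrib-+ _ _))))
                       (≤-trans (∑-mono (A≤upper x)) (≤-reflexive (row x e)))

  -- Comparing edge counts

  -- Here `x` is how far the cut size `s` lies below the minimum degree, `1 + x` the least cell
  -- size, `1 + x + ρ` the large cell and `t₀ + y` the total of the small ones. The right-hand side
  -- counts `spoke (s + x) (1 + ρ + y) t₀` on the same number of vertices; the difference is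
  -- explicit, and `(t₀ + y) * x` makes it positive.
  small-cut : ∀ s x ρ t₀ y → 1 ≤ x → 1 ≤ t₀ →
    s * (s + ((1 + x + ρ) + (t₀ + y))) + ((1 + x + ρ) + (t₀ + y)) * s + ((1 + x + ρ) * (1 + x + ρ) + (1 + x) * (t₀ + y)) <
    (s + x) * (s + ((1 + x + ρ) + (t₀ + y))) + ((1 + ρ + y) + t₀) * (s + x) + (1 + ρ + y) * (1 + ρ + y) + t₀
  small-cut s x ρ t₀ y 1≤x 1≤t₀ = <-≤-trans (m<m+n _ positive) (≤-reflexive (identity s x ρ t₀ y))
    where
    identity : ∀ s x ρ t₀ y →
      s * (s + ((1 + x + ρ) + (t₀ + y))) + ((1 + x + ρ) + (t₀ + y)) * s + ((1 + x + ρ) * (1 + x + ρ) + (1 + x) * (t₀ + y))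
        + (2 * ρ * y + y * (y + 1) + (t₀ + y) * x) ≡
      (s + x) * (s + ((1 + x + ρ) + (t₀ + y))) + ((1 + ρ + y) + t₀) * (s + x) + (1 + ρ + y) * (1 + ρ + y) + t₀
    identity = solve-∀
    positive : 0 < 2 * ρ * y + y * (y + 1) + (t₀ + y) * x
    positive = ≤-trans (*-mono-≤ (≤-trans 1≤t₀ (m≤m+n t₀ y)) 1≤x) (m≤n+m _ _)

  balance : ∀ {u v y z} → y < z → u + z ≡ v + y → u < v
  balance {u} {v} {y} {z} y<z e = +-cancelʳ-< y u v (<-≤-trans (+-monoʳ-< u y<z) (≤-reflexive e))

  -- The cut has `x` vertices more than `δ` and leaves one cell of size `r` and `t₀ + b * x`
  -- singletons. The difference of the two counts is divisible by `x`; the hypothesis is the sign of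
  -- the quotient.
  large-cut : ∀ b δ x r t₀ → 1 ≤ x →
    2 * t₀ + b * t₀ + b * (t₀ + b * x) + b < 2 * b * (r + (t₀ + b * x)) →
    (δ + x) * (δ + x + (r + (t₀ + b * x))) + (r + (t₀ + b * x)) * (δ + x) + (r * r + (t₀ + b * x)) <
    δ * (δ + x + (r + (t₀ + b * x))) + ((x + r + b * x) + t₀) * δ + (x + r + b * x) * (x + r + b * x) + t₀
  large-cut b δ (suc x) r t₀ _ lt = balance (*-monoʳ-< (suc x) lt) (identity b δ (suc x) r t₀)
    where
    identity : ∀ b δ x r t₀ →
      (δ + x) * (δ + x + (r + (t₀ + b * x))) + (r + (t₀ + b * x)) * (δ + x) + (r * r + (t₀ + b * x))
        + x * (2 * b * (r + (t₀ + b * x))) ≡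
      δ * (δ + x + (r + (t₀ + b * x))) + ((x + r + b * x) + t₀) * δ + (x + r + b * x) * (x + r + b * x) + t₀
        + x * (2 * t₀ + b * t₀ + b * (t₀ + b * x) + b)
    identity = solve-∀

  -- p ≥ t + 1 settles large x, the lower bound on n settles small x, and x ≥ 1 leaves no gap.
  large-cut-bound : ∀ b k d x p → 1 ≤ b → 1 ≤ x → suc (b * (d + x) + 1) ≤ p →
    b * (b + 5) * (k + d) + b + 5 ≤ b * (k + d + x + p) + b * (b + 4) * k + b * b →
    2 * (b * d + 1) + b * (b * d + 1) + b * ((b * d + 1) + b * x) + b < 2 * b * p
  large-cut-bound b k d (suc x) p 1≤b _ p-large n-large = begin-strict
    2 * (b * d + 1) + b * (b * d + 1) + b * ((b * d + 1) + b * suc x) + b ≡⟨ regroup b d x ⟩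
    -- The two copies of `b * p` on the other side are used separately: `key` bounds the first
    -- summand, `p-large` the second.
    (b + 2) * (b * d + 1) + b * suc (b * (d + suc x) + 1) <⟨ +-mono-<-≤ key (*-monoʳ-≤ b p-large) ⟩
    b * p + b * p ≡⟨ double b p ⟩
    2 * b * p ∎
    where
    open ≤-Reasoning
    regroup : ∀ b d x → 2 * (b * d + 1) + b * (b * d + 1) + b * ((b * d + 1) + b * suc x) + b ≡
      (b + 2) * (b * d + 1) + b * suc (b * (d + suc x) + 1)
    regroup = solve-∀
    double : ∀ b p → b * p + b * p ≡ 2 * b * p
    double = solve-∀
    -- Were it false, adding `b` times `p-large` to `n-large` and estimating both occurrences of
    -- `b * p` would leave `b * b * x + 1 ≤ b * x` up to common terms.
    key : (b + 2) * (b * d + 1) < b * p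
    key = ≰⇒> λ p-small → <-irrefl refl (begin-strict
      b * b * x + b * b + b                     ≡⟨ +-identityʳ _ ⟨
      b * b * x + b * b + b + 0                 <⟨ +-monoʳ-< (b * b * x + b * b + b) (s≤s z≤n) ⟩
      b * b * x + b * b + b + 1                 ≤⟨ +-cancelˡ-≤ (b * b * d + b + 4 + (b * b * k + 5 * b * k + b * b * d + 5 * b * d + b)) _ _ (begin
        (b * b * d + b + 4 + (b * b * k + 5 * b * k + b * b * d + 5 * b * d + b)) + (b * b * x + b * b + b + 1) ≡⟨ lower b k d x ⟩
        b * suc (b * (d + suc x) + 1) + (b * (b + 5) * (k + d) + b + 5) ≤⟨ +-mono-≤ (≤-trans (*-monoʳ-≤ b p-large) p-small) (≤-trans n-large (≤-reflexive (expand b k d x p))) ⟩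
        (b + 2) * (b * d + 1) + (b * p + (b * (k + d + suc x) + b * (b + 4) * k + b * b)) ≤⟨ +-monoʳ-≤ ((b + 2) * (b * d + 1)) (+-monoˡ-≤ _ p-small) ⟩
        (b + 2) * (b * d + 1) + ((b + 2) * (b * d + 1) + (b * (k + d + suc x) + b * (b + 4) * k + b * b)) ≡⟨ higher b k d x ⟩
        (b * b * d + b + 4 + (b * b * k + 5 * b * k + b * b * d + 5 * b * d + b)) + (b * x + b * b + b) ∎) ⟩
      b * x + b * b + b                         ≤⟨ +-monoˡ-≤ b (+-monoˡ-≤ (b * b) (*-monoˡ-≤ x (≤-trans (≤-reflexive (sym (*-identityʳ b))) (*-monoʳ-≤ b 1≤b)))) ⟩
      b * b * x + b * b + b                     ∎)
      where
      lower : ∀ b k d x → (b * b * d + b + 4 + (b * b * k + 5 * b * k + b * b * d + 5 * b * d + b)) + (b * b * x + b * b + b + 1) ≡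
        b * suc (b * (d + suc x) + 1) + (b * (b + 5) * (k + d) + b + 5)
      lower = solve-∀
      expand : ∀ b k d x p → b * (k + d + suc x + p) + b * (b + 4) * k + b * b ≡ b * p + (b * (k + d + suc x) + b * (b + 4) * k + b * b)
      expand = solve-∀
      higher : ∀ b k d x → (b + 2) * (b * d + 1) + ((b + 2) * (b * d + 1) + (b * (k + d + suc x) + b * (b + 4) * k + b * b)) ≡
        (b * b * d + b + 4 + (b * b * k + 5 * b * k + b * b * d + 5 * b * d + b)) + (b * x + b * b + b)
      higher = solve-∀

  -- Minimum degree, nonempty cells and the case of equality

  ∉⇒lookup : ∀ {n} {X : Subset n} {v} → v ∉ X → Vec.lookup X v ≡ false
  ∉⇒lookup {X = X} {v} v∉ = ¬true λ e → v∉ (lookup⇒[]= v X e)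

  lookup⇒∉ : ∀ {n} {X : Subset n} {v} → Vec.lookup X v ≡ false → v ∉ X
  lookup⇒∉ e v∈ = true≢false (trans (sym ([]=⇒lookup v∈)) e)

  -- Let `v` have minimum degree. If `δ ≤ k`, the neighbourhood of `v` is too small to separate, yet
  -- removing it isolates `v`; so no further vertex exists and `n` is at most `suc k`.
  connected⇒k<δ : ∀ {n k δ} (G : Graph n) → IsConnectedK (suc k) G → IsMinDegree G δ → k < δ
  connected⇒k<δ {n} {k} {δ} G (k+1<n , connected) (_ , v , deg-v) = ≰⇒> λ δ≤k → absurd δ≤k
    where
    X : Subset n
    X = Vec.tabulate (adj G v)
    inX : ∀ w → Vec.lookup X w ≡ adj G v w
    inX = lookup∘tabulate (adj G v)
    size-v : size (adj G v) ≡ δ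
    size-v = trans (sym (deg≡size (adj G) v)) deg-v
    stuck : ∀ {w} → Reach G X v w → v ≡ w
    stuck here = refl
    stuck (step a v∉ _) = ⊥-elim (v∉ (lookup⇒[]= _ X (trans (inX _) a)))
    absurd : δ ≤ k → ⊥
    absurd δ≤k with any? (λ w → (adj G v w ∨ (v == w)) Bool.≟ false)
    ... | yes (w , e) = true≢false (trans (sym (==-refl v)) (trans (cong (v ==_) (stuck reach)) (proj₂ (∨-false {adj G v w} e))))
      where
      reach : Reach G X v w
      reach = connected X (s≤s (≤-trans (≤-reflexive (trans (∣∣≡size X) (trans (∑-cong λ w → cong ⟦_⟧ (inX w)) size-v))) δ≤k)) v w
        (lookup⇒∉ (trans (inX v) (irrefl G v))) (lookup⇒∉ (trans (inX w) (proj₁ (∨-false {adj G v w} e))))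
    ... | no none = <⇒≱ k+1<n (begin
        n                                      ≡⟨ size-all n ⟨
        size (λ (_ : Fin n) → true)            ≤⟨ ∑-mono covered ⟩
        ∑ (λ w → ⟦ v == w ⟧ + ⟦ adj G v w ⟧)   ≡⟨ ∑-distrib-+ _ _ ⟩
        ∑ (λ w → ⟦ v == w ⟧) + size (adj G v)  ≡⟨ cong₂ _+_ (∑-indicator₁ v) size-v ⟩
        suc δ                                  ≤⟨ s≤s δ≤k ⟩
        suc k                                  ∎)
      where
      open ≤-Reasoning
      covered : ∀ w → 1 ≤ ⟦ v == w ⟧ + ⟦ adj G v w ⟧
      covered w with adj G v w | v == w | none ∘ (w ,_)
      ... | true | false | _ = ≤-refl
      ... | true | true | _ = s≤s z≤n
      ... | false | true | _ = ≤-refl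
      ... | false | false | h = ⊥-elim (h refl)

  two-positive : ∀ {l} (N : Fin l → ℕ) → 2 ≤ ∑ (λ i → pos (N i)) → ∃ λ i → ∃ λ j → i ≢ j × 0 < N i × 0 < N j
  two-positive N two with any? (λ i → 1 ≤? N i)
  ... | no ¬p = ⊥-elim (n≮0 (≤-trans two (≤-reflexive (∑-zero λ i → cong pos (n≤0⇒n≡0 (≮⇒≥ λ lt → ¬p (i , lt)))))))
  ... | yes (i , Ni) with any? (λ j → 1 ≤? ⟦ not (i == j) ⟧ * N j)
  ...   | yes (j , p) = i , j , differ p
    where
    differ : 1 ≤ ⟦ not (i == j) ⟧ * N j → i ≢ j × 0 < N i × 0 < N j
    differ p with i ≟ j
    ... | no i≢j = i≢j , Ni , ≤-trans p (≤-reflexive (+-identityʳ _))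
  ...   | no ¬p = ⊥-elim (<⇒≱ two (≤-trans (∑-mono single) (≤-reflexive (∑-indicator₁ i))))
    where
    single : ∀ j → pos (N j) ≤ ⟦ i == j ⟧
    single j with i == j | N j | ¬p ∘ (j ,_)
    ... | true | zero | _ = z≤n
    ... | true | suc _ | _ = ≤-refl
    ... | false | zero | _ = z≤n
    ... | false | suc _ | h = ⊥-elim (h (s≤s z≤n))

  -- All excess `ρ` over the least possible total is credited to a single part, which prepares the
  -- extreme configuration of `Squares`.
  parts-total : ∀ {l} (N : Fin l → ℕ) m t → (∀ i → 0 < N i → m ≤ N i) → 1 + t ≤ ∑ (λ i → pos (N i)) →
    Σ ℕ λ ρ → ∑ N ≡ (m + ρ) + t * m
  parts-total N m t m≤N many = let (ρ , e) = m≤n⇒∃[o]m+o≡n bound in ρ , trans (sym e) (regroup m t ρ)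
    where
    open ≤-Reasoning
    bound : m * (1 + t) ≤ ∑ N
    bound = begin
      m * (1 + t)                  ≤⟨ *-monoʳ-≤ m many ⟩
      m * ∑ (λ i → pos (N i))      ≡⟨ *-distribˡ-∑ m _ ⟩
      ∑ (λ i → m * pos (N i))      ≤⟨ ∑-mono (λ i → *-pos-≤ m (N i) (m≤N i)) ⟩
      ∑ N                          ∎
    regroup : ∀ m t ρ → m * (1 + t) + ρ ≡ (m + ρ) + t * m
    regroup = solve-∀

  %2-*-odd : ∀ b a → b % 2 ≡ 1 → (b * a) % 2 ≡ a % 2
  %2-*-odd b a odd = trans (%-distribˡ-* b a 2) (trans (cong (λ z → (z * (a % 2)) % 2) odd)
    (trans (cong (_% 2) (+-identityʳ (a % 2))) (m%n%n≡m%n a 2)))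

  ⟦⟧-injective : ∀ {a c} → ⟦ a ⟧ ≡ ⟦ c ⟧ → a ≡ c
  ⟦⟧-injective {true} {true} _ = refl
  ⟦⟧-injective {false} {false} _ = refl

  odd-positive : ∀ b → b % 2 ≡ 1 → 1 ≤ b
  odd-positive (suc b) _ = s≤s z≤n

  -- With `d` for the difference of `δ` and `k`, and `n` written as a sum of the parts, the
  -- truncated subtraction is exact.
  cliqueSize-value : ∀ b k d c {n δ} → δ ≡ k + d → n ≡ δ + (c + (b * d + 1)) → cliqueSize n b k δ ≡ c
  cliqueSize-value b k d c refl refl =
    trans (cong (_∸ ((b + 1) * (k + d) + 1)) (regroup b k d c)) (m+n∸n≡m c ((b + 1) * (k + d) + 1))
    where
    regroup : ∀ b k d c → (k + d) + (c + (b * d + 1)) + b * k ≡ c + ((b + 1) * (k + d) + 1)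
    regroup = solve-∀

  indepSize-value : ∀ b k d {δ} → δ ≡ k + d → indepSize b k δ ≡ b * d + 1
  indepSize-value b k d refl =
    cong (_+ 1) (trans (cong (_∸ b * k) (trans (*-distribˡ-+ b k d) (+-comm (b * k) _))) (m+n∸n≡m (b * d) (b * k)))

  -- Removed vertices form the core, cell `i₀` the clique, and the rest is independent: two vertices
  -- with a common label outside `i₀` would make a cell of size at least 2.
  saturated-iso : ∀ {n} (G : Graph n) (L : Labelling n) δ r t i₀ →
    (∀ x y → ⟦ adj G x y ⟧ + ⟦ x == y ⟧ ≡ ⟦ upper L x y ⟧) → size (removed L) ≡ δ →
    size (cell L i₀) ≡ r → (∀ j → i₀ ≢ j → size (cell L j) ≤ 1) → n ≡ δ + (r + t) → Iso G (spoke δ r t)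
  saturated-iso {n} G L δ r t i₀ full s≡δ i₀-size small n-eq = coloured-iso G δ r t τ adj-τ counts
    where
    τ : Fin n → Fin 3
    τ x = if removed L x then core else if label L x == i₀ then clique else pendant
    upper-τ : ∀ x y → x ≢ y → upper L x y ≡ linked (τ x) (τ y)
    upper-τ x y x≢y = go (removed L x) (removed L y) refl refl
      where
      inside : ∀ z → removed L z ≡ false → cell L (label L z) z ≡ true
      inside z rz = cong₂ _∧_ (cong not rz) (==-refl (label L z))
      go : ∀ rx ry → removed L x ≡ rx → removed L y ≡ ry →
        (rx ∨ (ry ∨ (label L x == label L y))) ≡
        linked (if rx then core else if label L x == i₀ then clique else pendant) (if ry then core else if label L y == i₀ then clique else pendant)
      go true _ _ _ = refl
      go false true _ _ = sym (linked-core _)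
      go false false ex ey with label L x ≟ i₀ | label L y ≟ i₀
      ... | yes refl | yes e = trans (cong (label L x ==_) e) (==-refl (label L x))
      ... | yes refl | no ne = ≢⇒== (ne ∘ sym)
      ... | no ne | yes refl = ≢⇒== ne
      ... | no ne | no _ = ≢⇒== λ e → <⇒≱ (size-pair (cell L (label L x)) x≢y (inside x ex)
              (subst (λ z → cell L z y ≡ true) (sym e) (inside y ey))) (small (label L x) (ne ∘ sym))
    adj-τ : ∀ x y → adj G x y ≡ (not (x == y) ∧ linked (τ x) (τ y))
    adj-τ x y = by-cases (x ≟ y)
      where
      by-cases : Dec (x ≡ y) → adj G x y ≡ (not (x == y) ∧ linked (τ x) (τ y))
      by-cases (yes refl) = trans (irrefl G x) (sym (cong (λ z → not z ∧ linked (τ x) (τ x)) (==-refl x)))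
      by-cases (no x≢y) = trans (⟦⟧-injective (trans (sym (+-identityʳ _)) (trans (cong (λ z → ⟦ adj G x y ⟧ + ⟦ z ⟧) (sym (≢⇒== x≢y))) (full x y))))
        (trans (upper-τ x y x≢y) (sym (cong (λ z → not z ∧ linked (τ x) (τ y)) (≢⇒== x≢y))))
    count-core : colour-count τ core ≡ δ
    count-core = trans (∑-cong pointwise) s≡δ
      where
      pointwise : ∀ x → ⟦ τ x == core ⟧ ≡ ⟦ removed L x ⟧
      pointwise x with removed L x | label L x == i₀
      ... | true | _ = refl
      ... | false | true = refl
      ... | false | false = refl
    count-clique : colour-count τ clique ≡ r
    count-clique = trans (∑-cong pointwise) i₀-size
      where
      pointwise : ∀ x → ⟦ τ x == clique ⟧ ≡ ⟦ cell L i₀ x ⟧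
      pointwise x with removed L x | label L x == i₀
      ... | true | _ = refl
      ... | false | true = refl
      ... | false | false = refl
    count-pendant : colour-count τ pendant ≡ t
    count-pendant = +-cancelˡ-≡ r _ _ (+-cancelˡ-≡ δ _ _ (trans (cong₂ _+_ (sym count-core) (cong (_+ colour-count τ pendant) (sym count-clique)))
      (trans (trans (trans (cong (colour-count τ core +_) (sym (∑-distrib-+ _ _))) (sym (∑-distrib-+ _ _)))
        (trans (∑-cong pointwise) (size-all n))) n-eq)))
      where
      pointwise : ∀ x → ⟦ τ x == core ⟧ + (⟦ τ x == clique ⟧ + ⟦ τ x == pendant ⟧) ≡ 1
      pointwise x with τ x
      ... | core = refl
      ... | clique = refl
      ... | pendant = refl
    counts : ∀ i → colour-count τ i ≡ δ * ⟦ core == i ⟧ + (r * ⟦ clique == i ⟧ + t * ⟦ pendant == i ⟧)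
    counts core = trans count-core (only₀ δ r t)
      where
      only₀ : ∀ δ r t → δ ≡ δ * 1 + (r * 0 + t * 0)
      only₀ = solve-∀
    counts clique = trans count-clique (only₁ δ r t)
      where
      only₁ : ∀ δ r t → r ≡ δ * 0 + (r * 1 + t * 0)
      only₁ = solve-∀
    counts pendant = trans count-pendant (only₂ δ r t)
      where
      only₂ : ∀ δ r t → t ≡ δ * 0 + (r * 0 + t * 1)
      only₂ = solve-∀

  -- Excluding violations of the parity condition

  module Extremal (b k n δ : ℕ) (b-odd : b % 2 ≡ 1) (n≡k : n % 2 ≡ k % 2) (G : Graph n)
    (connected : IsConnectedK (suc k) G) (min-degree : IsMinDegree G δ)
    (n-large : b * (b + 5) * δ + b + 5 ≤ b * n + b * (b + 4) * k + b * b)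
    (dense : edges (extremal n b k δ) ≤ edges (adj G)) (¬iso : ¬ Iso G (extremal n b k δ)) where

    1≤b : 1 ≤ b
    1≤b = odd-positive b b-odd

    arcs≥ : ∀ d c → δ ≡ k + d → n ≡ δ + (c + (b * d + 1)) →
      δ * n + (c + (b * d + 1)) * δ + c * c + (b * d + 1) ≤ arcs (adj G) + n
    arcs≥ d c δ-eq n-eq = begin
      δ * n + (c + t₀) * δ + c * c + t₀            ≡⟨ cong (λ z → δ * z + (c + t₀) * δ + c * c + t₀) n-eq ⟩
      δ * (δ + (c + t₀)) + (c + t₀) * δ + c * c + t₀ ≡⟨ arcs-spoke δ c t₀ ⟨
      arcs (spoke δ c t₀) + (δ + (c + t₀))         ≡⟨ cong₂ _+_ (cong₂ (λ c t → arcs (spoke δ c t)) (sym (cliqueSize-value b k d c δ-eq n-eq)) (sym (indepSize-value b k d δ-eq))) (sym n-eq) ⟩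
      arcs (extremal n b k δ) + n                  ≡⟨ cong (_+ n) (double-edges (spoke-sym δ (cliqueSize n b k δ) (indepSize b k δ)) (spoke-irr δ (cliqueSize n b k δ) (indepSize b k δ))) ⟨
      edges (extremal n b k δ) + edges (extremal n b k δ) + n ≤⟨ +-monoˡ-≤ n (+-mono-≤ dense dense) ⟩
      edges (adj G) + edges (adj G) + n            ≡⟨ cong (_+ n) (double-edges (Graph.sym G) (irrefl G)) ⟩
      arcs (adj G) + n                             ∎
      where
      open ≤-Reasoning
      t₀ = b * d + 1

    module Cut (X : Subset n) (X-size : ∣ X ∣ ≡ k) where

      inX : Fin n → Bool
      inX = Vec.lookup X

      -- The value 0 discards `X`; elsewhere `b` is odd, so degrees of the parity of `b` that are at
      -- most `b` are those of an odd factor.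
      g : Fin n → ℕ
      g x = if inX x then 0 else b

      module Violated (L : Labelling n) (val : Valid (isolate (adj G) inX) L)
        (violated : weight g (removed L) < oddCells g L) where

        -- With `X` moved into the removed set the labelling is valid for `G` itself; as `g` is 0 on
        -- `X`, no weight changes.
        L⁺ : Labelling n
        L⁺ = record { labels = labels L ; removed = λ x → removed L x ∨ inX x ; label = label L }

        val⁺ : Valid (adj G) L⁺
        val⁺ x y a rx ry = val x y (cong₂ _∧_ a (cong₂ _∧_ (cong not (proj₂ px)) (cong not (proj₂ py)))) (proj₁ px) (proj₁ py)
          where
          px = ∨-false {removed L x} rx
          py = ∨-false {removed L y} ry

        open Count (adj G) (irrefl G) L⁺ val⁺

        weight-cell : ∀ i → weight g (cell L i) ≡ b * N i
        weight-cell i = trans (∑-cong pointwise) (sym (*-distribˡ-∑ b _))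
          where
          pointwise : ∀ x → ⟦ cell L i x ⟧ * g x ≡ b * ⟦ cell L⁺ i x ⟧
          pointwise x with removed L x | inX x
          ... | true | _ = sym (*-zeroʳ b)
          ... | false | true = trans (*-zeroʳ ⟦ label L x == i ⟧) (sym (*-zeroʳ b))
          ... | false | false = *-comm ⟦ label L x == i ⟧ b

        inX-size : size inX ≡ k
        inX-size = trans (sym (∣∣≡size X)) X-size

        weight-removed : weight g (removed L) + b * k ≡ b * s
        weight-removed = trans (cong (weight g (removed L) +_) (trans (cong (b *_) (sym inX-size)) (*-distribˡ-∑ b _)))
          (trans (sym (∑-distrib-+ _ _)) (trans (∑-cong pointwise) (sym (*-distribˡ-∑ b _))))
          where
          pointwise : ∀ x → ⟦ removed L x ⟧ * g x + b * ⟦ inX x ⟧ ≡ b * ⟦ removed L x ∨ inX x ⟧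
          pointwise x with removed L x | inX x
          ... | true | true = refl
          ... | true | false = trans (cong₂ _+_ (+-identityʳ b) (*-zeroʳ b)) (trans (+-identityʳ b) (sym (*-identityʳ b)))
          ... | false | _ = refl

        X⊆ : ∀ x → ⟦ inX x ⟧ ≤ ⟦ removed L⁺ x ⟧
        X⊆ x with removed L x
        ... | true = ⟦⟧≤1 (inX x)
        ... | false = ≤-refl

        k≤s : k ≤ s
        k≤s = ≤-trans (≤-reflexive (sym inX-size)) (∑-mono X⊆)

        -- The violation yields more than `b * e` odd cells. Since `n` and `k` have equal parity, so
        -- do `e` and the number of remaining vertices; hence the excess is even and at least 2.
        many : ∀ e → k + e ≡ s → 2 + b * e ≤ ∑ (λ i → pos (N i))
        many e k+e≡s = ≤-trans (parity-gap (<⇒≤ lt) (<⇒≢ lt) parity) (∑-mono λ i → %2≤pos (N i))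
          where
          odd-count : oddCells g L ≡ ∑ (λ i → N i % 2)
          odd-count = ∑-cong λ i → trans (cong (_% 2) (weight-cell i)) (%2-*-odd b (N i) b-odd)
          weight-e : weight g (removed L) ≡ b * e
          weight-e = +-cancelʳ-≡ (b * k) _ _ (trans weight-removed (trans (cong (b *_) (trans (sym k+e≡s) (+-comm k e))) (*-distribˡ-+ b e k)))
          lt : b * e < ∑ (λ i → N i % 2)
          lt = subst₂ _<_ weight-e odd-count violated
          parity : (b * e) % 2 ≡ ∑ (λ i → N i % 2) % 2
          parity = begin
            (b * e) % 2          ≡⟨ %2-*-odd b e b-odd ⟩
            e % 2                ≡⟨ %2-+-cancelˡ e p even ⟩
            p % 2                ≡⟨ cong (_% 2) ∑N≡p ⟨
            ∑ N % 2              ≡⟨ ∑-%2 N ⟨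
            ∑ (λ i → N i % 2) % 2 ∎
            where
            open ≡-Reasoning
            even : (e + p) % 2 ≡ 0
            even with %2-cases (e + p)
            ... | inj₁ z = z
            ... | inj₂ z = ⊥-elim (clash (%2-cases k))
              where
              flip : (1 + k % 2) % 2 ≡ k % 2
              flip = begin
                (1 + k % 2) % 2             ≡⟨ cong (_% 2) (+-comm 1 (k % 2)) ⟩
                (k % 2 + 1) % 2             ≡⟨ cong (λ u → (k % 2 + u) % 2) z ⟨
                (k % 2 + (e + p) % 2) % 2   ≡⟨ %2-+ k (e + p) ⟨
                (k + (e + p)) % 2           ≡⟨ cong (_% 2) (trans (sym (+-assoc k e p)) (trans (cong (_+ p) k+e≡s) s+p≡n)) ⟩
                n % 2                       ≡⟨ n≡k ⟩
                k % 2                       ∎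
              clash : k % 2 ≡ 0 ⊎ k % 2 ≡ 1 → ⊥
              clash (inj₁ q) = 1+n≢0 (trans (sym (cong (λ u → (1 + u) % 2) q)) (trans flip q))
              clash (inj₂ q) = 1+n≢0 (sym (trans (sym (cong (λ u → (1 + u) % 2) q)) (trans flip q)))

        -- The removed set is then exactly `X`, which is too small to separate `G`. Labels are
        -- constant along walks that avoid `X`, yet two cells are nonempty.
        no-cut-at-k : k ≡ s → ⊥
        no-cut-at-k k≡s with two-positive N (≤-trans (≤-reflexive (cong (2 +_) (sym (*-zeroʳ b)))) (many 0 (trans (+-identityʳ k) k≡s)))
        ... | i , j , i≢j , Ni , Nj with size-pos (cell L⁺ i) Ni | size-pos (cell L⁺ j) Nj
        ... | x , x∈ | y , y∈ with cell-label L⁺ {i} x∈ | cell-label L⁺ {j} y∈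
        ... | rx , refl | ry , refl = i≢j (same (proj₂ connected X (s≤s (≤-reflexive X-size)) x y (outside x rx) (outside y ry)) rx)
          where
          outside : ∀ z → removed L⁺ z ≡ false → z ∉ X
          outside z rz = lookup⇒∉ (proj₂ (∨-false {removed L z} rz))
          only-X : ∀ z → inX z ≡ removed L⁺ z
          only-X z = ⟦⟧-injective (∑-≤⇒≗ X⊆ (≤-reflexive (trans (sym k≡s) (sym inX-size))) z)
          same : ∀ {u w} → Reach G X u w → removed L⁺ u ≡ false → label L u ≡ label L w
          same here _ = refl
          same (step {v = v} a v∉ rest) ru = trans (val⁺ _ v a ru rv) (same rest rv)
            where
            rv : removed L⁺ v ≡ false
            rv = trans (sym (only-X v)) (∉⇒lookup v∉)

        module Sizes (e : ℕ) (k+e≡s : k + e ≡ s) where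

          -- One less than the number of nonempty cells in `many`: the cells of least size beside
          -- the large one.
          t = b * e + 1

          enough : 1 + t ≤ ∑ (λ i → pos (N i))
          enough = ≤-trans (≤-reflexive (cong suc (+-comm (b * e) 1))) (many e k+e≡s)

          arcs-bound : ∀ m ρ → (∀ i → 0 < N i → m ≤ N i) → ∑ N ≡ (m + ρ) + t * m →
            arcs (adj G) + n ≤ s * n + p * s + ((m + ρ) * (m + ρ) + t * (m * m))
          arcs-bound m ρ m≤N total = ≤-trans arcs≤ (+-monoʳ-≤ (s * n + p * s) (Squares.squares≤ N m t (m + ρ) m≤N total enough))

        -- Neighbours of a vertex lie in its cell or are removed, so a nonempty cell has at least 1 + δ - s vertices.
        below-δ : ∀ e x → k + suc e ≡ s → s + suc x ≡ δ → ⊥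
        below-δ e x k+e≡s s+x≡δ = absurd (parts-total N (2 + x) t m≤N enough)
          where
          open ≤-Reasoning
          open Sizes (suc e) k+e≡s
          m≤N : ∀ i → 0 < N i → 2 + x ≤ N i
          m≤N i Ni with size-pos (cell L⁺ i) Ni
          ... | v , v∈ = +-cancelˡ-≤ s _ _ (begin
            s + (2 + x)             ≡⟨ trans (+-suc s (suc x)) (trans (cong suc s+x≡δ) (+-comm 1 δ)) ⟩
            δ + 1                   ≤⟨ +-monoˡ-≤ 1 (≤-trans (proj₁ min-degree v) (≤-reflexive (deg≡size (adj G) v))) ⟩
            size (adj G v) + 1      ≤⟨ degree≤ i v v∈ ⟩
            s + N i                 ∎)
          t₀ = b * (suc e + suc x) + 1
          -- `t₀` is the number of independent vertices in the extremal graph. The `t` cells of size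
          -- `2 + x` hold `y` vertices more than that, and in the comparison these go into the
          -- clique.
          y = b * suc x * e + suc x
          tm : t * (2 + x) ≡ t₀ + y
          tm = identity b e x
            where
            identity : ∀ b e x → (b * suc e + 1) * (2 + x) ≡ (b * (suc e + suc x) + 1) + (b * suc x * e + suc x)
            identity = solve-∀
          δ-eq : δ ≡ k + (suc e + suc x)
          δ-eq = trans (sym s+x≡δ) (trans (cong (_+ suc x) (sym k+e≡s)) (+-assoc k (suc e) (suc x)))
          regroup : ∀ s x ρ t₀ y → s + ((2 + x + ρ) + (t₀ + y)) ≡ s + suc x + ((1 + ρ + y) + t₀)
          regroup = solve-∀
          absurd : (Σ ℕ λ ρ → ∑ N ≡ (2 + x + ρ) + t * (2 + x)) → ⊥
          absurd (ρ , total) = <-irrefl refl (begin-strict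
            arcs (adj G) + n ≤⟨ arcs-bound (2 + x) ρ m≤N total ⟩
            s * n + p * s + ((2 + x + ρ) * (2 + x + ρ) + t * ((2 + x) * (2 + x)))
              ≡⟨ cong (λ z → s * n + p * s + ((2 + x + ρ) * (2 + x + ρ) + z)) (trans (sym (*-assoc t (2 + x) (2 + x))) (trans (*-comm (t * (2 + x)) (2 + x)) (cong ((2 + x) *_) tm))) ⟩
            s * n + p * s + ((2 + x + ρ) * (2 + x + ρ) + (2 + x) * (t₀ + y))
              ≡⟨ cong₂ (λ u w → s * u + w * s + ((2 + x + ρ) * (2 + x + ρ) + (2 + x) * (t₀ + y))) n-eq p-eq ⟩
            s * (s + ((2 + x + ρ) + (t₀ + y))) + ((2 + x + ρ) + (t₀ + y)) * s + ((2 + x + ρ) * (2 + x + ρ) + (2 + x) * (t₀ + y))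
              <⟨ small-cut s (suc x) ρ t₀ y (s≤s z≤n) (m≤n+m 1 _) ⟩
            (s + suc x) * (s + ((2 + x + ρ) + (t₀ + y))) + ((1 + ρ + y) + t₀) * (s + suc x) + (1 + ρ + y) * (1 + ρ + y) + t₀
              ≡⟨ cong₂ (λ u w → w * u + ((1 + ρ + y) + t₀) * w + (1 + ρ + y) * (1 + ρ + y) + t₀) (sym n-eq) s+x≡δ ⟩
            δ * n + ((1 + ρ + y) + t₀) * δ + (1 + ρ + y) * (1 + ρ + y) + t₀
              ≤⟨ arcs≥ (suc e + suc x) (1 + ρ + y) δ-eq (trans n-eq (trans (regroup s x ρ t₀ y) (cong (_+ ((1 + ρ + y) + t₀)) s+x≡δ))) ⟩
            arcs (adj G) + n ∎)
            where
            p-eq : p ≡ (2 + x + ρ) + (t₀ + y)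
            p-eq = trans (sym ∑N≡p) (trans total (cong ((2 + x + ρ) +_) tm))
            n-eq : n ≡ s + ((2 + x + ρ) + (t₀ + y))
            n-eq = trans (sym s+p≡n) (cong (s +_) p-eq)

        -- Beyond `δ` the minimum degree no longer forces larger cells, so the comparison is with
        -- singletons, and the sign that `large-cut` requires comes from `n-large`.
        above-δ : ∀ d x → k + d ≡ δ → δ + suc x ≡ s → ⊥
        above-δ d x k+d≡δ δ+x≡s = absurd (parts-total N 1 t (λ _ q → q) enough)
          where
          open ≤-Reasoning
          e-eq : k + (d + suc x) ≡ s
          e-eq = trans (sym (+-assoc k d (suc x))) (trans (cong (_+ suc x) k+d≡δ) δ+x≡s)
          open Sizes (d + suc x) e-eq
          t₀ = b * d + 1
          t-eq : t ≡ t₀ + b * suc x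
          t-eq = identity b d (suc x)
            where
            identity : ∀ b d x → b * (d + x) + 1 ≡ b * d + 1 + b * x
            identity = solve-∀
          absurd : (Σ ℕ λ ρ → ∑ N ≡ (1 + ρ) + t * 1) → ⊥
          absurd (ρ , total) = <-irrefl refl (begin-strict
            arcs (adj G) + n ≤⟨ arcs-bound 1 ρ (λ _ q → q) total ⟩
            s * n + p * s + ((1 + ρ) * (1 + ρ) + t * (1 * 1))
              ≡⟨ cong (λ z → s * n + p * s + ((1 + ρ) * (1 + ρ) + z)) (trans (*-identityʳ t) t-eq) ⟩
            s * n + p * s + ((1 + ρ) * (1 + ρ) + (t₀ + b * suc x))
              ≡⟨ cong₂ (λ u w → s * u + w * s + ((1 + ρ) * (1 + ρ) + (t₀ + b * suc x))) (trans (sym s+p≡n) (cong (s +_) p-eq)) p-eq ⟩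
            s * (s + (1 + ρ + (t₀ + b * suc x))) + (1 + ρ + (t₀ + b * suc x)) * s + ((1 + ρ) * (1 + ρ) + (t₀ + b * suc x))
              ≡⟨ cong (λ u → u * (u + (1 + ρ + (t₀ + b * suc x))) + (1 + ρ + (t₀ + b * suc x)) * u + ((1 + ρ) * (1 + ρ) + (t₀ + b * suc x))) (sym δ+x≡s) ⟩
            (δ + suc x) * (δ + suc x + (1 + ρ + (t₀ + b * suc x))) + (1 + ρ + (t₀ + b * suc x)) * (δ + suc x) + ((1 + ρ) * (1 + ρ) + (t₀ + b * suc x))
              <⟨ large-cut b δ (suc x) (1 + ρ) t₀ (s≤s z≤n) gap ⟩
            δ * (δ + suc x + (1 + ρ + (t₀ + b * suc x))) + (c + t₀) * δ + c * c + t₀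
              ≡⟨ cong (λ u → δ * u + (c + t₀) * δ + c * c + t₀) (sym n-eq) ⟩
            δ * n + (c + t₀) * δ + c * c + t₀
              ≤⟨ arcs≥ d c (sym k+d≡δ) (trans n-eq (regroup δ x ρ t₀ (b * suc x))) ⟩
            arcs (adj G) + n ∎)
            where
            -- In the extremal graph of the same order, the `suc x` surplus removed vertices and the
            -- `b * suc x` surplus singletons belong to the clique.
            c = suc x + (1 + ρ) + b * suc x
            p-eq : p ≡ 1 + ρ + (t₀ + b * suc x)
            p-eq = trans (sym ∑N≡p) (trans total (cong (1 + ρ +_) (trans (*-identityʳ t) t-eq)))
            n-eq : n ≡ δ + suc x + (1 + ρ + (t₀ + b * suc x))
            n-eq = trans (sym s+p≡n) (cong₂ _+_ (sym δ+x≡s) p-eq)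
            regroup : ∀ δ x ρ t₀ y → δ + suc x + (1 + ρ + (t₀ + y)) ≡ δ + ((suc x + (1 + ρ) + y) + t₀)
            regroup = solve-∀
            gap : 2 * t₀ + b * t₀ + b * (t₀ + b * suc x) + b < 2 * b * (1 + ρ + (t₀ + b * suc x))
            gap = large-cut-bound b k d (suc x) (1 + ρ + (t₀ + b * suc x)) 1≤b (s≤s z≤n)
              (≤-trans (≤-reflexive (cong suc t-eq)) (s≤s (m≤n+m _ ρ)))
              (subst₂ (λ u w → b * (b + 5) * u + b + 5 ≤ b * w + b * (b + 4) * k + b * b) (sym k+d≡δ)
                (trans n-eq (cong (λ z → z + suc x + (1 + ρ + (t₀ + b * suc x))) (sym k+d≡δ))) n-large)

        -- The upper bound coincides with the extremal count, so `dense` leaves equality twice: in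
        -- the sum of squares, which fixes the cell sizes, and in `arcs≤`, which supplies every
        -- permitted edge.
        at-δ : ∀ d → k + d ≡ δ → δ ≡ s → ⊥
        at-δ d k+d≡δ δ≡s = absurd (parts-total N 1 t (λ _ q → q) enough)
          where
          e-eq : k + d ≡ s
          e-eq = trans k+d≡δ δ≡s
          open Sizes d e-eq
          absurd : (Σ ℕ λ ρ → ∑ N ≡ (1 + ρ) + t * 1) → ⊥
          absurd (ρ , total) = ¬iso (subst₂ (λ c t → Iso G (spoke δ c t)) (sym (cliqueSize-value b k d r (sym k+d≡δ) n-eq)) (sym (indepSize-value b k d (sym k+d≡δ)))
              (saturated-iso G L⁺ δ r t (proj₁ big) full (sym δ≡s) (proj₁ (proj₂ big)) (proj₂ (proj₂ big)) n-eq))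
            where
            r = suc ρ
            total′ : ∑ N ≡ r + t
            total′ = trans total (cong (r +_) (*-identityʳ t))
            p-eq : p ≡ r + t
            p-eq = trans (sym ∑N≡p) total′
            n-eq : n ≡ δ + (r + t)
            n-eq = trans (sym s+p≡n) (cong₂ _+_ (sym δ≡s) p-eq)
            lower : s * n + p * s + (r * r + t) ≤ arcs (adj G) + n
            lower = ≤-trans (≤-reflexive (trans (cong₂ (λ u w → u * n + w * u + (r * r + t)) (sym δ≡s) p-eq) (sym (+-assoc (δ * n + (r + t) * δ) (r * r) t))))
              (arcs≥ d r (sym k+d≡δ) n-eq)
            squares≥ : r * r + t ≤ ∑ (λ i → N i * N i)
            squares≥ = +-cancelˡ-≤ (s * n + p * s) _ _ (≤-trans lower arcs≤)
            squares≤ : ∑ (λ i → N i * N i) ≤ r * r + t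
            squares≤ = ≤-trans (Squares.squares≤ N 1 t r (λ _ q → q) total enough) (≤-reflexive (cong (r * r +_) (*-identityʳ t)))
            full : ∀ x y → ⟦ adj G x y ⟧ + ⟦ x == y ⟧ ≡ ⟦ upper L⁺ x y ⟧
            full = arcs-equal (≤-trans (+-monoʳ-≤ (s * n + p * s) squares≤) lower)
            big = largest-part N t ρ total′ enough squares≥

        contradiction : ⊥
        contradiction with m≤n⇒∃[o]m+o≡n k≤s | m≤n⇒∃[o]m+o≡n (<⇒≤ (connected⇒k<δ G connected min-degree))
        ... | zero , k≡s | _ = no-cut-at-k (trans (sym (+-identityʳ k)) k≡s)
        ... | suc e , k+e≡s | d , k+d≡δ with <-cmp s δ
        ...   | tri≈ _ s≡δ _ = at-δ d k+d≡δ (sym s≡δ)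
        ...   | tri< s<δ _ _ = let (x , q) = m≤n⇒∃[o]m+o≡n s<δ in below-δ e x k+e≡s (trans (+-suc s x) q)
        ...   | tri> _ _ δ<s = let (x , q) = m≤n⇒∃[o]m+o≡n δ<s in above-δ d x k+d≡δ (trans (+-suc δ x) q)

      tutte : Tutte (isolate (adj G) inX) g
      tutte L val = ≮⇒≥ λ violated → Violated.contradiction L val violated

      oddFactor : HasOddFactorMinus b G X
      oddFactor = F , F-sym , (λ x y f → proj₁ (∧-true (F⊆ x y f))) , avoids , degrees
        where
        found : ParityFactor (isolate (adj G) inX) g
        found = parityFactor-stable (parityFactor (suc (arcs (isolate (adj G) inX))) (isolate (adj G) inX) g
          (λ x y → cong₂ _∧_ (Graph.sym G x y) (∧-comm (not (inX x)) _)) (λ x → cong (_∧ (not (inX x) ∧ not (inX x))) (irrefl G x)) ≤-refl tutte)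
        F = proj₁ found
        F-sym = proj₁ (proj₂ found)
        F⊆ = proj₁ (proj₂ (proj₂ found))
        avoids : ∀ i j → i ∈ X → F i j ≡ false
        avoids i j i∈ = ¬true λ f → true≢false (trans (sym ([]=⇒lookup i∈)) (not-true (proj₁ (∧-true (proj₂ (∧-true {adj G i j} (F⊆ i j f)))))))
        degrees : ∀ v → v ∉ X → (deg F v % 2 ≡ 1) × (deg F v ≤ b)
        degrees v v∉ = subst₂ (λ z w → z % 2 ≡ w × z ≤ b) (sym (deg≡size F v)) b-odd
          (subst (λ w → size (F v) % 2 ≡ w % 2 × size (F v) ≤ w) (cong (λ z → if z then 0 else b) (∉⇒lookup v∉)) (proj₂ (proj₂ (proj₂ found)) v))

  -- The factor `b` clears the fraction in the bound on the order. Moving the negative terms across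
  -- leaves casts of natural numbers on both sides.
  order-bound : ∀ b k n δ →
    ((ℤ.+ b) ℤ.* ((ℤ.+ b) ℤ.+ (ℤ.+ 5)) ℤ.* (ℤ.+ δ) ℤ.- (ℤ.+ b) ℤ.* ((ℤ.+ b) ℤ.+ (ℤ.+ 4)) ℤ.* (ℤ.+ k)
      ℤ.- (ℤ.+ b) ℤ.* (ℤ.+ b) ℤ.+ (ℤ.+ b) ℤ.+ (ℤ.+ 5)) ℤ.≤ ((ℤ.+ b) ℤ.* (ℤ.+ n)) →
    b * (b + 5) * δ + b + 5 ≤ b * n + b * (b + 4) * k + b * b
  order-bound b k n δ h = ℤ.drop‿+≤+ (subst₂ ℤ._≤_
    (trans (cancel (ℤ.+ b) (ℤ.+ k) (ℤ.+ δ) (ℤ.+ 4) (ℤ.+ 5)) (cong (λ z → z ℤ.+ (ℤ.+ b) ℤ.+ (ℤ.+ 5)) (product b (b + 5) δ)))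
    (trans (cong₂ ℤ._+_ (sym (ℤ.pos-* b n)) (cong₂ ℤ._+_ (product b (b + 4) k) (sym (ℤ.pos-* b b))))
      (cong ℤ.+_ (sym (+-assoc (b * n) (b * (b + 4) * k) (b * b)))))
    (ℤ.+-monoˡ-≤ ((ℤ.+ b) ℤ.* ((ℤ.+ b) ℤ.+ (ℤ.+ 4)) ℤ.* (ℤ.+ k) ℤ.+ (ℤ.+ b) ℤ.* (ℤ.+ b)) h))
    where
    product : ∀ a c d → (ℤ.+ a) ℤ.* (ℤ.+ c) ℤ.* (ℤ.+ d) ≡ ℤ.+ (a * c * d)
    product a c d = sym (trans (ℤ.pos-* (a * c) d) (cong (ℤ._* (ℤ.+ d)) (ℤ.pos-* a c)))
    cancel : ∀ B K D u v → (B ℤ.* (B ℤ.+ v) ℤ.* D ℤ.- B ℤ.* (B ℤ.+ u) ℤ.* K ℤ.- B ℤ.* B ℤ.+ B ℤ.+ v)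
      ℤ.+ (B ℤ.* (B ℤ.+ u) ℤ.* K ℤ.+ B ℤ.* B) ≡ B ℤ.* (B ℤ.+ v) ℤ.* D ℤ.+ B ℤ.+ v
    cancel = ℤ-solve-∀

open import Defs
open import Data.Nat using (ℕ; suc; _≤_; _<_; _%_)
open import Data.Integer using (ℤ; +_; _+_; _-_; _*_) renaming (_≤_ to _≤ℤ_)
open import Data.Nat.Properties using (≤-trans; ≤-reflexive; +-comm)
open import Data.Product using (_,_; proj₁)
open import Relation.Nullary using (¬_)
open import Relation.Binary.PropositionalEquality using (_≡_)

theorem1p1 : (b k n : ℕ) → 0 < b → 0 < k → 0 < n →
  n % 2 ≡ k % 2 → b % 2 ≡ 1 →
  (G : Graph n) → IsConnectedK (suc k) G →
  (δ : ℕ) → IsMinDegree G δ →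
  (
    ((+ b) * (+ b) * (+ k) * (+ k) - (+ 2) * (+ b) * (+ b) * (+ k) * (+ δ)
      - (+ 4) * (+ b) * (+ b) * (+ k) - (+ b) * (+ k)
      + (+ b) * (+ b) * (+ δ) * (+ δ) + (+ 4) * (+ b) * (+ b) * (+ δ)
      + (+ 7) * (+ b) * (+ δ) + (+ b) * (+ b) + (+ 8) * (+ b) + (+ 1))
    ≤ℤ ((+ 6) * (+ b) * (+ n))) →
  (
    ((+ b) * ((+ b) + (+ 5)) * (+ δ) - (+ b) * ((+ b) + (+ 4)) * (+ k)
      - (+ b) * (+ b) + (+ b) + (+ 5))
    ≤ℤ ((+ b) * (+ n))) →
  edges (extremal n b k δ) ≤ edges (adj G) →
  ¬ Iso G (extremal n b k δ) →
  IsKCritical k b G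
theorem1p1 b k n _ _ _ n≡k b-odd G connected δ min-degree _ n-large dense ¬iso =
  -- The requirement on the order is the part `suc k < n` of connectivity.
  ≤-trans (≤-reflexive (+-comm k 2)) (proj₁ connected) ,
  OddFactors.Extremal.Cut.oddFactor b k n δ b-odd n≡k G connected min-degree
    (OddFactors.order-bound b k n δ n-large) dense ¬iso
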